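{- Define the formal power series \[\mathcal{G}(t;x,y,u,z)=\sum_{n\ge1}t^n\sum_{s\in\mathcal{A}_n}x^{\mathrm{rep}(s)}y^{\max(s)}u^{\mathrm{asc}(s)}z^{\mathrm{zero}(s)},\qquad \mathfrak{G}(t;x,y,u,v)=\sum_{n\ge1}t^n\sum_{s\in\mathcal{A}_n}x^{\mathrm{rep}(s)}y^{\max(s)}u^{\mathrm{asc}(s)}v^{\mathrm{rmin}(s)}.\] Then (i) $\mathcal{G}(t;x,y,u,z)=\mathcal{G}(t;u,z,x,y)$; (ii) with $r=t(x+u-xu)$, \[ \mathfrak{G}(t;x,y,u,v)=\frac{vyt}{1-vytu}+\sum_{m\ge0}\frac{rv(1-yr)(1-r)^m}{(x-xu+u(1-yr)(1-r)^m)(1-tuvy)}\prod_{i=0}^{m}\frac{x\bigl(1-(1-yr)(1-r)^i\bigr)\bigl(x-xu+u(1-yr)(1-r)^i\bigr)}{\bigl(x-u(x-1)(1-yr)(1-r)^i\bigr)\bigl(x-xu+u(1-rv)(1-yr)(1-r)^i\bigr)}; \] (iii) $\mathfrak{G}(t;x,y,u,v)=\mathfrak{G}(t;x,v,u,y)$. Equivalently, for every $n\ge1$ there are bijections $\beta_1,\beta_2,\beta_3:\mathcal{A}_n\to\mathcal{A}_n$ with, for all $s\in\mathcal{A}_n$, $(\mathrm{asc},\mathrm{rep},\mathrm{zero},\max)(s)=(\mathrm{rep},\mathrm{asc},\max,\mathrm{zero})(\beta_1(s))$, $(\mathrm{asc},\mathrm{rep},\max,\mathrm{rmin})(s)=(\mathrm{asc},\mathrm{rep},\mathrm{rmin},\max)(\beta_2(s))$,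 and $(\mathrm{asc},\mathrm{rep},\mathrm{zero},\mathrm{rmin})(s)=(\mathrm{rep},\mathrm{asc},\mathrm{rmin},\mathrm{zero})(\beta_3(s))$.
   Context: An inversion sequence of length $n$ is a sequence $s=(s_1,\dots,s_n)$ of integers with $0\le s_i<i$. For such $s$, $\mathrm{asc}(s)=|\{i\in[n-1]:s_i<s_{i+1}\}|$. An ascent sequence is an inversion sequence with $s_i\le \mathrm{asc}(s_1,\dots,s_{i-1})+1$ for $2\le i\le n$; $\mathcal{A}_n$ is the set of ascent sequences of length $n$. Statistics: $\mathrm{rep}(s)=n-|\{s_1,\dots,s_n\}|$; $\mathrm{zero}(s)=|\{i:s_i=0\}|$; $\max(s)=|\{i:s_i=i-1\}|$; $\mathrm{rmin}(s)=|\{s_i:s_i<s_j\text{ for all }j>i\}|$ (number of right-to-left minima). Identities are of formal power series in $t$. -}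

module Defs where

open import Level using (Level)
import Level
open import Data.Bool using (Bool; true; false; _∧_; if_then_else_)
open import Data.Nat using (ℕ; zero; suc; _∸_; _≤_; _<ᵇ_; _≤ᵇ_; _≡ᵇ_; _≟_) renaming (_+_ to _+ℕ_)
open import Data.List using (List; []; _∷_; _++_; [_]; map; concatMap; upTo; filterᵇ; length; deduplicate; foldr)
open import Data.List.Membership.Propositional using (_∈_)
open import Data.Product using (Σ; _×_; _,_; ∃-syntax)
open import Relation.Binary.PropositionalEquality using (_≡_)
open import Algebra.Bundles using (CommutativeRing)

invSeqs : ℕ → List (List ℕ)
invSeqs zero    = [] ∷ []
invSeqs (suc n) = concatMap (λ s → map (λ a → s ++ [ a ]) (upTo (suc n))) (invSeqs n)

asc : List ℕ → ℕ
asc []            = 0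
asc (a ∷ [])      = 0
asc (a ∷ b ∷ s)   = (if a <ᵇ b then 1 else 0) +ℕ asc (b ∷ s)

-- ascent condition: sᵢ ≤ asc(s₁ … s_{i-1}) + 1 for 2 ≤ i ≤ n;
-- go k p rest : k = asc of the prefix read so far, p = its last entry
private
  ascGo : ℕ → ℕ → List ℕ → Bool
  ascGo k p []       = true
  ascGo k p (a ∷ s)  = (a ≤ᵇ suc k) ∧ ascGo ((if p <ᵇ a then 1 else 0) +ℕ k) a s

isAscent : List ℕ → Bool
isAscent []      = true
isAscent (a ∷ s) = ascGo 0 a s

A : ℕ → List (List ℕ)
A n = filterᵇ isAscent (invSeqs n)

count : (ℕ → Bool) → List ℕ → ℕ
count p []      = 0
count p (a ∷ s) = (if p a then 1 else 0) +ℕ count p s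

rep : List ℕ → ℕ
rep s = length s ∸ length (deduplicate _≟_ s)

zeroSt : List ℕ → ℕ
zeroSt = count (λ a → a ≡ᵇ 0)

private
  maxGo : ℕ → List ℕ → ℕ
  maxGo j []      = 0
  maxGo j (a ∷ s) = (if a ≡ᵇ j then 1 else 0) +ℕ maxGo (suc j) s

maxSt : List ℕ → ℕ
maxSt = maxGo 0

allB : (ℕ → Bool) → List ℕ → Bool
allB p []      = true
allB p (a ∷ s) = p a ∧ allB p s

rminValues : List ℕ → List ℕ
rminValues []      = []
rminValues (a ∷ s) = if allB (λ b → a <ᵇ b) s then a ∷ rminValues s else rminValues s

rmin : List ℕ → ℕ
rmin s = length (deduplicate _≟_ (rminValues s))

BijOn : List (List ℕ) → (List ℕ → List ℕ) → Set
BijOn X β =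
  (∀ {s} → s ∈ X → β s ∈ X) ×
  (∀ {s s′} → s ∈ X → s′ ∈ X → β s ≡ β s′ → s ≡ s′) ×
  (∀ {s′} → s′ ∈ X → ∃[ s ] (s ∈ X × β s ≡ s′))

module Series {c ℓ : Level} (R : CommutativeRing c ℓ) where
  open CommutativeRing R hiding (zero)

  infixl 6 _−_
  _−_ : Carrier → Carrier → Carrier
  a − b = a + (- b)

  pow : Carrier → ℕ → Carrier
  pow a zero    = 1#
  pow a (suc k) = a * pow a k

  sumL : List Carrier → Carrier
  sumL = foldr _+_ 0#

  𝒢 : ℕ → Carrier → Carrier → Carrier → Carrier → Carrier
  𝒢 zero    x y u z = 0#
  𝒢 (suc n) x y u z =
    sumL (map (λ s → pow x (rep s) * pow y (maxSt s) * pow u (asc s) * pow z (zeroSt s))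
              (A (suc n)))

  𝔊 : ℕ → Carrier → Carrier → Carrier → Carrier → Carrier
  𝔊 zero    x y u v = 0#
  𝔊 (suc n) x y u v =
    sumL (map (λ s → pow x (rep s) * pow y (maxSt s) * pow u (asc s) * pow v (rmin s))
              (A (suc n)))

  PS : Set c
  PS = ℕ → Carrier

  const : Carrier → PS
  const a zero    = a
  const a (suc k) = 0#

  tPS : PS
  tPS zero          = 0#
  tPS (suc zero)    = 1#
  tPS (suc (suc k)) = 0#

  _⊕_ : PS → PS → PS
  (f ⊕ g) k = f k + g k

  ⊖_ : PS → PS
  (⊖ f) k = - (f k)

  _⊝_ : PS → PS → PS
  f ⊝ g = f ⊕ (⊖ g)

  _⊗_ : PS → PS → PS
  (f ⊗ g) n = sumL (map (λ k → f k * g (n ∸ k)) (upTo (suc n)))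

  infixl 6 _⊕_ _⊝_
  infixl 7 _⊗_

  powPS : PS → ℕ → PS
  powPS f zero    = const 1#
  powPS f (suc k) = f ⊗ powPS f k

  -- Multiplicative inverse of f, given w with w · f₀ = 1.
  -- invList f w n = [bₙ, …, b₀], b₀ = w, b_{n} = −w Σ_{j=1}^{n} f_j b_{n−j}.
  private
    dot : PS → ℕ → List Carrier → Carrier
    dot f k []       = 0#
    dot f k (b ∷ bs) = f k * b + dot f (suc k) bs

    invList : PS → Carrier → ℕ → List Carrier
    invList f w zero    = w ∷ []
    invList f w (suc n) = (- (w * dot f 1 (invList f w n))) ∷ invList f w n

    headOr0 : List Carrier → Carrier
    headOr0 []      = 0#
    headOr0 (b ∷ _) = b

  invPS : PS → Carrier → PS
  invPS f w n = headOr0 (invList f w n)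

  prodUpTo : (ℕ → PS) → ℕ → PS
  prodUpTo F zero    = F 0
  prodUpTo F (suc m) = prodUpTo F m ⊗ F (suc m)

  sumUpTo : (ℕ → PS) → ℕ → PS
  sumUpTo T zero    = T 0
  sumUpTo T (suc m) = sumUpTo T m ⊕ T (suc m)

  -- Right-hand side of (ii), with the sum over m truncated at M.
  -- w is an inverse of x − xu + u, the constant term of every
  -- denominator other than 1 − tuvy (whose constant term is 1).
  module RHS (x y u v w : Carrier) where
    X Y U V : PS
    X = const x
    Y = const y
    U = const u
    V = const v

    r : PS
    r = tPS ⊗ const (x + u − x * u)

    one : PS
    one = const 1#

    q : ℕ → PS
    q i = (one ⊝ Y ⊗ r) ⊗ powPS (one ⊝ r) i

    first : PS
    first = V ⊗ Y ⊗ tPS ⊗ invPS (one ⊝ V ⊗ Y ⊗ tPS ⊗ U) 1#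

    factor : ℕ → PS
    factor i =
      X ⊗ (one ⊝ q i) ⊗ (X ⊝ X ⊗ U ⊕ U ⊗ q i)
        ⊗ invPS (X ⊝ U ⊗ (X ⊝ one) ⊗ q i) w
        ⊗ invPS (X ⊝ X ⊗ U ⊕ U ⊗ (one ⊝ r ⊗ V) ⊗ q i) w

    term : ℕ → PS
    term m =
      r ⊗ V ⊗ q m
        ⊗ invPS (X ⊝ X ⊗ U ⊕ U ⊗ q m) w
        ⊗ invPS (one ⊝ tPS ⊗ U ⊗ V ⊗ Y) 1#
        ⊗ prodUpTo factor m

    rhs : ℕ → PS
    rhs M = first ⊕ sumUpTo term M

  Identity-i : Set (c Level.⊔ ℓ)
  Identity-i = ∀ (n : ℕ) (x y u z : Carrier) → 𝒢 n x y u z ≈ 𝒢 n u z x y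

  -- (ii): the infinite sum over m converges t-adically to 𝔊, i.e. each
  -- coefficient of tⁿ stabilises (at the value of 𝔊) for M large
  Identity-ii : Set (c Level.⊔ ℓ)
  Identity-ii = ∀ (x y u v w : Carrier) → w * (x − x * u + u) ≈ 1# →
    ∀ (n : ℕ) → ∃[ N ] (∀ (M : ℕ) → N ≤ M → 𝔊 n x y u v ≈ RHS.rhs x y u v w M n)

  Identity-iii : Set (c Level.⊔ ℓ)
  Identity-iii = ∀ (n : ℕ) (x y u v : Carrier) → 𝔊 n x y u v ≈ 𝔊 n x v u y

quad : ℕ → ℕ → ℕ → ℕ → ℕ × ℕ × ℕ × ℕ
quad a b c d = a , b , c , d

{-# OPTIONS --safe #-}
module Submission where

-- Read an ascent sequence from left to right and give every admissible value a weight: 1 before its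
-- first occurrence and x afterwards. The generating function of the continuations is affine in each of
-- these weights, and weight 0 amounts to deleting the value; comparing neighbouring states therefore
-- gives two-term recurrences governed by r = t(x + u − xu). Summing over the initial run 0, 1, 2, …,
-- whose length is max, turns them into a linear functional equation between Δ(y) and Δ(c(y)), where
-- 1 − c(y) r = (1 − y r)(1 − r). Iterating this equation is formula (ii).
--
-- Modulo a power of t the equation has only one solution. The operator acting on y commutes, up to
-- invertible factors, with its mirror image acting on the variable of rmin (or, after exchanging x and u,
-- of zero), and each operator sends the other's right-hand side to the same element. Hence the solution
-- satisfies both equations, which gives the symmetries max ↔ rmin with asc, rep and zero fixed, and
-- (asc, rep, zero, max) ↔ (rep, asc, max, zero); conjugating the second by the first gives the third
-- bijection. Equalities of polynomials over ℤ become bijections by comparing coefficients.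

open import Defs
open import Level using (0ℓ)
open import Data.Nat using (ℕ; _≤_)
open import Data.List.Membership.Propositional using (_∈_)
open import Data.Product using (Σ; _×_; _,_; ∃-syntax)
open import Relation.Binary.PropositionalEquality using (_≡_)
open import Algebra.Bundles using (CommutativeRing)

import Algebra.Properties.Ring as RingProperties
import Algebra.Properties.Semiring.Mult.TCOptimised as Mult
import Algebra.Solver.Ring as RingSolver
open import Algebra.Bundles using (RawRing)
open import Algebra.Solver.Ring.AlmostCommutativeRing using (fromCommutativeRing; _-Raw-AlmostCommutative⟶_)
open import Data.Bool as Bool using (Bool; true; false; _∧_; _∨_; if_then_else_; not)
open import Data.Bool.Properties using (T?)
open import Data.Empty using (⊥-elim)
open import Data.Integer as ℤ using (ℤ; +_; -[1+_])
import Data.Integer.Properties as ℤₚ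
open import Data.List using (List; []; _∷_; _++_; [_]; map; length; filter; filterᵇ; concatMap; upTo; applyUpTo; replicate; deduplicate; cartesianProductWith)
open import Data.List.Properties using (++-assoc; ++-identityʳ; filter-all; ≡-dec; ∷-injective; ∷ʳ-injective)
open import Data.List.Membership.Propositional.Properties using (∈-∃++)
open import Data.List.Relation.Binary.Permutation.Propositional using (_↭_; ↭-sym; ↭-trans; ↭-prep; ↭-refl; ↭⇒↭ₛ)
open import Data.List.Relation.Binary.Permutation.Propositional.Properties using (↭-map-inv; ∈-resp-↭; shift)
import Data.List.Relation.Binary.Permutation.Setoid.Properties as PermutationSetoid
open import Data.List.Relation.Unary.All as All using (All; []; _∷_)
import Data.List.Relation.Unary.All.Properties as Allₚ
open import Data.List.Relation.Unary.AllPairs using ([]; _∷_)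
open import Data.List.Relation.Unary.Any using (here; there)
open import Data.List.Relation.Unary.Unique.Propositional using (Unique)
import Data.List.Relation.Unary.Unique.Propositional.Properties as Uniqueₚ
open import Data.Maybe using (Maybe; just; nothing)
open import Data.Nat as ℕ using (zero; suc; _<_; z≤n; s≤s; _≤ᵇ_; _<ᵇ_; _≡ᵇ_; _∸_; _≟_)
import Data.Nat.Properties as ℕₚ
open import Data.Product using (proj₁; proj₂)
open import Data.Sum using (inj₁; inj₂)
open import Data.Unit using (⊤; tt)
open import Data.Vec as Vec using (Vec; []; _∷_)
open import Function using (_∘_)
open import Relation.Binary.PropositionalEquality as ≡ using (_≢_)
open import Relation.Nullary using (yes; no; ¬?)

-- Put y ∘ v = y + v - y v r. Then 1 - (y ∘ v) r = (1 - y r)(1 - v r), the operation is commutative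
-- and associative, and `c y` is 1 ∘ y. The coefficients of the functional equations are built from
-- it: `h y v` is 1 - t u (y ∘ v) and `m z y` is x (y ∘ z). This is why the operators commute; and
-- since r is symmetric in x and u, the law survives their exchange. The unknowns are split by
-- whether the lowest value recurs: if it does, it is a right-to-left minimum, so its factor v can
-- be taken out. The price is an auxiliary series `𝒦`, whose own equation refers back to the case z
-- = 1. In that case `𝒦` can be eliminated, so the symmetry at z = 1 comes first and supplies what
-- general z needs. The symmetries are claimed over every commutative ring, where neither r nor x +
-- u - x u can be cancelled. Only factors 1 - t a are ever cancelled there, and t is made nilpotent
-- by comparing series up to degree N: what is divisible by every power of t is then zero, and no
-- limit has to be taken.

-- The ascent condition and the fixed points as explicit recursions

bump : ℕ → ℕ → ℕ → ℕ
bump k p a = (if p <ᵇ a then 1 else 0) ℕ.+ k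

ascentFrom : ℕ → ℕ → List ℕ → Bool
ascentFrom k p []       = true
ascentFrom k p (a ∷ s)  = (a ≤ᵇ suc k) ∧ ascentFrom (bump k p a) a s

ascentFrom-unique : (f : ℕ → ℕ → List ℕ → Bool) → (∀ k p → f k p [] ≡ true) →
  (∀ k p a s → f k p (a ∷ s) ≡ (a ≤ᵇ suc k) ∧ f (bump k p a) a s) →
  ∀ k p s → f k p s ≡ ascentFrom k p s
ascentFrom-unique f b e k p [] = b k p
ascentFrom-unique f b e k p (a ∷ s) = ≡.trans (e k p a s) (≡.cong ((a ≤ᵇ suc k) ∧_) (ascentFrom-unique f b e (bump k p a) a s))

-- The helper functions of isAscent and maxSt are private, so their names are recovered by unification.
mutual
  ascGo : ℕ → ℕ → List ℕ → Bool
  ascGo = _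

  isAscent-step : ∀ a b s → isAscent (a ∷ b ∷ s) ≡ (b ≤ᵇ 1) ∧ ascGo (bump 0 a b) b s
  isAscent-step a b s with bump 0 a b
  ... | k = ≡.refl

isAscent-∷ : ∀ a b s → isAscent (a ∷ b ∷ s) ≡ ascentFrom 0 a (b ∷ s)
isAscent-∷ a b s = ≡.trans (isAscent-step a b s) (≡.cong ((b ≤ᵇ 1) ∧_) (ascentFrom-unique ascGo (λ _ _ → ≡.refl) (λ _ _ _ _ → ≡.refl) (bump 0 a b) b s))

fixedFrom : ℕ → List ℕ → ℕ
fixedFrom j [] = 0
fixedFrom j (a ∷ s) = (if a ≡ᵇ j then 1 else 0) ℕ.+ fixedFrom (suc j) s

fixedFrom-unique : (f : ℕ → List ℕ → ℕ) → (∀ j → f j [] ≡ 0) →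
  (∀ j a s → f j (a ∷ s) ≡ (if a ≡ᵇ j then 1 else 0) ℕ.+ f (suc j) s) →
  ∀ j s → f j s ≡ fixedFrom j s
fixedFrom-unique f b e j [] = b j
fixedFrom-unique f b e j (a ∷ s) = ≡.trans (e j a s) (≡.cong (λ i → _ ℕ.+ i) (fixedFrom-unique f b e (suc j) s))

mutual
  maxGo : ℕ → List ℕ → ℕ
  maxGo = _

  maxSt-step : ∀ a s → maxSt (a ∷ s) ≡ (if a ≡ᵇ 0 then 1 else 0) ℕ.+ maxGo 1 s
  maxSt-step a s with 1
  ... | w = ≡.refl

maxSt-∷ : ∀ a s → maxSt (a ∷ s) ≡ fixedFrom 0 (a ∷ s)
maxSt-∷ a s = ≡.trans (maxSt-step a s) (≡.cong (λ i → _ ℕ.+ i) (fixedFrom-unique maxGo (λ _ → ≡.refl) (λ _ _ _ → ≡.refl) 1 s))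

-- Polynomial identities with integer coefficients over any commutative ring

module IntegerSolver (R : CommutativeRing 0ℓ 0ℓ) where
  open CommutativeRing R
  open RingProperties ring
  open Mult semiring renaming (_×_ to _·_)
  open import Relation.Binary.Reasoning.Setoid setoid

  -- Equality of integers is decidable, that of an arbitrary ring is not; normal forms are compared
  -- through this map.
  fromℤ : ℤ → Carrier
  fromℤ (+ n)    = n · 1#
  fromℤ -[1+ n ] = - (suc n · 1#)

  private
    ℤ-ring : RawRing 0ℓ 0ℓ
    ℤ-ring = CommutativeRing.rawRing ℤₚ.+-*-commutativeRing

    ⊖-homo : ∀ m n → fromℤ (m ℤ.⊖ n) ≈ m · 1# - n · 1#
    ⊖-homo zero zero = sym (-‿inverseʳ 0#)
    ⊖-homo zero (suc n) = sym (+-identityˡ _)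
    ⊖-homo (suc m) zero = sym (trans (+-congˡ -0#≈0#) (+-identityʳ _))
    ⊖-homo (suc m) (suc n) = begin
      fromℤ (suc m ℤ.⊖ suc n)            ≡⟨ ≡.cong fromℤ (ℤₚ.[1+m]⊖[1+n]≡m⊖n m n) ⟩
      fromℤ (m ℤ.⊖ n)                    ≈⟨ ⊖-homo m n ⟩
      m · 1# - n · 1#                    ≈⟨ +-congʳ (+-identityˡ _) ⟨
      0# + m · 1# - n · 1#               ≈⟨ +-congʳ (+-congʳ (-‿inverseʳ 1#)) ⟨
      1# - 1# + m · 1# - n · 1#          ≈⟨ +-congʳ (+-assoc 1# (- 1#) _) ⟩
      1# + (- 1# + m · 1#) - n · 1#      ≈⟨ +-congʳ (+-congˡ (+-comm (- 1#) _)) ⟩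
      1# + (m · 1# - 1#) - n · 1#        ≈⟨ +-congʳ (+-assoc 1# _ _) ⟨
      1# + m · 1# - 1# - n · 1#          ≈⟨ +-assoc _ _ _ ⟩
      1# + m · 1# + (- 1# - n · 1#)      ≈⟨ +-cong (1+× m 1#) (sym (-‿+-comm 1# (n · 1#))) ⟨
      suc m · 1# - (1# + n · 1#)         ≈⟨ +-congˡ (-‿cong (1+× n 1#)) ⟨
      suc m · 1# - suc n · 1#            ∎

    neg-homo : ∀ i → fromℤ (ℤ.- i) ≈ - fromℤ i
    neg-homo (+ zero)  = sym -0#≈0#
    neg-homo (+ suc n) = refl
    neg-homo -[1+ n ]  = sym (-‿involutive _)

    +-homo′ : ∀ i j → fromℤ (i ℤ.+ j) ≈ fromℤ i + fromℤ j
    +-homo′ (+ m)    (+ n)    = ×-homo-+ 1# m n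
    +-homo′ (+ m)    -[1+ n ] = ⊖-homo m (suc n)
    +-homo′ -[1+ m ] (+ n)    = trans (⊖-homo n (suc m)) (+-comm _ _)
    +-homo′ -[1+ m ] -[1+ n ] = begin
      - (suc (suc (m ℕ.+ n)) · 1#)       ≡⟨ ≡.cong (λ k → - (suc k · 1#)) (ℕₚ.+-suc m n) ⟨
      - ((suc m ℕ.+ suc n) · 1#)         ≈⟨ -‿cong (×-homo-+ 1# (suc m) (suc n)) ⟩
      - (suc m · 1# + suc n · 1#)        ≈⟨ -‿+-comm _ _ ⟨
      - (suc m · 1#) - suc n · 1#        ∎

    +*-homo : ∀ m n → fromℤ (+ m ℤ.* + n) ≈ fromℤ (+ m) * fromℤ (+ n)
    +*-homo m n = begin
      fromℤ (+ m ℤ.* + n)      ≡⟨ ≡.cong fromℤ (ℤₚ.pos-* m n) ⟨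
      (m ℕ.* n) · 1#           ≈⟨ ×1-homo-* m n ⟩
      m · 1# * n · 1#          ∎

    *-homo′ : ∀ i j → fromℤ (i ℤ.* j) ≈ fromℤ i * fromℤ j
    *-homo′ (+ m) (+ n) = +*-homo m n
    *-homo′ (+ m) -[1+ n ] = begin
      fromℤ (+ m ℤ.* (ℤ.- (+ suc n)))     ≡⟨ ≡.cong fromℤ (ℤₚ.neg-distribʳ-* (+ m) (+ suc n)) ⟨
      fromℤ (ℤ.- (+ m ℤ.* + suc n))       ≈⟨ neg-homo (+ m ℤ.* + suc n) ⟩
      - fromℤ (+ m ℤ.* + suc n)           ≈⟨ -‿cong (+*-homo m (suc n)) ⟩
      - (m · 1# * suc n · 1#)             ≈⟨ -‿distribʳ-* _ _ ⟩
      m · 1# * - (suc n · 1#)             ∎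
    *-homo′ -[1+ m ] j = begin
      fromℤ ((ℤ.- (+ suc m)) ℤ.* j)       ≡⟨ ≡.cong fromℤ (ℤₚ.neg-distribˡ-* (+ suc m) j) ⟨
      fromℤ (ℤ.- (+ suc m ℤ.* j))         ≈⟨ neg-homo (+ suc m ℤ.* j) ⟩
      - fromℤ (+ suc m ℤ.* j)             ≈⟨ -‿cong (pos m j) ⟩
      - (suc m · 1# * fromℤ j)            ≈⟨ -‿distribˡ-* _ _ ⟩
      - (suc m · 1#) * fromℤ j            ∎
      where
      pos : ∀ m j → fromℤ (+ suc m ℤ.* j) ≈ suc m · 1# * fromℤ j
      pos m (+ n) = +*-homo (suc m) n
      pos m -[1+ n ] = *-homo′ (+ suc m) -[1+ n ]

    morphism : ℤ-ring -Raw-AlmostCommutative⟶ fromCommutativeRing R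
    morphism = record
      { ⟦_⟧ = fromℤ ; +-homo = +-homo′ ; *-homo = *-homo′ ; -‿homo = neg-homo
      ; 0-homo = refl ; 1-homo = refl }

    _coeff≟_ : ∀ i j → Maybe (fromℤ i ≈ fromℤ j)
    i coeff≟ j with i ℤ.≟ j
    ... | yes ≡.refl = just refl
    ... | no _       = nothing

  open RingSolver ℤ-ring (fromCommutativeRing R) morphism _coeff≟_ public
    using (solve; _:=_; _:+_; _:*_; _:-_; :-_; con; Polynomial)

-- Slot weights: a transfer model for continuations of ascent sequences

module WordModel (S : CommutativeRing 0ℓ 0ℓ) where
  open CommutativeRing S hiding (zero)
  open import Relation.Binary.Reasoning.Setoid setoid
  open IntegerSolver S

  -- A choice of the next value: `P` holds the slots below the chosen one, including any prefix not
  -- open to choice, and `Q` those above it.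
  splits : (List Carrier → Carrier → List Carrier → Carrier) → List Carrier → List Carrier → Carrier
  splits φ P []      = 0#
  splits φ P (c ∷ Q) = φ P c Q + splits φ (P ++ [ c ]) Q

  splits-cong : ∀ {φ ψ} → (∀ P c Q → φ P c Q ≈ ψ P c Q) → ∀ P Q → splits φ P Q ≈ splits ψ P Q
  splits-cong eq P []      = refl
  splits-cong eq P (c ∷ Q) = +-cong (eq P c Q) (splits-cong eq (P ++ [ c ]) Q)

  splits-∷ʳ : ∀ φ P A c → splits φ P (A ++ [ c ]) ≈ splits (λ P′ d Q → φ P′ d (Q ++ [ c ])) P A + φ (P ++ A) c []
  splits-∷ʳ φ P [] c = begin
    φ P c [] + 0#            ≈⟨ +-comm _ _ ⟩
    0# + φ P c []            ≡⟨ ≡.cong (λ L → 0# + φ L c []) (++-identityʳ P) ⟨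
    0# + φ (P ++ []) c []    ∎
  splits-∷ʳ φ P (a ∷ A) c = begin
    φ P a (A ++ [ c ]) + splits φ (P ++ [ a ]) (A ++ [ c ])                  ≈⟨ +-congˡ (splits-∷ʳ φ (P ++ [ a ]) A c) ⟩
    φ P a (A ++ [ c ]) + (s + φ ((P ++ [ a ]) ++ A) c [])                    ≈⟨ +-assoc _ _ _ ⟨
    φ P a (A ++ [ c ]) + s + φ ((P ++ [ a ]) ++ A) c []                      ≡⟨ ≡.cong (λ L → φ P a (A ++ [ c ]) + s + φ L c []) (++-assoc P [ a ] A) ⟩
    φ P a (A ++ [ c ]) + s + φ (P ++ a ∷ A) c []                             ∎
    where s = splits (λ P′ d Q → φ P′ d (Q ++ [ c ])) (P ++ [ a ]) A

  module Weights (x u v : Carrier) where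

    -- A state (L , R) lists the weights of the admissible values up to, respectively above, the last
    -- entry. Moving to a value resets its weight to x; moving into R is an ascent (weight u), which makes
    -- one more value admissible. The term g accounts for continuations that avoid all values ≤ the new entry.
    move : (List Carrier → List Carrier → Carrier) → (List Carrier → Carrier) →
           List Carrier → List Carrier → Carrier → List Carrier → Carrier
    move f g W P c Q = c * (f (P ++ [ x ]) (Q ++ W) + g (Q ++ W))

    step : (List Carrier → List Carrier → Carrier) → (List Carrier → Carrier) →
           List Carrier → List Carrier → Carrier
    step f g L R = splits (move f g R) [] L + u * splits (move f g [ 1# ]) L R

    -- The new entry is a right-to-left minimum exactly for the continuations that avoid all values
    -- up to it, that is, for empty `L`. Adding v - 1 times these turns their factor 1 into v.
    tail≥ : ℕ → List Carrier → List Carrier → Carrier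
    tail≥ zero    L R = 1#
    tail≥ (suc n) L R = step (tail≥ n) (λ W → (v - 1#) * tail≥ n [] W) L R

    -- Continuations using an additional lowest value of weight x z; since this value is then a
    -- right-to-left minimum, they are counted with v to the power rmin − 1.
    tail∋0 : Carrier → ℕ → List Carrier → List Carrier → Carrier
    tail∋0 z zero    L R = 0#
    tail∋0 z (suc n) L R = x * z * (tail∋0 z n [] (L ++ R) + tail≥ n [] (L ++ R)) + step (tail∋0 z n) (λ _ → 0#) L R

    used : ℕ → List Carrier
    used k = replicate k x

    -- Here the entries so far are 0, 1, …, i, so the next entry may be another maximal one (weight y).
    run∋0 : Carrier → Carrier → ℕ → ℕ → Carrier
    run∋0 z y zero    i = 0#
    run∋0 z y (suc n) i =
      u * y * run∋0 z y n (suc i) +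
      (x * z * (tail∋0 z n [] (used i ++ [ 1# ]) + tail≥ n [] (used i ++ [ 1# ]))
        + splits (move (tail∋0 z n) (λ _ → 0#) [ 1# ]) [] (used i))

    -- When no value of the run is used again, the next entry has to prolong the run. It becomes the
    -- new lowest value, with 1 in place of z because it is not 0.
    run≥ : Carrier → ℕ → Carrier
    run≥ y zero    = 1#
    run≥ y (suc n) = u * y * v * (run∋0 1# y n 0 + run≥ y n)

    total : Carrier → Carrier → ℕ → Carrier
    total z y n = z * y * v * (run∋0 z y n 0 + run≥ y n)

    used-∷ʳ : ∀ k → used k ++ [ x ] ≡.≡ used (suc k)
    used-∷ʳ zero    = ≡.refl
    used-∷ʳ (suc k) = ≡.cong (x ∷_) (used-∷ʳ k)

    used-x∷ : ∀ k W → used k ++ x ∷ W ≡.≡ used (suc k) ++ W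
    used-x∷ k W = ≡.trans (≡.sym (++-assoc (used k) [ x ] W)) (≡.cong (_++ W) (used-∷ʳ k))

    -- β, γ and α are the values at slot weight 1, slot deleted (weight 0) and slot weight x.
    Affine : Carrier → Carrier → Carrier → Set
    Affine α β γ = α + x * γ ≈ x * β + γ

    affine-const : ∀ {α} → Affine α α α
    affine-const = +-comm _ _

    affine-+ : ∀ {α β γ α′ β′ γ′} → Affine α β γ → Affine α′ β′ γ′ → Affine (α + α′) (β + β′) (γ + γ′)
    affine-+ {α} {β} {γ} {α′} {β′} {γ′} p q = begin
      (α + α′) + x * (γ + γ′)         ≈⟨ solve 5 (λ a a' x c c' → (a :+ a') :+ x :* (c :+ c') := (a :+ x :* c) :+ (a' :+ x :* c')) refl α α′ x γ γ′ ⟩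
      (α + x * γ) + (α′ + x * γ′)     ≈⟨ +-cong p q ⟩
      (x * β + γ) + (x * β′ + γ′)     ≈⟨ solve 5 (λ x b b' c c' → (x :* b :+ c) :+ (x :* b' :+ c') := x :* (b :+ b') :+ (c :+ c')) refl x β β′ γ γ′ ⟩
      x * (β + β′) + (γ + γ′)         ∎

    affine-* : ∀ k {α β γ} → Affine α β γ → Affine (k * α) (k * β) (k * γ)
    affine-* k {α} {β} {γ} p = begin
      k * α + x * (k * γ)     ≈⟨ solve 4 (λ k a x c → k :* a :+ x :* (k :* c) := k :* (a :+ x :* c)) refl k α x γ ⟩
      k * (α + x * γ)         ≈⟨ *-congˡ p ⟩
      k * (x * β + γ)         ≈⟨ solve 4 (λ k b x c → k :* (x :* b :+ c) := x :* (k :* b) :+ k :* c) refl k β x γ ⟩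
      x * (k * β) + k * γ     ∎

    AffineAt : (List Carrier → Carrier) → Set
    AffineAt f = ∀ A B → Affine (f (A ++ x ∷ B)) (f (A ++ 1# ∷ B)) (f (A ++ B))

    affineAt-++ : ∀ f → AffineAt f → ∀ W → AffineAt (λ L → f (L ++ W))
    affineAt-++ f h W A B
      rewrite ++-assoc A (x ∷ B) W | ++-assoc A (1# ∷ B) W | ++-assoc A B W = h A (B ++ W)

    affineAt-++ˡ : ∀ f → AffineAt f → ∀ W → AffineAt (λ L → f (W ++ L))
    affineAt-++ˡ f h W A B
      rewrite ≡.sym (++-assoc W A (x ∷ B)) | ≡.sym (++-assoc W A (1# ∷ B)) | ≡.sym (++-assoc W A B) = h (W ++ A) B

    record Affine₂ (f : List Carrier → List Carrier → Carrier) : Set where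
      field
        left  : ∀ R → AffineAt (λ L → f L R)
        right : ∀ L → AffineAt (f L)

    splits-affine : ∀ {φ ψ χ} → (∀ P c Q → Affine (φ P c Q) (ψ P c Q) (χ P c Q)) →
                    ∀ P Q → Affine (splits φ P Q) (splits ψ P Q) (splits χ P Q)
    splits-affine h P []      = affine-const
    splits-affine h P (c ∷ Q) = affine-+ (h P c Q) (splits-affine h (P ++ [ c ]) Q)

    splits-affine-prefix : ∀ {φ} → (∀ c Q → AffineAt (λ P → φ P c Q)) → ∀ Q → AffineAt (λ P → splits φ P Q)
    splits-affine-prefix h []      A B = affine-const
    splits-affine-prefix {φ} h (c ∷ Q) A B =
      affine-+ (h c Q A B) (affineAt-++ (λ P → splits φ P Q) (splits-affine-prefix h Q) [ c ] A B)

    -- If the varied slot is itself chosen, the term is proportional to its weight (`hc`) and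
    -- disappears when the slot is deleted; for every other choice the slot survives in `P` or in
    -- `Q`.
    splits-affine-slots : ∀ {φ} → (∀ c Q → AffineAt (λ P → φ P c Q)) → (∀ P c → AffineAt (φ P c)) →
                          (∀ P Q → φ P x Q ≈ x * φ P 1# Q) → ∀ P → AffineAt (splits φ P)
    splits-affine-slots {φ} hP hQ hc P (a ∷ A) B = affine-+ (hQ P a A B) (splits-affine-slots hP hQ hc (P ++ [ a ]) A B)
    splits-affine-slots {φ} hP hQ hc P [] B = begin
      (φ P x B + s₁) + x * s₀          ≈⟨ +-congʳ (+-congʳ (hc P B)) ⟩
      (x * φ P 1# B + s₁) + x * s₀     ≈⟨ +-assoc _ _ _ ⟩
      x * φ P 1# B + (s₁ + x * s₀)     ≈⟨ +-congˡ aff ⟩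
      x * φ P 1# B + (x * s₂ + s₀)     ≈⟨ +-assoc _ _ _ ⟨
      x * φ P 1# B + x * s₂ + s₀       ≈⟨ +-congʳ (distribˡ _ _ _) ⟨
      x * (φ P 1# B + s₂) + s₀         ∎
      where
      s₀ = splits φ P B
      s₁ = splits φ (P ++ [ x ]) B
      s₂ = splits φ (P ++ [ 1# ]) B
      aff : Affine s₁ s₂ s₀
      aff = ≡.subst (λ L → Affine s₁ s₂ (splits φ L B)) (++-identityʳ P) (splits-affine-prefix hP B P [])

    -- A slot weight enters at most once: choosing the slot replaces its weight by x, and otherwise
    -- the slot is carried along unchanged.
    step-affine : ∀ {f g} → Affine₂ f → AffineAt g → Affine₂ (step f g)
    step-affine {f} {g} hf hg = record { left = left′ ; right = right′ }
      where
      open Affine₂ hf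
      moveW : ∀ W → AffineAt (λ W′ → f W W′ + g W′)
      moveW W A B = affine-+ (right W A B) (hg A B)
      inP : ∀ W c Q → AffineAt (λ P → move f g W P c Q)
      inP W c Q A B = affine-* c (affine-+ (affineAt-++ (λ L → f L (Q ++ W)) (left (Q ++ W)) [ x ] A B) affine-const)
      inQ : ∀ W P c → AffineAt (move f g W P c)
      inQ W P c A B = affine-* c (affineAt-++ (λ W′ → f (P ++ [ x ]) W′ + g W′) (moveW (P ++ [ x ])) W A B)
      chosen : ∀ W P Q → move f g W P x Q ≈ x * move f g W P 1# Q
      chosen W P Q = *-congˡ (sym (*-identityˡ _))
      left′ : ∀ R → AffineAt (λ L → step f g L R)
      left′ R A B = affine-+ (splits-affine-slots (inP R) (inQ R) (chosen R) [] A B)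
                             (affine-* u (splits-affine-prefix (inP [ 1# ]) R A B))
      right′ : ∀ L → AffineAt (step f g L)
      right′ L A B = affine-+ (splits-affine (λ P c Q → affine-* c (affineAt-++ˡ (λ W′ → f (P ++ [ x ]) W′ + g W′) (moveW (P ++ [ x ])) Q A B)) [] L)
                              (affine-* u (splits-affine-slots (inP [ 1# ]) (inQ [ 1# ]) (chosen [ 1# ]) L A B))

    tail≥-affine : ∀ n → Affine₂ (tail≥ n)
    tail≥-affine zero    = record { left = λ _ _ _ → affine-const ; right = λ _ _ _ → affine-const }
    tail≥-affine (suc n) = step-affine {g = λ W → (v - 1#) * tail≥ n [] W} (tail≥-affine n)
      (λ A B → affine-* (v - 1#) (Affine₂.right (tail≥-affine n) [] A B))

    tail∋0-affine : ∀ z n → Affine₂ (tail∋0 z n)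
    tail∋0-affine z zero    = record { left = λ _ _ _ → affine-const ; right = λ _ _ _ → affine-const }
    tail∋0-affine z (suc n) = record
      { left  = λ R A B → affine-+ (affine-* (x * z) (affineAt-++ first base R A B)) (Affine₂.left rec R A B)
      ; right = λ L A B → affine-+ (affine-* (x * z) (affineAt-++ˡ first base L A B)) (Affine₂.right rec L A B) }
      where
      first : List Carrier → Carrier
      first W = tail∋0 z n [] W + tail≥ n [] W
      base : AffineAt first
      base A B = affine-+ (Affine₂.right (tail∋0-affine z n) [] A B) (Affine₂.right (tail≥-affine n) [] A B)
      rec : Affine₂ (step (tail∋0 z n) (λ _ → 0#))
      rec = step-affine {g = λ _ → 0#} (tail∋0-affine z n) (λ _ _ → affine-const)

    -- Split by whether the extra lowest value is ever used. If it is, it is a right-to-left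
    -- minimum, which supplies the factor v that `tail∋0` leaves out.
    tail≥-x∷ : ∀ n L R → tail≥ n (x ∷ L) R ≈ v * tail∋0 1# n L R + tail≥ n L R
    tail≥-x∷ zero    L R = sym (trans (+-congʳ (zeroʳ v)) (+-identityˡ 1#))
    tail≥-x∷ (suc n) L R = begin
      (x * (tail≥ n (x ∷ []) (L ++ R) + (v - 1#) * e) + s₁) + u * s₂
        ≈⟨ +-cong (+-cong (*-congˡ (+-congʳ (tail≥-x∷ n [] (L ++ R)))) (splits-x∷ R [] L)) (*-congˡ (splits-x∷ [ 1# ] L R)) ⟩
      (x * ((v * h + e) + (v - 1#) * e) + (v * h₁ + e₁)) + u * (v * h₂ + e₂)
        ≈⟨ solve 9 (λ x u v h e h₁ e₁ h₂ e₂ →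
             (x :* ((v :* h :+ e) :+ (v :- con (+ 1)) :* e) :+ (v :* h₁ :+ e₁)) :+ u :* (v :* h₂ :+ e₂)
             := v :* (x :* con (+ 1) :* (h :+ e) :+ (h₁ :+ u :* h₂)) :+ (e₁ :+ u :* e₂)) refl x u v h e h₁ e₁ h₂ e₂ ⟩
      v * (x * 1# * (h + e) + (h₁ + u * h₂)) + (e₁ + u * e₂) ∎
      where
      g : List Carrier → Carrier
      g W = (v - 1#) * tail≥ n [] W
      e = tail≥ n [] (L ++ R)
      h = tail∋0 1# n [] (L ++ R)
      s₁ = splits (move (tail≥ n) g R) [ x ] L
      s₂ = splits (move (tail≥ n) g [ 1# ]) (x ∷ L) R
      h₁ = splits (move (tail∋0 1# n) (λ _ → 0#) R) [] L
      h₂ = splits (move (tail∋0 1# n) (λ _ → 0#) [ 1# ]) L R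
      e₁ = splits (move (tail≥ n) g R) [] L
      e₂ = splits (move (tail≥ n) g [ 1# ]) L R
      splits-x∷ : ∀ W P Q → splits (move (tail≥ n) g W) (x ∷ P) Q ≈
                  v * splits (move (tail∋0 1# n) (λ _ → 0#) W) P Q + splits (move (tail≥ n) g W) P Q
      splits-x∷ W P []      = sym (trans (+-congʳ (zeroʳ v)) (+-identityˡ 0#))
      splits-x∷ W P (c ∷ Q) = begin
        c * (tail≥ n (x ∷ P ++ [ x ]) (Q ++ W) + b) + splits (move (tail≥ n) g W) (x ∷ P ++ [ c ]) Q
          ≈⟨ +-cong (*-congˡ (+-congʳ (tail≥-x∷ n (P ++ [ x ]) (Q ++ W)))) (splits-x∷ W (P ++ [ c ]) Q) ⟩
        c * ((v * h′ + e′) + b) + (v * h″ + e″)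
          ≈⟨ solve 7 (λ c v h e b h' e' → c :* ((v :* h :+ e) :+ b) :+ (v :* h' :+ e')
               := v :* (c :* (h :+ con (+ 0)) :+ h') :+ (c :* (e :+ b) :+ e')) refl c v h′ e′ b h″ e″ ⟩
        v * (c * (h′ + 0#) + h″) + (c * (e′ + b) + e″) ∎
        where
        b = g (Q ++ W)
        h′ = tail∋0 1# n (P ++ [ x ]) (Q ++ W)
        e′ = tail≥ n (P ++ [ x ]) (Q ++ W)
        h″ = splits (move (tail∋0 1# n) (λ _ → 0#) W) (P ++ [ c ]) Q
        e″ = splits (move (tail≥ n) g W) (P ++ [ c ]) Q

    -- The two states differ only in how the slot x between `A` and `B` is entered: as an ascent,
    -- with a fresh slot appended, or as a weak descent. Each side is completed by the term that
    -- only the other one has.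
    step-slide : ∀ f g A B → step f g A (x ∷ B) + x * (f (A ++ [ x ]) B + g B)
                 ≈ step f g (A ++ [ x ]) B + x * (u * (f (A ++ [ x ]) (B ++ [ 1# ]) + g (B ++ [ 1# ])))
    step-slide f g A B = begin
      (splits (move f g (x ∷ B)) [] A + u * (x * p + s)) + x * q
        ≈⟨ +-congʳ (+-congʳ (splits-cong reassoc [] A)) ⟩
      (s′ + u * (x * p + s)) + x * q
        ≈⟨ solve 6 (λ s' u x p s q → (s' :+ u :* (x :* p :+ s)) :+ x :* q := ((s' :+ x :* q) :+ u :* s) :+ x :* (u :* p)) refl s′ u x p s q ⟩
      ((s′ + x * q) + u * s) + x * (u * p)
        ≈⟨ +-congʳ (+-congʳ (splits-∷ʳ (move f g B) [] A x)) ⟨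
      step f g (A ++ [ x ]) B + x * (u * p) ∎
      where
      p = f (A ++ [ x ]) (B ++ [ 1# ]) + g (B ++ [ 1# ])
      q = f (A ++ [ x ]) B + g B
      s = splits (move f g [ 1# ]) (A ++ [ x ]) B
      s′ = splits (λ P d Q → move f g B P d (Q ++ [ x ])) [] A
      reassoc : ∀ P c Q → move f g (x ∷ B) P c Q ≈ move f g B P c (Q ++ [ x ])
      reassoc P c Q = reflexive (≡.cong (λ W → c * (f (P ++ [ x ]) W + g W)) (≡.sym (++-assoc Q [ x ] B)))

-- Series in a nilpotent variable

module NilpotentSums (S : CommutativeRing 0ℓ 0ℓ) (N : ℕ) (t : CommutativeRing.Carrier S)
  (nil : CommutativeRing._≈_ S (Series.pow S t (suc N)) (CommutativeRing.0# S)) where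
  open CommutativeRing S hiding (zero)
  open Series S using (pow)
  open import Relation.Binary.Reasoning.Setoid setoid
  open IntegerSolver S
  open WordModel S using (splits)

  -- A truncated power series in τ, nested so that unfolding one step shifts the coefficients.
  horner : ℕ → Carrier → (ℕ → Carrier) → Carrier
  horner zero    τ f = f 0
  horner (suc n) τ f = f 0 + τ * horner n τ (λ k → f (suc k))

  horner-cong : ∀ n τ {f g} → (∀ k → f k ≈ g k) → horner n τ f ≈ horner n τ g
  horner-cong zero    τ eq = eq 0
  horner-cong (suc n) τ eq = +-cong (eq 0) (*-congˡ (horner-cong n τ (λ k → eq (suc k))))

  horner-+ : ∀ n τ f g → horner n τ (λ k → f k + g k) ≈ horner n τ f + horner n τ g
  horner-+ zero    τ f g = refl
  horner-+ (suc n) τ f g = trans (+-congˡ (*-congˡ (horner-+ n τ _ _)))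
    (solve 5 (λ a b τ c d → (a :+ b) :+ τ :* (c :+ d) := (a :+ τ :* c) :+ (b :+ τ :* d)) refl _ _ _ _ _)

  horner-* : ∀ n τ c f → horner n τ (λ k → c * f k) ≈ c * horner n τ f
  horner-* zero    τ c f = refl
  horner-* (suc n) τ c f = trans (+-congˡ (*-congˡ (horner-* n τ c _)))
    (solve 4 (λ a τ c d → c :* a :+ τ :* (c :* d) := c :* (a :+ τ :* d)) refl _ _ _ _)

  horner-0 : ∀ n τ → horner n τ (λ _ → 0#) ≈ 0#
  horner-0 zero    τ = refl
  horner-0 (suc n) τ = trans (+-congˡ (*-congˡ (horner-0 n τ))) (trans (+-congˡ (zeroʳ τ)) (+-identityˡ 0#))

  horner-suc : ∀ n τ f → horner (suc n) τ f ≈ horner n τ f + pow τ (suc n) * f (suc n)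
  horner-suc zero    τ f = +-congˡ (*-congʳ (sym (*-identityʳ τ)))
  horner-suc (suc n) τ f = trans (+-congˡ (*-congˡ (horner-suc n τ _)))
    (solve 5 (λ a τ b p d → a :+ τ :* (b :+ p :* d) := (a :+ τ :* b) :+ τ :* p :* d) refl _ _ _ _ _)

  pow-* : ∀ a b n → pow (a * b) n ≈ pow a n * pow b n
  pow-* a b zero    = sym (*-identityˡ 1#)
  pow-* a b (suc n) = trans (*-congˡ (pow-* a b n))
    (solve 4 (λ a b p q → (a :* b) :* (p :* q) := (a :* p) :* (b :* q)) refl a b _ _)

  nil-* : ∀ w → pow (t * w) (suc N) ≈ 0#
  nil-* w = trans (pow-* t w (suc N)) (trans (*-congʳ nil) (zeroˡ _))

  ∑ : Carrier → (ℕ → Carrier) → Carrier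
  ∑ w = horner N (t * w)

  -- The one term by which the two truncations differ carries (t w)^(N+1), which is zero; so the
  -- finite sum unfolds like an infinite one.
  ∑-unfold : ∀ w f → ∑ w f ≈ f 0 + t * w * ∑ w (λ k → f (suc k))
  ∑-unfold w f = sym (trans (horner-suc N (t * w) f)
    (trans (+-congˡ (trans (*-congʳ (nil-* w)) (zeroˡ _))) (+-identityʳ _)))

  -- After N + 1 substitutions the remainder has the factor (t w)^(N+1).
  solve-recurrence : ∀ w f g → (∀ q → f q ≈ g q + t * w * f (suc q)) → f 0 ≈ ∑ w g
  solve-recurrence w f g rec = trans (iterate N f g rec)
    (trans (+-congˡ (trans (*-congʳ (nil-* w)) (zeroˡ _))) (+-identityʳ _))
    where
    iterate : ∀ n f g → (∀ q → f q ≈ g q + t * w * f (suc q)) →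
              f 0 ≈ horner n (t * w) g + pow (t * w) (suc n) * f (suc n)
    iterate zero    f g rec = trans (rec 0) (+-congˡ (*-congʳ (sym (*-identityʳ _))))
    iterate (suc n) f g rec = trans (rec 0) (trans
      (+-congˡ (*-congˡ (iterate n (λ k → f (suc k)) (λ k → g (suc k)) (λ q → rec (suc q)))))
      (solve 5 (λ a τ b p d → a :+ τ :* (b :+ p :* d) := (a :+ τ :* b) :+ τ :* p :* d) refl _ _ _ _ _))

  -- Substituting the equation into itself shows that f is divisible by every power of t. All
  -- arguments are handled at once because the equation at y refers to `c y`.
  vanish : ∀ (f a b c : Carrier → Carrier) → (∀ y → f y ≈ t * (a y * f y + b y * f (c y))) → ∀ y → f y ≈ 0#
  vanish f a b c eq y with divisible (suc N)
    where
    divisible : ∀ n → Σ (Carrier → Carrier) (λ g → ∀ y → f y ≈ pow t n * g y)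
    divisible zero    = f , λ y → sym (*-identityˡ _)
    divisible (suc n) with divisible n
    ... | g , h = (λ y → a y * g y + b y * g (c y)) , λ y → trans (eq y) (trans
        (*-congˡ (+-cong (*-congˡ (h y)) (*-congˡ (h (c y)))))
        (solve 6 (λ t a p g b g' → t :* (a :* (p :* g) :+ b :* (p :* g')) := t :* p :* (a :* g :+ b :* g')) refl t (a y) _ (g y) (b y) _))
  ... | g , h = trans (h y) (trans (*-congʳ nil) (zeroˡ _))

  -- The difference p - q equals t a times itself, so `vanish` applies to it as a constant function.
  cancel : ∀ a {p q} → (1# - t * a) * p ≈ (1# - t * a) * q → p ≈ q
  cancel a {p} {q} eq = begin
    p              ≈⟨ solve 2 (λ p q → p := (p :- q) :+ q) refl p q ⟩
    (p - q) + q    ≈⟨ +-congʳ (vanish (λ _ → p - q) (λ _ → a) (λ _ → 0#) (λ y → y) (λ _ → small) 0#) ⟩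
    0# + q         ≈⟨ +-identityˡ q ⟩
    q              ∎
    where
    small : p - q ≈ t * (a * (p - q) + 0# * (p - q))
    small = begin
      p - q ≈⟨ solve 4 (λ t a p q → p :- q := ((con (+ 1) :- t :* a) :* p :- (con (+ 1) :- t :* a) :* q)
                                    :+ t :* (a :* (p :- q) :+ con (+ 0) :* (p :- q))) refl t a p q ⟩
      ((1# - t * a) * p - (1# - t * a) * q) + t * (a * (p - q) + 0# * (p - q)) ≈⟨ +-congʳ (+-congʳ eq) ⟩
      ((1# - t * a) * q - (1# - t * a) * q) + t * (a * (p - q) + 0# * (p - q)) ≈⟨ +-congʳ (-‿inverseʳ _) ⟩
      0# + t * (a * (p - q) + 0# * (p - q)) ≈⟨ +-identityˡ _ ⟩
      t * (a * (p - q) + 0# * (p - q)) ∎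

  splits-horner : ∀ n τ (φ : ℕ → List Carrier → Carrier → List Carrier → Carrier) P Q →
    horner n τ (λ k → splits (φ k) P Q) ≈ splits (λ P′ c Q′ → horner n τ (λ k → φ k P′ c Q′)) P Q
  splits-horner n τ φ P []      = horner-0 n τ
  splits-horner n τ φ P (c ∷ Q) = trans (horner-+ n τ _ _) (+-congˡ (splits-horner n τ φ (P ++ [ c ]) Q))

-- Recurrences between neighbouring states

module FunctionalEquation (S : CommutativeRing 0ℓ 0ℓ) (N : ℕ) (t : CommutativeRing.Carrier S)
  (nil : CommutativeRing._≈_ S (Series.pow S t (suc N)) (CommutativeRing.0# S))
  (x u v : CommutativeRing.Carrier S) where
  open CommutativeRing S hiding (zero)
  open import Relation.Binary.Reasoning.Setoid setoid
  open IntegerSolver S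
  open WordModel S
  open Weights x u v
  open NilpotentSums S N t nil

  r : Carrier
  r = t * (x + u - x * u)

  gen : (ℕ → Carrier) → Carrier
  gen = horner N t

  gen-unfold : ∀ f → gen f ≈ f 0 + t * gen (λ k → f (suc k))
  gen-unfold f = begin
    gen f                                   ≈⟨ horner-τ N f ⟩
    ∑ 1# f                                  ≈⟨ ∑-unfold 1# f ⟩
    f 0 + t * 1# * ∑ 1# (λ k → f (suc k))   ≈⟨ +-congˡ (*-cong (*-identityʳ t) (sym (horner-τ N _))) ⟩
    f 0 + t * gen (λ k → f (suc k))         ∎
    where
    horner-τ : ∀ n f → horner n t f ≈ horner n (t * 1#) f
    horner-τ zero    f = refl
    horner-τ (suc n) f = +-congˡ (*-cong (sym (*-identityʳ t)) (horner-τ n _))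

  genMove : ∀ (f : ℕ → List Carrier → List Carrier → Carrier) (g : ℕ → List Carrier → Carrier) W P Q →
    gen (λ n → splits (move (f n) (g n) W) P Q) ≈
    splits (move (λ L R → gen (λ n → f n L R)) (λ R → gen (λ n → g n R)) W) P Q
  genMove f g W P Q = trans (splits-horner N t _ P Q)
    (splits-cong (λ P c Q → trans (horner-* N t c _) (*-congˡ (horner-+ N t _ _))) P Q)

  genStep : ∀ (f : ℕ → List Carrier → List Carrier → Carrier) (g : ℕ → List Carrier → Carrier) L R →
    gen (λ n → step (f n) (g n) L R) ≈ step (λ L R → gen (λ n → f n L R)) (λ R → gen (λ n → g n R)) L R
  genStep f g L R = trans (horner-+ N t _ _)
    (+-cong (genMove f g R [] L) (trans (horner-* N t u _) (*-congˡ (genMove f g [ 1# ] L R))))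

  𝓔 : List Carrier → List Carrier → Carrier
  𝓔 L R = gen (λ n → tail≥ n L R)

  𝓗 : Carrier → List Carrier → List Carrier → Carrier
  𝓗 z L R = gen (λ n → tail∋0 z n L R)

  move-congʳ : ∀ f (g g′ : List Carrier → Carrier) → (∀ R → g R ≈ g′ R) →
    ∀ W P Q → splits (move f g W) P Q ≈ splits (move f g′ W) P Q
  move-congʳ f g g′ eq W = splits-cong (λ P c Q → *-congˡ (+-congˡ (eq (Q ++ W))))

  step-congʳ : ∀ f (g g′ : List Carrier → Carrier) → (∀ R → g R ≈ g′ R) → ∀ L R → step f g L R ≈ step f g′ L R
  step-congʳ f g g′ eq L R = +-cong (move-congʳ f g g′ eq R [] L) (*-congˡ (move-congʳ f g g′ eq [ 1# ] L R))

  𝓔-eq : ∀ L R → 𝓔 L R ≈ 1# + t * step 𝓔 (λ W → (v - 1#) * 𝓔 [] W) L R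
  𝓔-eq L R = trans (gen-unfold _) (+-congˡ (*-congˡ (trans (genStep tail≥ (λ n W → (v - 1#) * tail≥ n [] W) L R)
    (step-congʳ 𝓔 _ (λ W → (v - 1#) * 𝓔 [] W) (λ _ → horner-* N t _ _) L R))))

  𝓗-eq : ∀ z L R → 𝓗 z L R ≈ t * (x * z * (𝓗 z [] (L ++ R) + 𝓔 [] (L ++ R)) + step (𝓗 z) (λ _ → 0#) L R)
  𝓗-eq z L R = trans (gen-unfold _) (trans (+-identityˡ _) (*-congˡ (trans (horner-+ N t _ _)
    (+-cong (trans (horner-* N t _ _) (*-congˡ (horner-+ N t _ _)))
            (trans (genStep (tail∋0 z) (λ _ _ → 0#) L R) (step-congʳ (𝓗 z) (λ _ → gen (λ _ → 0#)) (λ _ → 0#) (λ _ → horner-0 N t) L R))))))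

  gen-affine : ∀ α β γ → (∀ n → Affine (α n) (β n) (γ n)) → Affine (gen α) (gen β) (gen γ)
  gen-affine α β γ h = begin
    gen α + x * gen γ               ≈⟨ +-congˡ (horner-* N t x γ) ⟨
    gen α + gen (λ n → x * γ n)     ≈⟨ horner-+ N t _ _ ⟨
    gen (λ n → α n + x * γ n)       ≈⟨ horner-cong N t h ⟩
    gen (λ n → x * β n + γ n)       ≈⟨ horner-+ N t _ _ ⟩
    gen (λ n → x * β n) + gen γ     ≈⟨ +-congʳ (horner-* N t x β) ⟩
    x * gen β + gen γ               ∎

  slots : ℕ → List Carrier
  slots m = used m ++ [ 1# ]

  -- Moving a used value from R to L only changes whether its next use is an ascent; affinity then absorbs
  -- the fresh slot appended by that ascent, which is where r comes from.
  slide : ∀ (F : List Carrier → List Carrier → Carrier) (g b : List Carrier → Carrier) →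
    (∀ L R → F L R ≈ b (L ++ R) + t * step F g L R) → (∀ L → AffineAt (F L)) → AffineAt g →
    ∀ q m → F (used q) (slots (suc m)) ≈
      ((1# - r) * F (used (suc q)) (slots m) + t * u * F (used (suc q)) (slots (suc m)))
      + (t * u * g (slots (suc m)) - r * g (slots m))
  slide F g b eq affF affg q m = begin
    F L₀ (x ∷ B)
      ≈⟨ eq L₀ (x ∷ B) ⟩
    b (L₀ ++ x ∷ B) + t * s
      ≈⟨ solve 5 (λ b t s x q → b :+ t :* s := (b :+ t :* (s :+ x :* q)) :- t :* x :* q) refl _ t s x (F L₁ B + g B) ⟩
    (b (L₀ ++ x ∷ B) + t * (s + x * (F L₁ B + g B))) - t * x * (F L₁ B + g B)
      ≈⟨ +-congʳ (+-cong (reflexive (≡.cong b (≡.sym (++-assoc L₀ [ x ] B)))) (*-congˡ (step-slide F g L₀ B))) ⟩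
    (b (L₁ ++ B) + t * (s′ + x * (u * (F L₁ (B ++ [ 1# ]) + g (B ++ [ 1# ]))))) - t * x * (F L₁ B + g B)
      ≈⟨ solve 8 (λ b t s x u p f g → (b :+ t :* (s :+ x :* (u :* p))) :- t :* x :* (f :+ g)
              := (b :+ t :* s) :+ (t :* u :* (x :* p) :- t :* x :* (f :+ g))) refl _ t s′ x u _ (F L₁ B) (g B) ⟩
    (b (L₁ ++ B) + t * s′) + (t * u * (x * (F L₁ (B ++ [ 1# ]) + g (B ++ [ 1# ]))) - t * x * (F L₁ B + g B))
      ≈⟨ +-cong (sym (eq L₁ B)) (+-congʳ (*-congˡ fresh)) ⟩
    F L₁ B + (t * u * ((F L₁ (x ∷ B) + g (x ∷ B)) + (x - 1#) * (F L₁ B + g B)) - t * x * (F L₁ B + g B))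
      ≈⟨ solve 7 (λ t u x f g f' g' → f :+ (t :* u :* ((f' :+ g') :+ (x :- con (+ 1)) :* (f :+ g)) :- t :* x :* (f :+ g))
              := ((con (+ 1) :- t :* (x :+ u :- x :* u)) :* f :+ t :* u :* f') :+ (t :* u :* g' :- t :* (x :+ u :- x :* u) :* g))
              refl t u x (F L₁ B) (g B) (F L₁ (x ∷ B)) (g (x ∷ B)) ⟩
    ((1# - r) * F L₁ B + t * u * F L₁ (x ∷ B)) + (t * u * g (x ∷ B) - r * g B)
      ≡⟨ ≡.cong (λ L → ((1# - r) * F L B + t * u * F L (x ∷ B)) + (t * u * g (x ∷ B) - r * g B)) (used-∷ʳ q) ⟩
    ((1# - r) * F (used (suc q)) B + t * u * F (used (suc q)) (x ∷ B)) + (t * u * g (x ∷ B) - r * g B) ∎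
    where
    L₀ = used q
    L₁ = used q ++ [ x ]
    B = slots m
    s = step F g L₀ (x ∷ B)
    s′ = step F g L₁ B
    -- `B ++ [ 1# ]` ends in two slots of weight 1. Affinity is used at the first of them: weight x
    -- turns the list into `x ∷ B`, and deletion gives `B` back.
    fresh : x * (F L₁ (B ++ [ 1# ]) + g (B ++ [ 1# ])) ≈ (F L₁ (x ∷ B) + g (x ∷ B)) + (x - 1#) * (F L₁ B + g B)
    fresh = begin
      x * p₁
        ≈⟨ solve 3 (λ x p q → x :* p := (x :* p :+ q) :- q) refl x p₁ p₀ ⟩
      (x * p₁ + p₀) - p₀
        ≈⟨ +-congʳ (≡.subst₂ (λ L W → Affine (F L₁ L + g L) (F L₁ W + g W) p₀) (used-x∷ m [ 1# ]) (≡.sym (++-assoc (used m) [ 1# ] [ 1# ]))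
             (affine-+ (affF L₁ (used m) [ 1# ]) (affg (used m) [ 1# ]))) ⟨
      (p₂ + x * p₀) - p₀
        ≈⟨ solve 3 (λ x a b → (a :+ x :* b) :- b := a :+ (x :- con (+ 1)) :* b) refl x p₂ p₀ ⟩
      p₂ + (x - 1#) * p₀ ∎
      where
      p₀ = F L₁ B + g B
      p₁ = F L₁ (B ++ [ 1# ]) + g (B ++ [ 1# ])
      p₂ = F L₁ (x ∷ B) + g (x ∷ B)

  -- Apart from the distinguished lowest value, q used values lie weakly below the last entry; above
  -- it lie m used values and the fresh one.
  H : Carrier → ℕ → ℕ → Carrier
  H z q m = 𝓗 z (used q) (slots m)

  K : ℕ → Carrier
  K m = 𝓔 [] (slots m)

  J : ℕ → Carrier
  J m = 𝓔 [ x ] (slots m)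

  J-eq : ∀ m → J m ≈ v * H 1# 0 m + K m
  J-eq m = trans (horner-cong N t (λ n → tail≥-x∷ n [] (slots m)))
    (trans (horner-+ N t _ _) (+-congʳ (horner-* N t v _)))

  H-slide : ∀ z q m → H z q (suc m) ≈ (1# - r) * H z (suc q) m + t * u * H z (suc q) (suc m)
  H-slide z q m = trans
    (slide (𝓗 z) (λ _ → 0#) (λ W → t * (x * z * (𝓗 z [] W + 𝓔 [] W)))
      (λ L R → trans (𝓗-eq z L R) (distribˡ t _ _))
      (λ L A B → gen-affine _ _ _ (λ n → Affine₂.right (tail∋0-affine z n) L A B))
      (λ A B → affine-const) q m)
    (solve 4 (λ a t u r → a :+ (t :* u :* con (+ 0) :- r :* con (+ 0)) := a) refl _ t u r)

  K-slide : ∀ m → K (suc m) ≈ ((1# - r) * J m + t * u * J (suc m)) + (v - 1#) * (t * u * K (suc m) - r * K m)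
  K-slide m = trans
    (slide 𝓔 (λ W → (v - 1#) * 𝓔 [] W) (λ _ → 1#) 𝓔-eq aff (λ A B → affine-* (v - 1#) (aff [] A B)) 0 m)
    (+-congˡ (solve 6 (λ t u r v a b → t :* u :* ((v :- con (+ 1)) :* a) :- r :* ((v :- con (+ 1)) :* b)
       := (v :- con (+ 1)) :* (t :* u :* a :- r :* b)) refl t u r v _ _))
    where
    aff : ∀ L → AffineAt (𝓔 L)
    aff L A B = gen-affine _ _ _ (λ n → Affine₂.right (tail≥-affine n) L A B)

  -- The base that `K-slide` does not reach: from `[ 1# ]` only the fresh slot can be chosen.
  K-zero : K 0 ≈ 1# + t * u * (J 0 + (v - 1#) * K 0)
  K-zero = trans (𝓔-eq [] [ 1# ]) (+-congˡ
    (solve 4 (λ t u a b → t :* (con (+ 0) :+ u :* (con (+ 1) :* (a :+ b) :+ con (+ 0))) := t :* u :* (a :+ b)) refl t u _ _))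

  -- The antidiagonal sum of `H z i j` over i + j = q + m - 1 with i ≥ q. It arises because choosing
  -- one of the used values divides a fixed number of them into those below and those above.
  diagonal : Carrier → ℕ → ℕ → Carrier
  diagonal z q zero    = 0#
  diagonal z q (suc m) = H z q m + diagonal z (suc q) m

  -- After the initial run 0, ..., k the ascent into the fresh slot would prolong the run and is
  -- counted elsewhere, so its contribution is removed.
  g : Carrier → ℕ → Carrier
  g z k = H z k 0 - t * u * H z (suc k) 0

  splits-used : ∀ z q m → splits (move (𝓗 z) (λ _ → 0#) [ 1# ]) (used q) (used m) ≈ x * diagonal z (suc q) m
  splits-used z q zero    = sym (zeroʳ x)
  splits-used z q (suc m) = begin
    x * (𝓗 z (used q ++ [ x ]) (slots m) + 0#) + splits _ (used q ++ [ x ]) (used m)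
      ≡⟨ ≡.cong (λ L → x * (𝓗 z L (slots m) + 0#) + splits (move (𝓗 z) (λ _ → 0#) [ 1# ]) L (used m)) (used-∷ʳ q) ⟩
    x * (H z (suc q) m + 0#) + splits _ (used (suc q)) (used m)
      ≈⟨ +-cong (*-congˡ (+-identityʳ _)) (splits-used z (suc q) m) ⟩
    x * H z (suc q) m + x * diagonal z (suc (suc q)) m
      ≈⟨ distribˡ x _ _ ⟨
    x * diagonal z (suc q) (suc m) ∎

  g-eq : ∀ z k → g z k ≈ t * (x * z * (H z 0 k + K k) + x * diagonal z 1 k)
  g-eq z k = begin
    H z k 0 - t * u * H z (suc k) 0
      ≈⟨ +-congʳ (𝓗-eq z (used k) [ 1# ]) ⟩
    t * (p + (splits (move (𝓗 z) (λ _ → 0#) [ 1# ]) [] (used k) + u * (1# * (𝓗 z (used k ++ [ x ]) [ 1# ] + 0#) + 0#))) - t * u * H z (suc k) 0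
      ≡⟨ ≡.cong (λ L → t * (p + (splits (move (𝓗 z) (λ _ → 0#) [ 1# ]) [] (used k) + u * (1# * (𝓗 z L [ 1# ] + 0#) + 0#))) - t * u * H z (suc k) 0) (used-∷ʳ k) ⟩
    t * (p + (splits (move (𝓗 z) (λ _ → 0#) [ 1# ]) [] (used k) + u * (1# * (H z (suc k) 0 + 0#) + 0#))) - t * u * H z (suc k) 0
      ≈⟨ solve 5 (λ t p s u h → t :* (p :+ (s :+ u :* (con (+ 1) :* (h :+ con (+ 0)) :+ con (+ 0)))) :- t :* u :* h := t :* (p :+ s)) refl t p _ u _ ⟩
    t * (p + splits (move (𝓗 z) (λ _ → 0#) [ 1# ]) [] (used k))
      ≈⟨ *-congˡ (+-congˡ (splits-used z 0 k)) ⟩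
    t * (p + x * diagonal z 1 k) ∎
    where p = x * z * (H z 0 k + K k)

  -- `H-slide` summed along an antidiagonal. At its end no used value is left above the last entry,
  -- and this boundary contributes `g z k`.
  diagonal-eq : ∀ z k → H z 0 k + r * diagonal z 1 k ≈ t * u * diagonal z 1 (suc k) + g z k
  diagonal-eq z k = begin
    H z 0 k + r * diagonal z 1 k
      ≈⟨ solve 5 (λ a b t u r → a :+ r :* b := (a :+ b) :- (con (+ 1) :- r) :* b) refl _ _ t u r ⟩
    diagonal z 0 (suc k) - (1# - r) * diagonal z 1 k
      ≈⟨ solve 3 (λ a b h → a :- b := (a :+ h) :- b :- h) refl _ _ (t * u * H z (suc k) 0) ⟩
    (diagonal z 0 (suc k) + t * u * H z (suc k) 0) - (1# - r) * diagonal z 1 k - t * u * H z (suc k) 0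
      ≈⟨ +-congʳ (+-congʳ (telescoped 0 k)) ⟩
    ((1# - r) * diagonal z 1 k + t * u * diagonal z 1 (suc k) + H z k 0) - (1# - r) * diagonal z 1 k - t * u * H z (suc k) 0
      ≈⟨ solve 4 (λ a b c d → (a :+ b :+ c) :- a :- d := b :+ (c :- d)) refl _ _ _ _ ⟩
    t * u * diagonal z 1 (suc k) + g z k ∎
    where
    telescoped : ∀ q m → diagonal z q (suc m) + t * u * H z (suc (q ℕ.+ m)) 0 ≈
      (1# - r) * diagonal z (suc q) m + t * u * diagonal z (suc q) (suc m) + H z (q ℕ.+ m) 0
    telescoped q zero rewrite ℕₚ.+-identityʳ q = solve 5 (λ a b t u r → (a :+ con (+ 0)) :+ t :* u :* b
      := (con (+ 1) :- r) :* con (+ 0) :+ t :* u :* (b :+ con (+ 0)) :+ a) refl _ _ t u r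
    telescoped q (suc m) = begin
      (H z q (suc m) + diagonal z (suc q) (suc m)) + t * u * H z (suc (q ℕ.+ suc m)) 0
        ≈⟨ +-assoc _ _ _ ⟩
      H z q (suc m) + (diagonal z (suc q) (suc m) + t * u * H z (suc (q ℕ.+ suc m)) 0)
        ≈⟨ +-cong (H-slide z q m) (≡.subst (λ i → diagonal z (suc q) (suc m) + t * u * H z (suc i) 0 ≈ (1# - r) * diagonal z (suc (suc q)) m
                    + t * u * diagonal z (suc (suc q)) (suc m) + H z i 0) (≡.sym (ℕₚ.+-suc q m)) (telescoped (suc q) m)) ⟩
      ((1# - r) * H z (suc q) m + t * u * H z (suc q) (suc m)) +
        ((1# - r) * diagonal z (suc (suc q)) m + t * u * diagonal z (suc (suc q)) (suc m) + H z (q ℕ.+ suc m) 0)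
        ≈⟨ solve 8 (λ r t u a b c d e → ((con (+ 1) :- r) :* a :+ t :* u :* b) :+ ((con (+ 1) :- r) :* c :+ t :* u :* d :+ e)
              := (con (+ 1) :- r) :* (a :+ c) :+ t :* u :* (b :+ d) :+ e) refl r t u _ _ _ _ _ ⟩
      (1# - r) * diagonal z (suc q) (suc m) + t * u * diagonal z (suc q) (suc (suc m)) + H z (q ℕ.+ suc m) 0 ∎

-- Certificates for consequences of linear equations

module LinearCombination (S : CommutativeRing 0ℓ 0ℓ) where
  open CommutativeRing S
  open IntegerSolver S

  difference-zero : ∀ {a b} → a - b ≈ 0# → a ≈ b
  difference-zero {a} {b} e = trans (solve 2 (λ a b → a := (a :- b) :+ b) refl a b) (trans (+-congʳ e) (+-identityˡ b))

  private
    vanishing : ∀ k {a b} → a ≈ b → k * (a - b) ≈ 0#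
    vanishing k {a} {b} e = trans (*-congˡ (trans (+-congʳ e) (-‿inverseʳ b))) (zeroʳ k)

    _⊞_ : ∀ {p q} → p ≈ 0# → q ≈ 0# → p + q ≈ 0#
    p ⊞ q = trans (+-cong p q) (+-identityˡ 0#)

  -- The coefficients `k` say how the hypotheses are combined; the last argument is then a pure
  -- polynomial identity, within reach of the solver.
  lincomb₁ : ∀ k {a b l r} → a ≈ b → l - r ≈ k * (a - b) → l ≈ r
  lincomb₁ k e c = difference-zero (trans c (vanishing k e))

  lincomb₂ : ∀ k₁ k₂ {a₁ b₁ a₂ b₂ l r} → a₁ ≈ b₁ → a₂ ≈ b₂ → l - r ≈ k₁ * (a₁ - b₁) + k₂ * (a₂ - b₂) → l ≈ r
  lincomb₂ k₁ k₂ e₁ e₂ c = difference-zero (trans c (vanishing k₁ e₁ ⊞ vanishing k₂ e₂))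

  lincomb₃ : ∀ k₁ k₂ k₃ {a₁ b₁ a₂ b₂ a₃ b₃ l r} → a₁ ≈ b₁ → a₂ ≈ b₂ → a₃ ≈ b₃ →
    l - r ≈ k₁ * (a₁ - b₁) + k₂ * (a₂ - b₂) + k₃ * (a₃ - b₃) → l ≈ r
  lincomb₃ k₁ k₂ k₃ e₁ e₂ e₃ c = difference-zero (trans c ((vanishing k₁ e₁ ⊞ vanishing k₂ e₂) ⊞ vanishing k₃ e₃))

  lincomb₄ : ∀ k₁ k₂ k₃ k₄ {a₁ b₁ a₂ b₂ a₃ b₃ a₄ b₄ l r} → a₁ ≈ b₁ → a₂ ≈ b₂ → a₃ ≈ b₃ → a₄ ≈ b₄ →
    l - r ≈ k₁ * (a₁ - b₁) + k₂ * (a₂ - b₂) + k₃ * (a₃ - b₃) + k₄ * (a₄ - b₄) → l ≈ r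
  lincomb₄ k₁ k₂ k₃ k₄ e₁ e₂ e₃ e₄ c = difference-zero
    (trans c (((vanishing k₁ e₁ ⊞ vanishing k₂ e₂) ⊞ vanishing k₃ e₃) ⊞ vanishing k₄ e₄))

  lincomb₅ : ∀ k₁ k₂ k₃ k₄ k₅ {a₁ b₁ a₂ b₂ a₃ b₃ a₄ b₄ a₅ b₅ l r} →
    a₁ ≈ b₁ → a₂ ≈ b₂ → a₃ ≈ b₃ → a₄ ≈ b₄ → a₅ ≈ b₅ →
    l - r ≈ k₁ * (a₁ - b₁) + k₂ * (a₂ - b₂) + k₃ * (a₃ - b₃) + k₄ * (a₄ - b₄) + k₅ * (a₅ - b₅) → l ≈ r
  lincomb₅ k₁ k₂ k₃ k₄ k₅ e₁ e₂ e₃ e₄ e₅ c = difference-zero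
    (trans c ((((vanishing k₁ e₁ ⊞ vanishing k₂ e₂) ⊞ vanishing k₃ e₃) ⊞ vanishing k₄ e₄) ⊞ vanishing k₅ e₅))

-- Functional equations in the run variable y

module KernelEquation (S : CommutativeRing 0ℓ 0ℓ) (N : ℕ) (t : CommutativeRing.Carrier S)
  (nil : CommutativeRing._≈_ S (Series.pow S t (suc N)) (CommutativeRing.0# S))
  (x u v : CommutativeRing.Carrier S) where
  open CommutativeRing S hiding (zero)
  open import Relation.Binary.Reasoning.Setoid setoid
  open IntegerSolver S
  open LinearCombination S
  open WordModel S
  open Weights x u v
  open NilpotentSums S N t nil
  open FunctionalEquation S N t nil x u v

  c : Carrier → Carrier
  c y = 1# + y - y * r

  h : Carrier → Carrier
  h y = 1# - t * u * (y + v - y * v * r)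

  -- D z y counts the sequences, up to a factor t z y v, in which 0 recurs after the initial run; M y counts
  -- the remaining ones.
  D : Carrier → Carrier → Carrier
  D z y = ∑ (u * y) (g z)

  𝒦 : Carrier → Carrier
  𝒦 y = ∑ (u * y) K

  ∑-linear₂ : ∀ w a b f g → ∑ w (λ k → a * f k + b * g k) ≈ a * ∑ w f + b * ∑ w g
  ∑-linear₂ w a b f g = trans (horner-+ N (t * w) _ _) (+-cong (horner-* N (t * w) a f) (horner-* N (t * w) b g))

  ∑-cong : ∀ w {f g} → (∀ k → f k ≈ g k) → ∑ w f ≈ ∑ w g
  ∑-cong w = horner-cong N (t * w)

  -- This is the origin of `c`. In the recurrence for the row sums of `H`, the first term of
  -- `H-slide` contributes y (1 - r) and the second one, after reindexing, 1; the multiplier is t u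
  -- (1 + y (1 - r)), and the inhomogeneity is again `g`.
  ∑H≈D∘c : ∀ z y → ∑ (u * y) (H z 0) ≈ D z (c y)
  ∑H≈D∘c z y = solve-recurrence (u * c y) (λ q → ∑ (u * y) (H z q)) (g z) (λ q →
    lincomb₃ 1# (t * u * y) (- (t * u))
      (∑-unfold (u * y) (H z q))
      (trans (∑-cong (u * y) (H-slide z q)) (∑-linear₂ (u * y) (1# - r) (t * u) (H z (suc q)) (λ m → H z (suc q) (suc m))))
      (∑-unfold (u * y) (H z (suc q)))
      (solve 10 (λ t u y r a b e f s s′ →
         a :- ((b :- t :* u :* e) :+ t :* (u :* (con (+ 1) :+ y :- y :* r)) :* f)
         := con (+ 1) :* (a :- (b :+ t :* (u :* y) :* s))
            :+ t :* u :* y :* (s :- ((con (+ 1) :- r) :* f :+ t :* u :* s′))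
            :+ (:- (t :* u)) :* (f :- (e :+ t :* (u :* y) :* s′)))
        refl t u y r _ _ _ _ _ _))

  -- Let T be the sum of `diagonal z 1`. Since `diagonal z 1 0` is zero, y times the summed
  -- `diagonal-eq` becomes (1 - y r) T = y (D(c y) - D(y)). Inserting this into (1 - y r) times the
  -- summed `g-eq` eliminates T.
  D-eq : ∀ z y → (1# - y * r + t * x * y) * D z y
               ≈ t * x * (y + z * (1# - y * r)) * D z (c y) + t * x * z * (1# - y * r) * 𝒦 y
  D-eq z y = trans (lincomb₃ (- (t * x * y)) (t * x) (1# - y * r) eq₁ (∑-unfold (u * y) (diagonal z 1)) eq₃
      (solve 11 (λ t x u y z r d d₀ T S κ → (con (+ 1) :- y :* r :+ t :* x :* y) :* d
           :- (t :* x :* (y :+ z :* (con (+ 1) :- y :* r)) :* d₀ :+ t :* x :* z :* (con (+ 1) :- y :* r) :* κ)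
         := (:- (t :* x :* y)) :* ((d₀ :+ r :* T) :- (t :* u :* S :+ d))
            :+ t :* x :* (T :- (con (+ 0) :+ t :* (u :* y) :* S))
            :+ (con (+ 1) :- y :* r) :* (d :- t :* (x :* z :* (d₀ :+ κ) :+ x :* T)))
         refl t x u y z r _ _ _ _ _))
    (+-congʳ (*-congˡ (∑H≈D∘c z y)))
    where
    eq₁ : ∑ (u * y) (H z 0) + r * ∑ (u * y) (diagonal z 1) ≈ t * u * ∑ (u * y) (λ k → diagonal z 1 (suc k)) + D z y
    eq₁ = begin
      ∑ (u * y) (H z 0) + r * ∑ (u * y) (diagonal z 1)             ≈⟨ +-congˡ (horner-* N _ r _) ⟨
      ∑ (u * y) (H z 0) + ∑ (u * y) (λ k → r * diagonal z 1 k)     ≈⟨ horner-+ N _ _ _ ⟨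
      ∑ (u * y) (λ k → H z 0 k + r * diagonal z 1 k)               ≈⟨ ∑-cong (u * y) (diagonal-eq z) ⟩
      ∑ (u * y) (λ k → t * u * diagonal z 1 (suc k) + g z k)       ≈⟨ horner-+ N _ _ _ ⟩
      ∑ (u * y) (λ k → t * u * diagonal z 1 (suc k)) + D z y       ≈⟨ +-congʳ (horner-* N _ (t * u) _) ⟩
      t * u * ∑ (u * y) (λ k → diagonal z 1 (suc k)) + D z y       ∎
    eq₃ : D z y ≈ t * (x * z * (∑ (u * y) (H z 0) + 𝒦 y) + x * ∑ (u * y) (diagonal z 1))
    eq₃ = begin
      D z y                                                                               ≈⟨ ∑-cong (u * y) (g-eq z) ⟩
      ∑ (u * y) (λ k → t * (x * z * (H z 0 k + K k) + x * diagonal z 1 k))                ≈⟨ horner-* N _ t _ ⟩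
      t * ∑ (u * y) (λ k → x * z * (H z 0 k + K k) + x * diagonal z 1 k)                  ≈⟨ *-congˡ (∑-linear₂ (u * y) (x * z) x _ _) ⟩
      t * (x * z * ∑ (u * y) (λ k → H z 0 k + K k) + x * ∑ (u * y) (diagonal z 1))        ≈⟨ *-congˡ (+-congʳ (*-congˡ (horner-+ N _ _ _))) ⟩
      t * (x * z * (∑ (u * y) (H z 0) + 𝒦 y) + x * ∑ (u * y) (diagonal z 1))              ∎

  -- In `K-slide` and `K-zero` together the sum of `J` has the factor t u (1 + y (1 - r)), whence
  -- the `c y` on the right; `J-eq` then trades it for v times the sum of `H` plus `𝒦`.
  𝒦-eq : ∀ y → h y * 𝒦 y ≈ 1# + t * u * v * c y * D 1# (c y)
  𝒦-eq y = trans (lincomb₅ (1# - t * u * (v - 1#)) 1# (t * u * y) (- (t * u)) (t * u * c y)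
      (∑-unfold (u * y) K) K-zero eqC (∑-unfold (u * y) J) eqE
      (solve 13 (λ t u v y r κ k₀ sk sj j₀ j d₀ one →
         (con (+ 1) :- t :* u :* (y :+ v :- y :* v :* r)) :* κ
           :- (con (+ 1) :+ t :* u :* v :* (con (+ 1) :+ y :- y :* r) :* d₀)
         := (con (+ 1) :- t :* u :* (v :- con (+ 1))) :* (κ :- (k₀ :+ t :* (u :* y) :* sk))
            :+ con (+ 1) :* (k₀ :- (con (+ 1) :+ t :* u :* (j₀ :+ (v :- con (+ 1)) :* k₀)))
            :+ t :* u :* y :* (sk :- (((con (+ 1) :- r) :* j :+ t :* u :* sj) :+ (v :- con (+ 1)) :* (t :* u :* sk :- r :* κ)))
            :+ (:- (t :* u)) :* (j :- (j₀ :+ t :* (u :* y) :* sj))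
            :+ t :* u :* (con (+ 1) :+ y :- y :* r) :* (j :- (v :* d₀ :+ κ)))
         refl t u v y r _ _ _ _ _ _ _ 1#))
    (+-congˡ (*-congˡ (∑H≈D∘c 1# y)))
    where
    eqC : ∑ (u * y) (λ k → K (suc k)) ≈
      ((1# - r) * ∑ (u * y) J + t * u * ∑ (u * y) (λ k → J (suc k))) + (v - 1#) * (t * u * ∑ (u * y) (λ k → K (suc k)) - r * 𝒦 y)
    eqC = begin
      ∑ (u * y) (λ k → K (suc k))     ≈⟨ ∑-cong (u * y) K-slide ⟩
      _                               ≈⟨ horner-+ N _ _ _ ⟩
      _                               ≈⟨ +-cong (∑-linear₂ (u * y) (1# - r) (t * u) J (λ k → J (suc k))) (trans (horner-* N _ (v - 1#) _)
                                          (*-congˡ (trans (∑-cong (u * y) (λ k → +-congˡ (-‿distribˡ-* r (K k)))) (∑-linear₂ (u * y) (t * u) (- r) _ _)))) ⟩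
      _                               ≈⟨ +-congˡ (*-congˡ (+-congˡ (sym (-‿distribˡ-* r (𝒦 y))))) ⟩
      _                               ∎
      where open import Algebra.Properties.Ring ring using (-‿distribˡ-*)
    eqE : ∑ (u * y) J ≈ v * ∑ (u * y) (H 1# 0) + 𝒦 y
    eqE = trans (∑-cong (u * y) J-eq) (trans (horner-+ N _ _ _) (+-congʳ (horner-* N _ v _)))

  -- Prolonging the run by one entry costs t u y, so the recurrence in the length of the run is
  -- solved by a sum with these weights; what leaves the run is exactly `g`.
  run≈D : ∀ z y → gen (λ n → run∋0 z y n 0) ≈ D z y
  run≈D z y = solve-recurrence (u * y) (λ i → gen (λ n → run∋0 z y n i)) (g z) (λ i → begin
    gen (λ n → run∋0 z y n i)
      ≈⟨ gen-unfold _ ⟩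
    0# + t * gen (λ n → run∋0 z y (suc n) i)
      ≈⟨ +-congˡ (*-congˡ (trans (horner-+ N t _ _) (+-cong (horner-* N t _ _) (trans (horner-+ N t _ _)
           (+-cong (trans (horner-* N t _ _) (*-congˡ (horner-+ N t _ _)))
             (trans (genMove (tail∋0 z) (λ _ _ → 0#) [ 1# ] [] (used i))
             (trans (move-congʳ (𝓗 z) _ (λ _ → 0#) (λ _ → horner-0 N t) [ 1# ] [] (used i)) (splits-used z 0 i)))))))) ⟩
    0# + t * (u * y * G (suc i) + (x * z * (H z 0 i + K i) + x * diagonal z 1 i))
      ≈⟨ solve 5 (λ t u y a b → con (+ 0) :+ t :* (u :* y :* a :+ b) := t :* b :+ t :* (u :* y) :* a) refl t u y _ _ ⟩
    t * (x * z * (H z 0 i + K i) + x * diagonal z 1 i) + t * (u * y) * G (suc i)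
      ≈⟨ +-congʳ (g-eq z i) ⟨
    g z i + t * (u * y) * G (suc i) ∎)
    where
    G : ℕ → Carrier
    G i = gen (λ n → run∋0 z y n i)

  M : Carrier → Carrier
  M y = gen (run≥ y)

  M-eq : ∀ y → (1# - t * (u * v * y)) * M y ≈ 1# + t * u * v * y * D 1# y
  M-eq y = lincomb₁ 1# (begin
    M y                                                                    ≈⟨ gen-unfold _ ⟩
    1# + t * gen (λ n → run≥ y (suc n))                                    ≈⟨ +-congˡ (*-congˡ (trans (horner-* N t _ _) (*-congˡ (horner-+ N t _ _)))) ⟩
    1# + t * (u * y * v * (gen (λ n → run∋0 1# y n 0) + M y))              ≈⟨ +-congˡ (*-congˡ (*-congˡ (+-congʳ (run≈D 1# y)))) ⟩
    1# + t * (u * y * v * (D 1# y + M y))                                  ∎)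
    (solve 6 (λ t u v y m d → (con (+ 1) :- t :* (u :* v :* y)) :* m :- (con (+ 1) :+ t :* u :* v :* y :* d)
       := con (+ 1) :* (m :- (con (+ 1) :+ t :* (u :* y :* v :* (d :+ m))))) refl t u v y _ _)

  total-eq : ∀ z y → gen (total z y) ≈ z * y * v * (D z y + M y)
  total-eq z y = trans (horner-* N t _ _) (*-congˡ (trans (horner-+ N t _ _) (+-congʳ (run≈D z y))))

-- Commuting operators and the two symmetries

module Symmetry (S : CommutativeRing 0ℓ 0ℓ) (N : ℕ) (t : CommutativeRing.Carrier S)
  (nil : CommutativeRing._≈_ S (Series.pow S t (suc N)) (CommutativeRing.0# S)) where
  open CommutativeRing S hiding (zero)
  open import Relation.Binary.Reasoning.Setoid setoid
  open IntegerSolver S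
  open LinearCombination S
  open NilpotentSums S N t nil

  -- Uniqueness for the functional equations: with a leading factor that is 1 modulo t, the
  -- homogeneous equation can be rewritten in the form of `vanish`.
  vanish-kernel : ∀ (f kernel α b c : Carrier → Carrier) → (∀ y → kernel y ≈ 1# - t * α y) →
    (∀ y → kernel y * f y ≈ t * b y * f (c y)) → ∀ y → f y ≈ 0#
  vanish-kernel f kernel α b c kernel≈ eq = vanish f α b c (λ y → lincomb₂ 1# (- f y) (eq y) (kernel≈ y)
    (solve 6 (λ t f kernel α b fc → f :- t :* (α :* f :+ b :* fc)
       := con (+ 1) :* (kernel :* f :- t :* b :* fc) :+ (:- f) :* (kernel :- (con (+ 1) :- t :* α))) refl t (f y) (kernel y) (α y) (b y) (f (c y))))

  cancel-unit : ∀ {P p q} α → P ≈ 1# - t * α → P * p ≈ P * q → p ≈ q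
  cancel-unit α P≈ eq = cancel α (trans (*-congʳ (sym P≈)) (trans eq (*-congʳ P≈)))

  module _ (x u : Carrier) where
    module Kernel (v : Carrier) = KernelEquation S N t nil x u v

    r : Carrier
    r = t * (x + u - x * u)

    c kernel e : Carrier → Carrier
    c y = 1# + y - y * r
    kernel y = 1# - y * r + t * x * y
    e y = 1# - t * u * y

    h : Carrier → Carrier → Carrier
    h y v = 1# - t * u * (y + v - y * v * r)

    Δ₁ : Carrier → Carrier → Carrier
    Δ₁ y v = Kernel.D v 1# y

    -- At z = 1 the coefficient y + z (1 - y r) is `c y`, and eliminating `𝒦` produces h + t u v (1
    -- - y r) = e y. Thus v survives only in `h`.
    Δ₁-eq : ∀ y v → kernel y * h y v * Δ₁ y v ≈ t * x * (1# - y * r) + t * (x * c y * e y) * Δ₁ (c y) v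
    Δ₁-eq y v = lincomb₂ (h y v) (t * x * (1# - y * r)) (Kernel.D-eq v 1# y) (Kernel.𝒦-eq v y)
      (solve 9 (λ t x u y v r d κ d′ → let 1' = con (+ 1) ; Y = 1' :- y :* r ; kernel = Y :+ t :* x :* y
                                           h = 1' :- t :* u :* (y :+ v :- y :* v :* r) ; c = 1' :+ y :- y :* r in
         kernel :* h :* d :- (t :* x :* Y :+ t :* (x :* c :* (1' :- t :* u :* y)) :* d′)
         := h :* (kernel :* d :- (t :* x :* (y :+ 1' :* Y) :* d′ :+ t :* x :* 1' :* Y :* κ))
            :+ t :* x :* Y :* (h :* κ :- (1' :+ t :* u :* v :* c :* d′)))
        refl t x u y v r _ _ _)

    kernel-unit : Carrier → Carrier
    kernel-unit y = y * (x + u - x * u) - x * y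

    kernel≈ : ∀ y → kernel y ≈ 1# - t * kernel-unit y
    kernel≈ y = solve 4 (λ t x u y → con (+ 1) :- y :* (t :* (x :+ u :- x :* u)) :+ t :* x :* y
      := con (+ 1) :- t :* (y :* (x :+ u :- x :* u) :- x :* y)) refl t x u y

    Ah-unit : Carrier → Carrier → Carrier
    Ah-unit y w = kernel-unit y + u * w * kernel y

    Ah≈ : ∀ y w → kernel y * (1# - t * u * w) ≈ 1# - t * Ah-unit y w
    Ah≈ y w = lincomb₁ 1# (kernel≈ y) (solve 5 (λ t u w kernel a → kernel :* (con (+ 1) :- t :* u :* w) :- (con (+ 1) :- t :* (a :+ u :* w :* kernel))
      := con (+ 1) :* (kernel :- (con (+ 1) :- t :* a))) refl t u w (kernel y) (kernel-unit y))

    -- The mirrored equation: its defect is annihilated by the operator in y, because the two operators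
    -- commute up to the factors h.
    Δ₁-mirror : ∀ v y → kernel v * h y v * Δ₁ y v - t * (x * c v * e v) * Δ₁ y (c v) - t * x * (1# - v * r) ≈ 0#
    Δ₁-mirror v = vanish-kernel
      (λ y → kernel v * h y v * Δ₁ y v - t * (x * c v * e v) * Δ₁ y (c v) - t * x * (1# - v * r))
      (λ y → kernel y * h (c y) v) (λ y → Ah-unit y (c y + v - c y * v * r)) (λ y → x * c y * e y) c
      (λ y → Ah≈ y _)
      (λ y → lincomb₂ (kernel v * h (c y) v) (- (t * (x * c v * e v))) (Δ₁-eq y v) (Δ₁-eq y (c v))
        (solve 9 (λ t x u y v d₀₀ d₁₀ d₀₁ d₁₁ →
           let 1' = con (+ 1) ; r = t :* (x :+ u :- x :* u) ; Y = 1' :- y :* r ; V = 1' :- v :* r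
               c = 1' :+ y :- y :* r ; cv = 1' :+ v :- v :* r
               kernel = Y :+ t :* x :* y ; B = V :+ t :* x :* v
               h = λ y v → 1' :- t :* u :* (y :+ v :- y :* v :* r)
               a = t :* (x :* c :* (1' :- t :* u :* y)) ; b = t :* (x :* cv :* (1' :- t :* u :* v)) in
           kernel :* h c v :* (B :* h y v :* d₀₀ :- b :* d₀₁ :- t :* x :* V) :- a :* (B :* h c v :* d₁₀ :- b :* d₁₁ :- t :* x :* V)
           := B :* h c v :* (kernel :* h y v :* d₀₀ :- (t :* x :* Y :+ a :* d₁₀))
              :+ (:- b) :* (kernel :* h y cv :* d₀₁ :- (t :* x :* Y :+ a :* d₁₁)))
          refl t x u y v (Δ₁ y v) (Δ₁ (c y) v) (Δ₁ y (c v)) (Δ₁ (c y) (c v))))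

    -- As functions of v both sides solve the same equation, the left one by `Δ₁-mirror`, and the
    -- solution is unique.
    Δ₁-sym : ∀ y v → Δ₁ y v ≈ Δ₁ v y
    Δ₁-sym y v = difference-zero (vanish-kernel (λ v → Δ₁ y v - Δ₁ v y)
      (λ v → kernel v * h v y) (λ v → Ah-unit v (v + y - v * y * r)) (λ v → x * c v * e v) c (λ v → Ah≈ v _)
      (λ v → lincomb₂ 1# (- 1#) (Δ₁-mirror v y) (Δ₁-eq v y)
        (solve 12 (λ t u kernel b X y v r d₀₀ d₀₁ d e →
           let h = λ y v → con (+ 1) :- t :* u :* (y :+ v :- y :* v :* r) in
           kernel :* h v y :* (d₀₀ :- d) :- t :* b :* (d₀₁ :- e)
           := con (+ 1) :* (kernel :* h y v :* d₀₀ :- t :* b :* d₀₁ :- X :- con (+ 0))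
              :+ (:- con (+ 1)) :* (kernel :* h v y :* d :- (X :+ t :* b :* e)))
          refl t u (kernel v) (x * c v * e v) (t * x * (1# - v * r)) y v r _ _ _ _)) v)

    Δ : Carrier → Carrier → Carrier → Carrier
    Δ z y v = Kernel.D v z y

    κ : Carrier → Carrier → Carrier
    κ v y = Kernel.𝒦 v y

    m : Carrier → Carrier → Carrier
    m z y = x * (y + z * (1# - y * r))

    -- Both sides are 1 - t u (1 ∘ y ∘ v) for the law y ∘ v = y + v - y v r.
    h-swap : ∀ y v → h y (c v) ≈ h (c y) v
    h-swap y v = solve 5 (λ t u y v r → let h = λ y v → con (+ 1) :- t :* u :* (y :+ v :- y :* v :* r) in
      h y (con (+ 1) :+ v :- v :* r) := h (con (+ 1) :+ y :- y :* r) v) refl t u y v r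

    h-comm : ∀ y v → h y v ≈ h v y
    h-comm y v = solve 5 (λ t u y v r → let h = λ y v → con (+ 1) :- t :* u :* (y :+ v :- y :* v :* r) in
      h y v := h v y) refl t u y v r

    h≈ : ∀ y v → h y v ≈ 1# - t * (u * (y + v - y * v * r))
    h≈ y v = +-congˡ (-‿cong (*-assoc t u _))

    -- Multiplied by the common factor `h y (c v)`, both become 1 + t u c(y) c(v) Δ₁(c y, c v),
    -- which is symmetric in y and v.
    κ-double-shift : ∀ y v → κ (c v) y ≈ κ (c y) v
    κ-double-shift y v = cancel-unit _ (h≈ y (c v)) (begin
      h y (c v) * κ (c v) y                     ≈⟨ Kernel.𝒦-eq (c v) y ⟩
      1# + t * u * c v * c y * Δ₁ (c y) (c v)   ≈⟨ +-congˡ (*-cong (solve 4 (λ t u a b → t :* u :* a :* b := t :* u :* b :* a) refl t u (c v) (c y)) (Δ₁-sym (c y) (c v))) ⟩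
      1# + t * u * c y * c v * Δ₁ (c v) (c y)   ≈⟨ Kernel.𝒦-eq (c y) v ⟨
      h v (c y) * κ (c y) v                     ≈⟨ *-congʳ (trans (h-comm v (c y)) (sym (h-swap y v))) ⟩
      h y (c v) * κ (c y) v                     ∎)

    -- The mirrored operators agree on each other's right-hand sides.
    κ-exchange : ∀ z y v → (1# - y * r) * (kernel v * κ v y - t * m z v * κ (c v) y)
                         ≈ (1# - v * r) * (kernel y * κ y v - t * m z y * κ (c v) y)
    κ-exchange z y v = cancel-unit _ (h≈ (c y) v) (cancel-unit _ (h≈ y v) (lincomb₅
      (h (c y) v * (1# - y * r) * kernel v)
      (- (h (c y) v * (1# - v * r) * kernel y))
      (h y v * ((1# - v * r) * (t * m z y) - (1# - y * r) * (t * m z v)))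
      (t * u * v * c y * (1# - y * r))
      (- (t * u * y * c v * (1# - v * r)))
      (Kernel.𝒦-eq v y)
      (trans (*-congʳ (h-comm y v)) (trans (Kernel.𝒦-eq y v) (+-congˡ (*-congˡ (Δ₁-sym (c v) y)))))
      (trans (*-congʳ (sym (h-swap y v))) (Kernel.𝒦-eq (c v) y))
      (trans (*-cong (*-congˡ (h-comm (c y) v)) (Δ₁-sym (c y) v)) (trans (Δ₁-eq v (c y)) (+-congˡ (*-congˡ (Δ₁-sym (c v) (c y))))))
      (trans (*-congʳ (*-congˡ (sym (h-swap y v)))) (Δ₁-eq y (c v)))
      (solve 12 (λ t x u y v z κ₀ κ₁ κ₂ p q d →
           let 1' = con (+ 1) ; r = t :* (x :+ u :- x :* u) ; Y = 1' :- y :* r ; V = 1' :- v :* r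
               c = 1' :+ y :- y :* r ; cv = 1' :+ v :- v :* r
               kernel = Y :+ t :* x :* y ; B = V :+ t :* x :* v
               h = λ y v → 1' :- t :* u :* (y :+ v :- y :* v :* r)
               a = t :* (x :* c :* (1' :- t :* u :* y)) ; b = t :* (x :* cv :* (1' :- t :* u :* v))
               m = x :* (y :+ z :* Y) ; n = x :* (v :+ z :* V) in
           h y v :* (h c v :* (Y :* (B :* κ₀ :- t :* n :* κ₂))) :- h y v :* (h c v :* (V :* (kernel :* κ₁ :- t :* m :* κ₂)))
           := h c v :* Y :* B :* (h y v :* κ₀ :- (1' :+ t :* u :* v :* c :* p))
              :+ (:- (h c v :* V :* kernel)) :* (h y v :* κ₁ :- (1' :+ t :* u :* y :* cv :* q))
              :+ h y v :* (V :* (t :* m) :- Y :* (t :* n)) :* (h c v :* κ₂ :- (1' :+ t :* u :* cv :* c :* d))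
              :+ t :* u :* v :* c :* Y :* (B :* h c v :* p :- (t :* x :* V :+ b :* d))
              :+ (:- (t :* u :* y :* cv :* V)) :* (kernel :* h c v :* q :- (t :* x :* Y :+ a :* d)))
        refl t x u y v z (κ v y) (κ y v) (κ (c v) y) (Δ₁ (c y) v) (Δ₁ y (c v)) (Δ₁ (c y) (c v)))))

    -- The operator in y annihilates the defect: `κ-exchange` matches the inhomogeneous terms, and
    -- the value of `κ` shifted in the other variable is identified by `κ-double-shift`.
    Δ-mirror : ∀ z v y → kernel v * Δ z y v - t * m z v * Δ z y (c v) - t * x * z * (1# - v * r) * κ y v ≈ 0#
    Δ-mirror z v = vanish-kernel
      (λ y → kernel v * Δ z y v - t * m z v * Δ z y (c v) - t * x * z * (1# - v * r) * κ y v)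
      kernel kernel-unit (m z) c kernel≈
      (λ y → lincomb₄ (kernel v) (- (t * m z v)) (t * x * z) (t * x * z * (1# - v * r) * (t * m z y))
        (Kernel.D-eq v z y) (Kernel.D-eq (c v) z y) (κ-exchange z y v) (sym (κ-double-shift y v))
        (solve 17 (λ t x y z Y V kernel B n d₀₀ d₁₀ d₀₁ d₁₁ κ₀ κ₁ κ₂ κ₃ →
           let M = x :* (y :+ z :* Y) in
           kernel :* (B :* d₀₀ :- t :* n :* d₀₁ :- t :* x :* z :* V :* κ₁) :- t :* M :* (B :* d₁₀ :- t :* n :* d₁₁ :- t :* x :* z :* V :* κ₃)
           := B :* (kernel :* d₀₀ :- (t :* x :* (y :+ z :* Y) :* d₁₀ :+ t :* x :* z :* Y :* κ₀))
              :+ (:- (t :* n)) :* (kernel :* d₀₁ :- (t :* x :* (y :+ z :* Y) :* d₁₁ :+ t :* x :* z :* Y :* κ₂))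
              :+ t :* x :* z :* (Y :* (B :* κ₀ :- t :* n :* κ₂) :- V :* (kernel :* κ₁ :- t :* M :* κ₂))
              :+ (t :* x :* z :* V :* (t :* M)) :* (κ₃ :- κ₂))
          refl t x y z (1# - y * r) (1# - v * r) (kernel y) (kernel v) (m z v) (Δ z y v) (Δ z (c y) v) (Δ z y (c v)) (Δ z (c y) (c v)) (κ v y) (κ y v) (κ (c v) y) (κ (c y) v)))

    Δ-sym : ∀ z y v → Δ z y v ≈ Δ z v y
    Δ-sym z y v = difference-zero (vanish-kernel (λ v → Δ z y v - Δ z v y) kernel kernel-unit (m z) c kernel≈
      (λ v → lincomb₂ 1# (- 1#) (Δ-mirror z v y) (Kernel.D-eq y z v)
        (solve 11 (λ t x z v V kernel d₀₀ d₀₁ κ d →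
           λ e → let n = x :* (v :+ z :* V) in
           kernel :* (d₀₀ :- d) :- t :* n :* (d₀₁ :- e)
           := con (+ 1) :* (kernel :* d₀₀ :- t :* n :* d₀₁ :- t :* x :* z :* V :* κ :- con (+ 0))
              :+ (:- con (+ 1)) :* (kernel :* d :- (t :* x :* (v :+ z :* V) :* e :+ t :* x :* z :* V :* κ)))
          refl t x z v (1# - v * r) _ _ _ _ _ _)) v)

    M-sym : ∀ y v → Kernel.M v y ≈ Kernel.M y v
    M-sym y v = cancel (u * v * y) (begin
      (1# - t * (u * v * y)) * Kernel.M v y    ≈⟨ Kernel.M-eq v y ⟩
      1# + t * u * v * y * Δ₁ y v              ≈⟨ +-congˡ (*-cong (solve 4 (λ t u v y → t :* u :* v :* y := t :* u :* y :* v) refl t u v y) (Δ₁-sym y v)) ⟩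
      1# + t * u * y * v * Δ₁ v y              ≈⟨ Kernel.M-eq y v ⟨
      (1# - t * (u * y * v)) * Kernel.M y v    ≈⟨ *-congʳ (solve 4 (λ t u v y → con (+ 1) :- t :* (u :* y :* v) := con (+ 1) :- t :* (u :* v :* y)) refl t u v y) ⟩
      (1# - t * (u * v * y)) * Kernel.M y v    ∎)

    φ : Carrier → Carrier → Carrier
    φ z y = Kernel.D 1# z y + Kernel.M 1# y

    -- At v = 1 the series `𝒦` is `M` at `c y`, so the sum of the recurring and the non-recurring
    -- part is the only unknown left. Its coefficient y + z - y z r is symmetric in y and z.
    φ-eq : ∀ z y → e y * (kernel y * φ z y - t * (x * (y + z - y * z * r)) * φ z (c y)) ≈ 1# - y * r
    φ-eq z y = lincomb₅ (e y) (t * u * y) (kernel y) (- (t * x * y)) (t * x * (1# - y * r) * (e y * z + t * u * y))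
      (Kernel.D-eq 1# z y) (Kernel.D-eq 1# 1# y) (Kernel.M-eq 1# y) (Kernel.M-eq 1# (c y)) 𝒦≈M∘c
      (solve 13 (λ t x u y z r d d′ d₁ d₁′ m m′ κ →
         let 1' = con (+ 1) ; Y = 1' :- y :* r ; kernel = Y :+ t :* x :* y ; e = 1' :- t :* u :* y ; c = 1' :+ y :- y :* r in
         e :* (kernel :* (d :+ m) :- t :* (x :* (y :+ z :- y :* z :* r)) :* (d′ :+ m′)) :- Y
         := e :* (kernel :* d :- (t :* x :* (y :+ z :* Y) :* d′ :+ t :* x :* z :* Y :* κ))
            :+ t :* u :* y :* (kernel :* d₁ :- (t :* x :* (y :+ 1' :* Y) :* d₁′ :+ t :* x :* 1' :* Y :* κ))
            :+ kernel :* ((1' :- t :* (u :* 1' :* y)) :* m :- (1' :+ t :* u :* 1' :* y :* d₁))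
            :+ (:- (t :* x :* y)) :* ((1' :- t :* (u :* 1' :* c)) :* m′ :- (1' :+ t :* u :* 1' :* c :* d₁′))
            :+ t :* x :* Y :* (e :* z :+ t :* u :* y) :* (κ :- m′))
        refl t x u y z r _ _ _ _ _ _ _)
      where
      𝒦≈M∘c : Kernel.𝒦 1# y ≈ Kernel.M 1# (c y)
      𝒦≈M∘c = cancel (u * 1# * c y) (begin
        (1# - t * (u * 1# * c y)) * Kernel.𝒦 1# y       ≈⟨ *-congʳ (solve 4 (λ t u y r → con (+ 1) :- t :* (u :* con (+ 1) :* (con (+ 1) :+ y :- y :* r))
                                                            := con (+ 1) :- t :* u :* (y :+ con (+ 1) :- y :* con (+ 1) :* r)) refl t u y r) ⟩
        h y 1# * Kernel.𝒦 1# y                           ≈⟨ Kernel.𝒦-eq 1# y ⟩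
        1# + t * u * 1# * c y * Kernel.D 1# 1# (c y)     ≈⟨ Kernel.M-eq 1# (c y) ⟨
        (1# - t * (u * 1# * c y)) * Kernel.M 1# (c y)    ∎)

  -- With w = y + z - y z r one has kernel x u y - t x w = (1 - y r)(1 - t x z) and kernel u x z - t
  -- u w = (1 - z r)(1 - t u y). Hence either operator takes the right-hand side of the other to (1
  -- - y r)(1 - z r)(1 - t u y)(1 - t x z).
  φ-mirror : ∀ x u z y → e u x z * (kernel u x z * φ x u z y - t * (u * (y + z - y * z * r x u)) * φ x u (c u x z) y) ≈ 1# - z * r x u
  φ-mirror x u z y = difference-zero (vanish-kernel
    (λ y → e u x z * (kernel u x z * φ x u z y - t * (u * (y + z - y * z * r x u)) * φ x u (c u x z) y) - (1# - z * r x u))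
    (kernel x u) (kernel-unit x u) (λ y → x * (y + z - y * z * r x u)) (c x u) (kernel≈ x u)
    -- The factor `e x u y` in front of `φ-eq` is 1 - t (u y); it is removed so that only `kernel`
    -- leads the equation.
    (λ y → cancel (u * y) (lincomb₂ (e u x z * kernel u x z) (- (e u x z * (t * (u * (y + z - y * z * r x u)))))
      (φ-eq x u z y) (φ-eq x u (c u x z) y)
      (solve 9 (λ t x u y z f₀₀ f₁₀ f₀₁ f₁₁ →
         let 1' = con (+ 1) ; r = t :* (x :+ u :- x :* u) ; r' = t :* (u :+ x :- u :* x) ; Y = 1' :- y :* r ; Z = 1' :- z :* r
             kernel = Y :+ t :* x :* y ; B = 1' :- z :* r' :+ t :* u :* z ; e = 1' :- t :* u :* y ; e' = 1' :- t :* x :* z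
             c = 1' :+ y :- y :* r ; cz = 1' :+ z :- z :* r' ; w = λ y z → y :+ z :- y :* z :* r in
         (1' :- t :* (u :* y)) :* (kernel :* (e' :* (B :* f₀₀ :- t :* (u :* w y z) :* f₀₁) :- Z))
         :- (1' :- t :* (u :* y)) :* (t :* (x :* w y z) :* (e' :* (B :* f₁₀ :- t :* (u :* w c z) :* f₁₁) :- Z))
         := e' :* B :* (e :* (kernel :* f₀₀ :- t :* (x :* w y z) :* f₁₀) :- Y)
            :+ (:- (e' :* (t :* (u :* w y z)))) :* (e :* (kernel :* f₀₁ :- t :* (x :* w y cz) :* f₁₁) :- Y))
        refl t x u y z (φ x u z y) (φ x u z (c x u y)) (φ x u (c u x z) y) (φ x u (c u x z) (c x u y)))))
    y)

  -- As functions of z both sides solve the equation belonging to the exchanged pair (u, x), the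
  -- left one by `φ-mirror`.
  φ-sym : ∀ x u z y → φ x u z y ≈ φ u x y z
  φ-sym x u z y = difference-zero (vanish-kernel (λ z → φ x u z y - φ u x y z)
    (kernel u x) (kernel-unit u x) (λ z → u * (y + z - y * z * r x u)) (c u x) (kernel≈ u x)
    (λ z → cancel (x * z) (lincomb₂ 1# (- 1#) (φ-mirror x u z y) (φ-eq u x y z)
      (solve 9 (λ t x u y z f₀ f₁ g₀ g₁ →
         let 1' = con (+ 1) ; r = t :* (x :+ u :- x :* u) ; r' = t :* (u :+ x :- u :* x)
             B = 1' :- z :* r' :+ t :* u :* z ; e' = 1' :- t :* x :* z ; w = λ y z → y :+ z :- y :* z :* r in
         (1' :- t :* (x :* z)) :* (B :* (f₀ :- g₀)) :- (1' :- t :* (x :* z)) :* (t :* (u :* w y z) :* (f₁ :- g₁))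
         := 1' :* (e' :* (B :* f₀ :- t :* (u :* w y z) :* f₁) :- (1' :- z :* r))
            :+ (:- 1') :* (e' :* (B :* g₀ :- t :* (u :* (z :+ y :- z :* y :* r')) :* g₁) :- (1' :- z :* r')))
        refl t x u y z (φ x u z y) (φ x u (c u x z) y) (φ u x y z) (φ u x y (c u x z)))))
    z)

-- Sums over ascent sequences, read from the left

<ᵇ-true : ∀ {m n} → m < n → (m <ᵇ n) ≡ true
<ᵇ-true {zero}  (s≤s _)         = ≡.refl
<ᵇ-true {suc m} (s≤s (s≤s m<n)) = <ᵇ-true (s≤s m<n)

≤ᵇ-true : ∀ {m n} → m ≤ n → (m ≤ᵇ n) ≡ true
≤ᵇ-true {zero}  _   = ≡.refl
≤ᵇ-true {suc m} m<n = <ᵇ-true m<n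

<ᵇ-false : ∀ {m n} → n ≤ m → (m <ᵇ n) ≡ false
<ᵇ-false {zero}  z≤n       = ≡.refl
<ᵇ-false {suc m} z≤n       = ≡.refl
<ᵇ-false {suc m} (s≤s n≤m) = <ᵇ-false n≤m

≡ᵇ-refl : ∀ m → (m ≡ᵇ m) ≡ true
≡ᵇ-refl zero    = ≡.refl
≡ᵇ-refl (suc m) = ≡ᵇ-refl m

≡ᵇ-false-< : ∀ {m n} → m < n → (m ≡ᵇ n) ≡ false
≡ᵇ-false-< {zero}  (s≤s _)   = ≡.refl
≡ᵇ-false-< {suc m} (s≤s m<n) = ≡ᵇ-false-< m<n

≡ᵇ-false-> : ∀ {m n} → n < m → (m ≡ᵇ n) ≡ false
≡ᵇ-false-> {n = zero}  (s≤s _)   = ≡.refl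
≡ᵇ-false-> {n = suc n} (s≤s n<m) = ≡ᵇ-false-> n<m

bump-≤ : ∀ {k p a} → a ≤ p → bump k p a ≡ k
bump-≤ {k} a≤p = ≡.cong (λ b → (if b then 1 else 0) ℕ.+ k) (<ᵇ-false a≤p)

bump-> : ∀ {k p a} → p < a → bump k p a ≡ suc k
bump-> {k} p<a = ≡.cong (λ b → (if b then 1 else 0) ℕ.+ k) (<ᵇ-true p<a)

bump≤ : ∀ k p a → bump k p a ≤ suc k
bump≤ k p a with p <ᵇ a
... | true  = ℕₚ.≤-refl
... | false = ℕₚ.n≤1+n k

-- Records the bounds on the entries of a word, so that a termwise equality under `ΣC` may rely on
-- them.
data Continuation (lo : ℕ) : ℕ → ℕ → List ℕ → Set where
  end  : ∀ {k p} → Continuation lo k p []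
  next : ∀ {k p a s} → lo ≤ a → a ≤ suc k → Continuation lo (bump k p a) a s → Continuation lo k p (a ∷ s)

mark : ℕ → (ℕ → Bool) → ℕ → Bool
mark a U b = (b ≡ᵇ a) ∨ U b

module ListSums (S : CommutativeRing 0ℓ 0ℓ) where
  open CommutativeRing S hiding (zero)
  open Series S using (sumL; pow)
  open import Relation.Binary.Reasoning.Setoid setoid
  open IntegerSolver S

  ind : Bool → Carrier → Carrier
  ind b a = if b then a else 0#

  ind-cong : ∀ b {p q} → p ≈ q → ind b p ≈ ind b q
  ind-cong true  e = e
  ind-cong false e = refl

  ΣR : ℕ → ℕ → (ℕ → Carrier) → Carrier
  ΣR a zero    h = 0#
  ΣR a (suc n) h = h a + ΣR (suc a) n h

  ΣR-cong : ∀ a n {h h′} → (∀ b → h b ≈ h′ b) → ΣR a n h ≈ ΣR a n h′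
  ΣR-cong a zero    e = refl
  ΣR-cong a (suc n) e = +-cong (e a) (ΣR-cong (suc a) n e)

  ΣR-shift : ∀ a n h → ΣR (suc a) n h ≈ ΣR a n (λ b → h (suc b))
  ΣR-shift a zero    h = refl
  ΣR-shift a (suc n) h = +-congˡ (ΣR-shift (suc a) n h)

  ΣR-0 : ∀ a n {h} → (∀ b → b < a ℕ.+ n → h b ≈ 0#) → ΣR a n h ≈ 0#
  ΣR-0 a zero    e = refl
  ΣR-0 a (suc n) e = trans (+-cong (e a (ℕₚ.m<m+n a (s≤s z≤n)))
    (ΣR-0 (suc a) n (λ b lt → e b (≡.subst (b <_) (≡.sym (ℕₚ.+-suc a n)) lt)))) (+-identityˡ 0#)

  ΣR-split : ∀ a m n h → ΣR a (m ℕ.+ n) h ≈ ΣR a m h + ΣR (a ℕ.+ m) n h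
  ΣR-split a zero    n h = trans (reflexive (≡.cong (λ b → ΣR b n h) (≡.sym (ℕₚ.+-identityʳ a)))) (sym (+-identityˡ _))
  ΣR-split a (suc m) n h = trans (+-congˡ (trans (ΣR-split (suc a) m n h)
    (reflexive (≡.cong (λ b → ΣR (suc a) m h + ΣR b n h) (≡.sym (ℕₚ.+-suc a m)))))) (sym (+-assoc _ _ _))

  ΣR-cut : ∀ {m k} h → k ≤ m → ΣR 0 m (λ a → ind (a <ᵇ k) (h a)) ≈ ΣR 0 k h
  ΣR-cut {m} h z≤n = ΣR-0 0 m (λ { zero _ → refl ; (suc b) _ → refl })
  ΣR-cut {suc m} {suc k} h (s≤s k≤m) = +-congˡ (trans (ΣR-shift 0 m _)
    (trans (ΣR-cut (λ a → h (suc a)) k≤m) (sym (ΣR-shift 0 k h))))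

  sumL-cong : ∀ {B : Set} {f g : B → Carrier} → (∀ s → f s ≈ g s) → ∀ xs → sumL (map f xs) ≈ sumL (map g xs)
  sumL-cong e []       = refl
  sumL-cong e (s ∷ xs) = +-cong (e s) (sumL-cong e xs)

  sumL-++ : ∀ {B : Set} (f : B → Carrier) xs ys → sumL (map f (xs ++ ys)) ≈ sumL (map f xs) + sumL (map f ys)
  sumL-++ f []       ys = sym (+-identityˡ _)
  sumL-++ f (s ∷ xs) ys = trans (+-congˡ (sumL-++ f xs ys)) (sym (+-assoc _ _ _))

  sumL-concatMap : ∀ {B C : Set} (f : C → Carrier) (k : B → List C) xs →
    sumL (map f (concatMap k xs)) ≈ sumL (map (λ s → sumL (map f (k s))) xs)
  sumL-concatMap f k []       = refl
  sumL-concatMap f k (s ∷ xs) = trans (sumL-++ f (k s) (concatMap k xs)) (+-congˡ (sumL-concatMap f k xs))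

  sumL-map : ∀ {B C : Set} (f : C → Carrier) (g : B → C) xs → sumL (map f (map g xs)) ≈ sumL (map (λ s → f (g s)) xs)
  sumL-map f g []       = refl
  sumL-map f g (s ∷ xs) = +-congˡ (sumL-map f g xs)

  sumL-filter : ∀ {B : Set} (f : B → Carrier) (p : B → Bool) xs → sumL (map f (filterᵇ p xs)) ≈ sumL (map (λ s → ind (p s) (f s)) xs)
  sumL-filter f p []       = refl
  sumL-filter f p (s ∷ xs) with p s
  ... | true  = +-congˡ (sumL-filter f p xs)
  ... | false = trans (sumL-filter f p xs) (sym (+-identityˡ _))

  sumL-upTo : ∀ n h → sumL (map h (upTo n)) ≈ ΣR 0 n h
  sumL-upTo n h = go n (λ a → a)
    where
    go : ∀ n f → sumL (map h (applyUpTo f n)) ≈ ΣR 0 n (λ a → h (f a))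
    go zero    f = refl
    go (suc n) f = +-congˡ (trans (go n (λ a → f (suc a))) (sym (ΣR-shift 0 n _)))

  -- Sums over the n entries that can follow m entries of an inversion sequence, chosen from the
  -- left. `invSeqs` grows at the right end; `ΣI-snoc` reconciles the two.
  ΣI : ℕ → ℕ → (List ℕ → Carrier) → Carrier
  ΣI m zero    g = g []
  ΣI m (suc n) g = ΣR 0 (suc m) (λ a → ΣI (suc m) n (λ s → g (a ∷ s)))

  ΣI-cong : ∀ m n {g g′} → (∀ s → g s ≈ g′ s) → ΣI m n g ≈ ΣI m n g′
  ΣI-cong m zero    e = e []
  ΣI-cong m (suc n) e = ΣR-cong 0 (suc m) (λ a → ΣI-cong (suc m) n (λ s → e (a ∷ s)))

  ΣI-0 : ∀ m n → ΣI m n (λ _ → 0#) ≈ 0#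
  ΣI-0 m zero    = refl
  ΣI-0 m (suc n) = ΣR-0 0 (suc m) (λ _ _ → ΣI-0 (suc m) n)

  ΣI-snoc : ∀ m n g → ΣI m (suc n) g ≈ ΣI m n (λ s → ΣR 0 (suc (m ℕ.+ n)) (λ a → g (s ++ [ a ])))
  ΣI-snoc m zero    g = reflexive (≡.cong (λ i → ΣR 0 (suc i) (λ a → g [ a ])) (≡.sym (ℕₚ.+-identityʳ m)))
  ΣI-snoc m (suc n) g = ΣR-cong 0 (suc m) (λ a → trans (ΣI-snoc (suc m) n (λ s → g (a ∷ s)))
    (reflexive (≡.cong (λ i → ΣI (suc m) n (λ s → ΣR 0 (suc i) (λ b → g (a ∷ s ++ [ b ])))) (≡.sym (ℕₚ.+-suc m n)))))

  sumL-invSeqs : ∀ n g → sumL (map g (invSeqs n)) ≈ ΣI 0 n g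
  sumL-invSeqs zero    g = +-identityʳ _
  sumL-invSeqs (suc n) g = begin
    sumL (map g (invSeqs (suc n)))
      ≈⟨ sumL-concatMap g (λ s → map (λ a → s ++ [ a ]) (upTo (suc n))) (invSeqs n) ⟩
    sumL (map (λ s → sumL (map g (map (λ a → s ++ [ a ]) (upTo (suc n))))) (invSeqs n))
      ≈⟨ sumL-cong (λ s → trans (sumL-map g (λ a → s ++ [ a ]) (upTo (suc n))) (sumL-upTo (suc n) _)) (invSeqs n) ⟩
    sumL (map (λ s → ΣR 0 (suc n) (λ a → g (s ++ [ a ]))) (invSeqs n))
      ≈⟨ sumL-invSeqs n _ ⟩
    ΣI 0 n (λ s → ΣR 0 (suc n) (λ a → g (s ++ [ a ])))
      ≈⟨ ΣI-snoc 0 n g ⟨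
    ΣI 0 (suc n) g ∎

  -- The same for ascent sequences with k ascents and last entry p so far. The bound `lo` is the
  -- counterpart of deleting the slots below it.
  ΣC : ℕ → ℕ → ℕ → ℕ → (List ℕ → Carrier) → Carrier
  ΣC lo zero    k p g = g []
  ΣC lo (suc n) k p g = ΣR 0 (suc (suc k)) (λ a → ind (lo ≤ᵇ a) (ΣC lo n (bump k p a) a (λ s → g (a ∷ s))))

  ΣR-cong-< : ∀ a n {h h′} → (∀ b → a ≤ b → b < n ℕ.+ a → h b ≈ h′ b) → ΣR a n h ≈ ΣR a n h′
  ΣR-cong-< a zero    e = refl
  ΣR-cong-< a (suc n) e = +-cong (e a ℕₚ.≤-refl (s≤s (ℕₚ.m≤n+m a n)))
    (ΣR-cong-< (suc a) n (λ b a<b lt → e b (ℕₚ.<⇒≤ a<b) (≡.subst (b <_) (ℕₚ.+-suc n a) lt)))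

  ΣC-cong : ∀ lo n k p {g g′} → (∀ {s} → Continuation lo k p s → g s ≈ g′ s) → ΣC lo n k p g ≈ ΣC lo n k p g′
  ΣC-cong lo zero    k p e = e end
  ΣC-cong lo (suc n) k p {g} {g′} e = ΣR-cong-< 0 (suc (suc k)) (λ a _ a<2+k → term a (λ lo≤a →
      ΣC-cong lo n (bump k p a) a (λ c → e (next lo≤a (ℕₚ.≤-pred (≡.subst (a <_) (ℕₚ.+-identityʳ _) a<2+k)) c))))
    where
    term : ∀ a {α β} → (lo ≤ a → α ≈ β) → ind (lo ≤ᵇ a) α ≈ ind (lo ≤ᵇ a) β
    term a h with lo ≤ᵇ a in eq
    ... | true  = h (ℕₚ.≤ᵇ⇒≤ lo a (≡.subst Bool.T (≡.sym eq) tt))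
    ... | false = refl

  ind-+ : ∀ b p q → ind b (p + q) ≈ ind b p + ind b q
  ind-+ true  p q = refl
  ind-+ false p q = sym (+-identityˡ 0#)

  ind-* : ∀ b c p → ind b (c * p) ≈ c * ind b p
  ind-* true  c p = refl
  ind-* false c p = sym (zeroʳ c)

  ind-0 : ∀ b → ind b 0# ≈ 0#
  ind-0 true  = refl
  ind-0 false = refl

  ΣR-+ : ∀ a n f g → ΣR a n (λ b → f b + g b) ≈ ΣR a n f + ΣR a n g
  ΣR-+ a zero    f g = sym (+-identityˡ 0#)
  ΣR-+ a (suc n) f g = trans (+-congˡ (ΣR-+ (suc a) n f g))
    (solve 4 (λ a b c d → (a :+ b) :+ (c :+ d) := (a :+ c) :+ (b :+ d)) refl _ _ _ _)

  ΣR-* : ∀ a n c f → ΣR a n (λ b → c * f b) ≈ c * ΣR a n f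
  ΣR-* a zero    c f = sym (zeroʳ c)
  ΣR-* a (suc n) c f = trans (+-congˡ (ΣR-* (suc a) n c f)) (sym (distribˡ c _ _))

  ΣC-+ : ∀ lo n k p f g → ΣC lo n k p (λ s → f s + g s) ≈ ΣC lo n k p f + ΣC lo n k p g
  ΣC-+ lo zero    k p f g = refl
  ΣC-+ lo (suc n) k p f g = trans (ΣR-cong 0 (suc (suc k)) (λ a → trans (ind-cong (lo ≤ᵇ a) (ΣC-+ lo n _ a _ _)) (ind-+ (lo ≤ᵇ a) _ _)))
    (ΣR-+ 0 (suc (suc k)) _ _)

  ΣC-* : ∀ lo n k p c f → ΣC lo n k p (λ s → c * f s) ≈ c * ΣC lo n k p f
  ΣC-* lo zero    k p c f = refl
  ΣC-* lo (suc n) k p c f = trans (ΣR-cong 0 (suc (suc k)) (λ a → trans (ind-cong (lo ≤ᵇ a) (ΣC-* lo n _ a c _)) (ind-* (lo ≤ᵇ a) c _)))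
    (ΣR-* 0 (suc (suc k)) c _)

  ΣC-0 : ∀ lo n k p → ΣC lo n k p (λ _ → 0#) ≈ 0#
  ΣC-0 lo zero    k p = refl
  ΣC-0 lo (suc n) k p = ΣR-0 0 (suc (suc k)) (λ a _ → trans (ind-cong (lo ≤ᵇ a) (ΣC-0 lo n _ a)) (ind-0 (lo ≤ᵇ a)))

  -- For k + 1 ≤ m the ascent bound implies the inversion bound. This persists, since an entry
  -- raises m by one and k by at most one.
  ΣI-ascent : ∀ m n k p g → suc k ≤ m → ΣI m n (λ s → ind (ascentFrom k p s) (g s)) ≈ ΣC 0 n k p g
  ΣI-ascent m zero    k p g k<m = refl
  ΣI-ascent m (suc n) k p g k<m = begin
    ΣR 0 (suc m) (λ a → ΣI (suc m) n (λ s → ind ((a ≤ᵇ suc k) ∧ ascentFrom (bump k p a) a s) (g (a ∷ s))))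
      ≈⟨ ΣR-cong 0 (suc m) term ⟩
    ΣR 0 (suc m) (λ a → ind (a ≤ᵇ suc k) (h a))
      ≈⟨ +-congˡ (trans (ΣR-shift 0 m _) (trans (ΣR-cut (λ a → h (suc a)) k<m) (sym (ΣR-shift 0 (suc k) _)))) ⟩
    ΣR 0 (suc (suc k)) h ∎
    where
    h : ℕ → Carrier
    h a = ΣC 0 n (bump k p a) a (λ s → g (a ∷ s))
    term : ∀ a → ΣI (suc m) n (λ s → ind ((a ≤ᵇ suc k) ∧ ascentFrom (bump k p a) a s) (g (a ∷ s))) ≈ ind (a ≤ᵇ suc k) (h a)
    term a with a ≤ᵇ suc k
    ... | true  = ΣI-ascent (suc m) n (bump k p a) a (λ s → g (a ∷ s)) (s≤s (ℕₚ.≤-trans (bump≤ k p a) k<m))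
    ... | false = ΣI-0 (suc m) n

  sumL-A : ∀ n g → sumL (map g (A (suc n))) ≈ ΣC 0 n 0 0 (λ s → g (0 ∷ s))
  sumL-A n g = begin
    sumL (map g (A (suc n)))                                            ≈⟨ sumL-filter g isAscent (invSeqs (suc n)) ⟩
    sumL (map (λ s → ind (isAscent s) (g s)) (invSeqs (suc n)))         ≈⟨ sumL-invSeqs (suc n) _ ⟩
    ΣI 1 n (λ s → ind (isAscent (0 ∷ s)) (g (0 ∷ s))) + 0#              ≈⟨ +-identityʳ _ ⟩
    ΣI 1 n (λ s → ind (isAscent (0 ∷ s)) (g (0 ∷ s)))                   ≈⟨ ΣI-cong 1 n (λ s → reflexive (≡.cong (λ b → ind b (g (0 ∷ s))) (ascent s))) ⟩
    ΣI 1 n (λ s → ind (ascentFrom 0 0 s) (g (0 ∷ s)))                   ≈⟨ ΣI-ascent 1 n 0 0 _ (s≤s z≤n) ⟩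
    ΣC 0 n 0 0 (λ s → g (0 ∷ s))                                        ∎
    where
    ascent : ∀ s → isAscent (0 ∷ s) ≡ ascentFrom 0 0 s
    ascent []      = ≡.refl
    ascent (b ∷ s) = isAscent-∷ 0 b s

  ΣC-above : ∀ b lo n k p g → lo ≤ suc b → ΣC lo n k p (λ s → ind (allB (b <ᵇ_) s) (g s)) ≈ ΣC (suc b) n k p g
  ΣC-above b lo zero    k p g lo≤ = refl
  ΣC-above b lo (suc n) k p g lo≤ = ΣR-cong 0 (suc (suc k)) term
    where
    term : ∀ a → ind (lo ≤ᵇ a) (ΣC lo n (bump k p a) a (λ s → ind ((b <ᵇ a) ∧ allB (b <ᵇ_) s) (g (a ∷ s))))
               ≈ ind (b <ᵇ a) (ΣC (suc b) n (bump k p a) a (λ s → g (a ∷ s)))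
    term a with b <ᵇ a in eq
    ... | false = trans (ind-cong (lo ≤ᵇ a) (ΣC-0 lo n _ a)) (ind-0 (lo ≤ᵇ a))
    ... | true rewrite ≤ᵇ-true (ℕₚ.≤-trans lo≤ (ℕₚ.<ᵇ⇒< b a (≡.subst Bool.T (≡.sym eq) tt))) =
      ΣC-above b lo n (bump k p a) a (λ s → g (a ∷ s)) lo≤

-- Correctness of the slot model

module Statistics (S : CommutativeRing 0ℓ 0ℓ) (x u v : CommutativeRing.Carrier S) where
  open CommutativeRing S hiding (zero)
  open import Relation.Binary.Reasoning.Setoid setoid
  open IntegerSolver S
  open ListSums S
  open Series S using (sumL)
  open WordModel S
  open Weights x u v

  weightIf : Bool → Carrier → Carrier
  weightIf b a = if b then a else 1#

  slot : (ℕ → Bool) → ℕ → Carrier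
  slot U a = weightIf (U a) x

  seg : (ℕ → Bool) → ℕ → ℕ → List Carrier
  seg U a zero    = []
  seg U a (suc n) = slot U a ∷ seg U (suc a) n

  seg-++ : ∀ U a m n → seg U a (m ℕ.+ n) ≡ seg U a m ++ seg U (m ℕ.+ a) n
  seg-++ U a zero    n = ≡.refl
  seg-++ U a (suc m) n = ≡.cong (slot U a ∷_) (≡.trans (seg-++ U (suc a) m n)
    (≡.cong (λ b → seg U (suc a) m ++ seg U b n) (ℕₚ.+-suc m a)))

  seg-mark-> : ∀ U {a b} n → a < b → seg (mark a U) b n ≡ seg U b n
  seg-mark-> U zero    a<b = ≡.refl
  seg-mark-> U {a} {b} (suc n) a<b = ≡.cong₂ _∷_
    (≡.cong (λ e → weightIf (e ∨ U b) x) (≡ᵇ-false-> a<b)) (seg-mark-> U n (ℕₚ.m<n⇒m<1+n a<b))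

  seg-mark-last : ∀ U a lo i → i ℕ.+ lo ≡ a → seg (mark a U) lo (suc i) ≡ seg U lo i ++ [ x ]
  seg-mark-last U a lo zero    ≡.refl = ≡.cong (λ e → weightIf (e ∨ U a) x ∷ []) (≡ᵇ-refl a)
  seg-mark-last U a lo (suc i) eq = ≡.cong₂ _∷_
    (≡.cong (λ e → weightIf (e ∨ U lo) x) (≡ᵇ-false-< (≡.subst (lo <_) eq (ℕₚ.m<n+m lo (s≤s z≤n)))))
    (seg-mark-last U a (suc lo) i (≡.trans (ℕₚ.+-suc i lo) eq))

  seg-fresh : ∀ U a n {k} → (∀ b → k < b → U b ≡ false) → k < n ℕ.+ a → seg U a (suc n) ≡ seg U a n ++ [ 1# ]
  seg-fresh U a zero    fresh k<a = ≡.cong (λ e → weightIf e x ∷ []) (fresh a k<a)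
  seg-fresh U a (suc n) {k} fresh k<a = ≡.cong (slot U a ∷_) (seg-fresh U (suc a) n {k} fresh (≡.subst (k <_) (≡.sym (ℕₚ.+-suc n a)) k<a))

  splits-+ : ∀ φ ψ P Q → splits (λ P c Q → φ P c Q + ψ P c Q) P Q ≈ splits φ P Q + splits ψ P Q
  splits-+ φ ψ P []      = sym (+-identityˡ 0#)
  splits-+ φ ψ P (c ∷ Q) = trans (+-congˡ (splits-+ φ ψ (P ++ [ c ]) Q))
    (solve 4 (λ a b c d → (a :+ b) :+ (c :+ d) := (a :+ c) :+ (b :+ d)) refl _ _ _ _)

  splits-* : ∀ k φ P Q → splits (λ P c Q → k * φ P c Q) P Q ≈ k * splits φ P Q
  splits-* k φ P []      = sym (zeroʳ k)
  splits-* k φ P (c ∷ Q) = trans (+-congˡ (splits-* k φ (P ++ [ c ]) Q)) (sym (distribˡ k _ _))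

  -- `stop` and `start` stay fixed in the induction; through them the termwise hypothesis learns
  -- where a lies in the whole range.
  ΣR-splits : ∀ U lo φ (f : ℕ → Carrier) i j a stop start → i ℕ.+ lo ≡ a → j ℕ.+ a ≡ stop → start ≤ a →
    (∀ i j a → i ℕ.+ lo ≡ a → suc j ℕ.+ a ≡ stop → start ≤ a → f a ≈ φ (seg U lo i) (slot U a) (seg U (suc a) j)) →
    ΣR a j f ≈ splits φ (seg U lo i) (seg U a j)
  ΣR-splits U lo φ f i zero    a stop start eq₁ eq₂ le h = refl
  ΣR-splits U lo φ f i (suc j) a stop start eq₁ eq₂ le h = begin
    f a + ΣR (suc a) j f
      ≈⟨ +-cong (h i j a eq₁ eq₂ le) (ΣR-splits U lo φ f (suc i) j (suc a) stop start (≡.cong suc eq₁) (≡.trans (ℕₚ.+-suc j a) eq₂) (ℕₚ.m≤n⇒m≤1+n le) h) ⟩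
    φ (seg U lo i) (slot U a) (seg U (suc a) j) + splits φ (seg U lo (suc i)) (seg U (suc a) j)
      ≡⟨ ≡.cong (λ P → φ (seg U lo i) (slot U a) (seg U (suc a) j) + splits φ P (seg U (suc a) j)) (snoc i lo eq₁) ⟩
    φ (seg U lo i) (slot U a) (seg U (suc a) j) + splits φ (seg U lo i ++ [ slot U a ]) (seg U (suc a) j) ∎
    where
    snoc : ∀ i lo → i ℕ.+ lo ≡ a → seg U lo (suc i) ≡ seg U lo i ++ [ slot U a ]
    snoc zero    lo ≡.refl = ≡.refl
    snoc (suc i) lo eq     = ≡.cong (slot U lo ∷_) (snoc i (suc lo) (≡.trans (ℕₚ.+-suc i lo) eq))

  word : (ℕ → Bool) → ℕ → List ℕ → Carrier
  word U p []      = 1#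
  word U p (a ∷ s) = slot U a * weightIf (p <ᵇ a) u * word (mark a U) a s

  minima : List ℕ → Carrier
  minima []      = 1#
  minima (a ∷ s) = weightIf (allB (a <ᵇ_) s) v * minima s

  -- The factor of the entry a is 1 + (v - 1) times the indicator that all later entries exceed a,
  -- and `ΣC-above` turns this indicator into the bound a + 1.
  ΣC-first : ∀ lo n k a c (F G : List ℕ → Carrier) → lo ≤ suc a →
    (∀ {s} → Continuation lo k a s → F s ≈ c * (G s * minima (a ∷ s))) →
    ΣC lo n k a F ≈ c * (ΣC lo n k a (λ s → G s * minima s) + (v - 1#) * ΣC (suc a) n k a (λ s → G s * minima s))
  ΣC-first lo n k a c F G lo≤ eq = begin
    ΣC lo n k a F
      ≈⟨ ΣC-cong lo n k a (λ {s} d → trans (eq d) (*-congˡ (expand (allB (a <ᵇ_) s) (G s) (minima s)))) ⟩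
    ΣC lo n k a (λ s → c * (G s * minima s + (v - 1#) * ind (allB (a <ᵇ_) s) (G s * minima s)))
      ≈⟨ ΣC-* lo n k a c _ ⟩
    c * ΣC lo n k a (λ s → G s * minima s + (v - 1#) * ind (allB (a <ᵇ_) s) (G s * minima s))
      ≈⟨ *-congˡ (trans (ΣC-+ lo n k a _ _) (+-congˡ (trans (ΣC-* lo n k a (v - 1#) _) (*-congˡ (ΣC-above a lo n k a _ lo≤))))) ⟩
    c * (ΣC lo n k a (λ s → G s * minima s) + (v - 1#) * ΣC (suc a) n k a (λ s → G s * minima s)) ∎
    where
    expand : ∀ b p q → p * (weightIf b v * q) ≈ p * q + (v - 1#) * ind b (p * q)
    expand true  p q = solve 3 (λ p q v → p :* (v :* q) := p :* q :+ (v :- con (+ 1)) :* (p :* q)) refl p q v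
    expand false p q = solve 3 (λ p q v → p :* (con (+ 1) :* q) := p :* q :+ (v :- con (+ 1)) :* con (+ 0)) refl p q v

  Fresh : (ℕ → Bool) → ℕ → Set
  Fresh U k = ∀ b → k < b → U b ≡ false

  fresh-mark : ∀ {U k} a {k′} → Fresh U k → k ≤ k′ → a ≤ k′ → Fresh (mark a U) k′
  fresh-mark {U} a fresh k≤ a≤ b lt rewrite ≡ᵇ-false-> (ℕₚ.≤-<-trans a≤ lt) = fresh b (ℕₚ.≤-<-trans k≤ lt)

  ΣR-from : ∀ lo n f → ΣR 0 (lo ℕ.+ n) (λ a → ind (lo ≤ᵇ a) (f a)) ≈ ΣR lo n f
  ΣR-from lo n f = trans (ΣR-split 0 lo n _) (trans (+-cong (ΣR-0 0 lo below) (above lo n ℕₚ.≤-refl)) (+-identityˡ _))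
    where
    below : ∀ b → b < lo → ind (lo ≤ᵇ b) (f b) ≈ 0#
    below b (s≤s b<lo) rewrite <ᵇ-false b<lo = refl
    above : ∀ a n → lo ≤ a → ΣR a n (λ a → ind (lo ≤ᵇ a) (f a)) ≈ ΣR a n f
    above a zero    le = refl
    above a (suc n) le rewrite ≤ᵇ-true le = +-congˡ (above (suc a) n (ℕₚ.m≤n⇒m≤1+n le))

  ΣC-ranges : ∀ lo n k p g ℓ m → ℓ ℕ.+ lo ≡ suc p → m ℕ.+ p ≡ suc k →
    ΣC lo (suc n) k p g ≈ ΣR lo ℓ (λ a → ΣC lo n (bump k p a) a (λ s → g (a ∷ s)))
                        + ΣR (suc p) m (λ a → ΣC lo n (bump k p a) a (λ s → g (a ∷ s)))
  ΣC-ranges lo n k p g ℓ m eq₁ eq₂ = begin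
    ΣR 0 (suc (suc k)) (λ a → ind (lo ≤ᵇ a) (f a))            ≡⟨ ≡.cong (λ e → ΣR 0 e (λ a → ind (lo ≤ᵇ a) (f a))) count-eq ⟩
    ΣR 0 (lo ℕ.+ (ℓ ℕ.+ m)) (λ a → ind (lo ≤ᵇ a) (f a))       ≈⟨ ΣR-from lo (ℓ ℕ.+ m) f ⟩
    ΣR lo (ℓ ℕ.+ m) f                                         ≈⟨ ΣR-split lo ℓ m f ⟩
    ΣR lo ℓ f + ΣR (lo ℕ.+ ℓ) m f                             ≡⟨ ≡.cong (λ b → ΣR lo ℓ f + ΣR b m f) (≡.trans (ℕₚ.+-comm lo ℓ) eq₁) ⟩
    ΣR lo ℓ f + ΣR (suc p) m f                                ∎
    where
    f = λ a → ΣC lo n (bump k p a) a (λ s → g (a ∷ s))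
    count-eq : suc (suc k) ≡ lo ℕ.+ (ℓ ℕ.+ m)
    count-eq = ≡.trans (≡.cong suc (≡.trans (≡.sym eq₂) (ℕₚ.+-comm m p)))
      (≡.trans (≡.cong (ℕ._+ m) (≡.sym eq₁)) (≡.trans (≡.cong (ℕ._+ m) (ℕₚ.+-comm ℓ lo)) (ℕₚ.+-assoc lo ℓ m)))

  -- What the model needs to know about the next entry a: i slots from `lo` on lie below it, and m
  -- slots above it, up to the new largest admissible value k′ + 1.
  MoveTerm : (ℕ → Bool) → ℕ → ℕ → ℕ → (ℕ → Carrier) → (List Carrier → List Carrier → Carrier) → (List Carrier → Carrier) → Set
  MoveTerm U lo k p T f g = ∀ a k′ i m → bump k p a ≡ k′ → i ℕ.+ lo ≡ a → m ℕ.+ a ≡ suc k′ → k ≤ k′ → a ≤ k′ →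
    T a ≈ weightIf (p <ᵇ a) u * (slot U a * (f (seg U lo i ++ [ x ]) (seg U (suc a) m) + g (seg U (suc a) m)))

  descents-correct : ∀ U lo k p {T} f g → MoveTerm U lo k p T f g → p ≤ k → ∀ ℓ m → ℓ ℕ.+ lo ≡ suc p → m ℕ.+ p ≡ suc k →
    ΣR lo ℓ T ≈ splits (move f g (seg U (suc p) m)) [] (seg U lo ℓ)
  descents-correct U lo k p {T} f g term p≤k ℓ m eq₁ eq₂ =
    ΣR-splits U lo (move f g (seg U (suc p) m)) T 0 ℓ lo (suc p) 0 ≡.refl eq₁ z≤n low
    where
    low : ∀ i j a → i ℕ.+ lo ≡ a → suc j ℕ.+ a ≡ suc p → 0 ≤ a → T a ≈ move f g (seg U (suc p) m) (seg U lo i) (slot U a) (seg U (suc a) j)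
    low i j a eq₃ eq₄ _ = begin
      T a
        ≈⟨ term a k i (j ℕ.+ m) (bump-≤ a≤p) eq₃ m-eq ℕₚ.≤-refl (ℕₚ.≤-trans a≤p p≤k) ⟩
      weightIf (p <ᵇ a) u * (slot U a * (f (seg U lo i ++ [ x ]) (seg U (suc a) (j ℕ.+ m)) + g (seg U (suc a) (j ℕ.+ m))))
        ≡⟨ ≡.cong₂ (λ b R → weightIf b u * (slot U a * (f (seg U lo i ++ [ x ]) R + g R))) (<ᵇ-false a≤p)
             (≡.trans (seg-++ U (suc a) j m) (≡.cong (λ b → seg U (suc a) j ++ seg U b m) (≡.trans (ℕₚ.+-suc j a) eq₄))) ⟩
      1# * move f g (seg U (suc p) m) (seg U lo i) (slot U a) (seg U (suc a) j)
        ≈⟨ *-identityˡ _ ⟩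
      move f g (seg U (suc p) m) (seg U lo i) (slot U a) (seg U (suc a) j) ∎
      where
      j+a≡p : j ℕ.+ a ≡ p
      j+a≡p = ℕₚ.suc-injective eq₄
      a≤p : a ≤ p
      a≤p = ≡.subst (a ≤_) j+a≡p (ℕₚ.m≤n+m a j)
      m-eq : (j ℕ.+ m) ℕ.+ a ≡ suc k
      m-eq = ≡.trans (≡.cong (ℕ._+ a) (ℕₚ.+-comm j m)) (≡.trans (ℕₚ.+-assoc m j a) (≡.trans (≡.cong (m ℕ.+_) j+a≡p) eq₂))

  step-correct : ∀ U lo k p {T} f g → MoveTerm U lo k p T f g → Fresh U k → p ≤ k → ∀ ℓ m → ℓ ℕ.+ lo ≡ suc p → m ℕ.+ p ≡ suc k →
    ΣR lo ℓ T + ΣR (suc p) m T ≈ step f g (seg U lo ℓ) (seg U (suc p) m)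
  step-correct U lo k p {T} f g term fresh p≤k ℓ m eq₁ eq₂ = +-cong (descents-correct U lo k p f g term p≤k ℓ m eq₁ eq₂)
    (trans (ΣR-splits U lo (λ P c Q → u * move f g [ 1# ] P c Q) T ℓ m (suc p) (suc (suc k)) (suc p)
         eq₁ (≡.trans (ℕₚ.+-suc m p) (≡.cong suc eq₂)) ℕₚ.≤-refl high)
       (splits-* u (move f g [ 1# ]) (seg U lo ℓ) (seg U (suc p) m)))
    where
    high : ∀ i j a → i ℕ.+ lo ≡ a → suc j ℕ.+ a ≡ suc (suc k) → suc p ≤ a → T a ≈ u * move f g [ 1# ] (seg U lo i) (slot U a) (seg U (suc a) j)
    high i j a eq₃ eq₄ p<a = begin
      T a
        ≈⟨ term a (suc k) i (suc j) (bump-> p<a) eq₃ eq₄ (ℕₚ.n≤1+n k) (≡.subst (a ≤_) (ℕₚ.suc-injective eq₄) (ℕₚ.m≤n+m a j)) ⟩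
      weightIf (p <ᵇ a) u * (slot U a * (f (seg U lo i ++ [ x ]) (seg U (suc a) (suc j)) + g (seg U (suc a) (suc j))))
        ≡⟨ ≡.cong₂ (λ b R → weightIf b u * (slot U a * (f (seg U lo i ++ [ x ]) R + g R))) (<ᵇ-true p<a)
             (seg-fresh U (suc a) j {k} fresh (≡.subst (k <_) (≡.sym (≡.trans (ℕₚ.+-suc j a) eq₄)) (ℕₚ.m≤n⇒m≤1+n ℕₚ.≤-refl))) ⟩
      u * move f g [ 1# ] (seg U lo i) (slot U a) (seg U (suc a) j) ∎

  wordMinima : (ℕ → Bool) → ℕ → List ℕ → Carrier
  wordMinima U p s = word U p s * minima s

  restAbove : ℕ → List Carrier → Carrier
  restAbove n W = (v - 1#) * tail≥ n [] W

  -- `L` holds the ℓ values lo, ..., p and `R` the m values p + 1, ..., k + 1. For ℓ = 0 the bound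
  -- lo is p + 1, which is the empty `L` in the term for right-to-left minima.
  tail≥-correct : ∀ n lo k p U ℓ m → ℓ ℕ.+ lo ≡ suc p → m ℕ.+ p ≡ suc k → p ≤ k → Fresh U k →
    ΣC lo n k p (wordMinima U p) ≈ tail≥ n (seg U lo ℓ) (seg U (suc p) m)

  tail≥-term : ∀ n lo k p U → Fresh U k →
    MoveTerm U lo k p (λ a → ΣC lo n (bump k p a) a (λ s → wordMinima U p (a ∷ s))) (tail≥ n) (restAbove n)

  tail≥-correct zero    lo k p U ℓ m eq₁ eq₂ p≤k fresh = *-identityˡ 1#
  tail≥-correct (suc n) lo k p U ℓ m eq₁ eq₂ p≤k fresh = trans (ΣC-ranges lo n k p (wordMinima U p) ℓ m eq₁ eq₂)
    (step-correct U lo k p (tail≥ n) (restAbove n) (tail≥-term n lo k p U fresh) fresh p≤k ℓ m eq₁ eq₂)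

  tail≥-term n lo k p U fresh a k′ i m ≡.refl eq₃ eq₄ k≤k′ a≤k′ = begin
    ΣC lo n k′ a (λ s → wordMinima U p (a ∷ s))
      ≈⟨ ΣC-first lo n k′ a (slot U a * weightIf (p <ᵇ a) u) _ (word (mark a U) a) (ℕₚ.m≤n⇒m≤1+n (≡.subst (lo ≤_) eq₃ (ℕₚ.m≤n+m lo i))) (λ _ → *-assoc _ _ _) ⟩
    slot U a * weightIf (p <ᵇ a) u * (ΣC lo n k′ a (wordMinima (mark a U) a) + (v - 1#) * ΣC (suc a) n k′ a (wordMinima (mark a U) a))
      ≈⟨ *-congˡ (+-cong (tail≥-correct n lo k′ a (mark a U) (suc i) m (≡.cong suc eq₃) eq₄ a≤k′ fresh′)
           (*-congˡ (tail≥-correct n (suc a) k′ a (mark a U) 0 m ≡.refl eq₄ a≤k′ fresh′))) ⟩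
    slot U a * weightIf (p <ᵇ a) u * (tail≥ n (seg (mark a U) lo (suc i)) (seg (mark a U) (suc a) m) + restAbove n (seg (mark a U) (suc a) m))
      ≡⟨ ≡.cong₂ (λ L R → slot U a * weightIf (p <ᵇ a) u * (tail≥ n L R + restAbove n R)) (seg-mark-last U a lo i eq₃) (seg-mark-> U m ℕₚ.≤-refl) ⟩
    slot U a * weightIf (p <ᵇ a) u * (tail≥ n (seg U lo i ++ [ x ]) (seg U (suc a) m) + restAbove n (seg U (suc a) m))
      ≈⟨ solve 3 (λ a b c → a :* b :* c := b :* (a :* c)) refl _ _ _ ⟩
    weightIf (p <ᵇ a) u * (slot U a * (tail≥ n (seg U lo i ++ [ x ]) (seg U (suc a) m) + restAbove n (seg U (suc a) m))) ∎
    where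
    fresh′ : Fresh (mark a U) k′
    fresh′ = fresh-mark a fresh k≤k′ a≤k′

  zeros : Carrier → ℕ → List ℕ → Carrier
  zeros z lo []      = 1#
  zeros z lo (a ∷ s) = weightIf (a ≡ᵇ lo) z * zeros z lo s

  zeros-above : ∀ z {lo b k p s} → lo ≤ b → Continuation (suc b) k p s → zeros z lo s ≈ 1#
  zeros-above z lo≤b end = refl
  zeros-above z {lo} lo≤b (next b<a _ c) =
    trans (*-cong (reflexive (≡.cong (λ e → weightIf e z) (≡ᵇ-false-> (ℕₚ.≤-<-trans lo≤b b<a)))) (zeros-above z lo≤b c)) (*-identityˡ 1#)

  zeros-1 : ∀ lo s → zeros 1# lo s ≈ 1#
  zeros-1 lo []      = refl
  zeros-1 lo (a ∷ s) = trans (*-cong (weight-1 (a ≡ᵇ lo)) (zeros-1 lo s)) (*-identityˡ 1#)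
    where
    weight-1 : ∀ b → weightIf b 1# ≈ 1#
    weight-1 true  = refl
    weight-1 false = refl

  fixeds : Carrier → ℕ → List ℕ → Carrier
  fixeds y j []      = 1#
  fixeds y j (a ∷ s) = weightIf (a ≡ᵇ j) y * fixeds y (suc j) s


  -- An entry is at most k + 1, below the position j. This persists, since each entry raises j by
  -- one and k by at most one.
  fixeds-late : ∀ y {lo k p s} j → suc (suc k) ≤ j → Continuation lo k p s → fixeds y j s ≈ 1#
  fixeds-late y j le end = refl
  fixeds-late y {k = k} {p} j le (next {a = a} _ a≤ c) = trans
    (*-cong (reflexive (≡.cong (λ e → weightIf e y) (≡ᵇ-false-< (ℕₚ.<-≤-trans (s≤s a≤) le))))
            (fixeds-late y (suc j) (s≤s (ℕₚ.≤-trans (s≤s (bump≤ k p a)) le)) c))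
    (*-identityˡ 1#)

  withZeros : Carrier → ℕ → (ℕ → Bool) → ℕ → List ℕ → Carrier
  withZeros z lo U p s = word U p s * zeros z lo s * minima s

  tail∋0∪tail≥ : Carrier → ℕ → List Carrier → List Carrier → Carrier
  tail∋0∪tail≥ z n L R = v * tail∋0 z n L R + tail≥ n L R

  splits-tail∋0∪tail≥ : ∀ z n W P Q → splits (move (tail∋0∪tail≥ z n) (restAbove n) W) P Q ≈
    v * splits (move (tail∋0 z n) (λ _ → 0#) W) P Q + splits (move (tail≥ n) (restAbove n) W) P Q
  splits-tail∋0∪tail≥ z n W P Q = begin
    splits (move (tail∋0∪tail≥ z n) (restAbove n) W) P Q
      ≈⟨ splits-cong (λ P c Q → solve 5 (λ c v a b d → c :* ((v :* a :+ b) :+ d) := v :* (c :* (a :+ con (+ 0))) :+ c :* (b :+ d)) refl c v _ _ _) P Q ⟩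
    splits (λ P c Q → v * move (tail∋0 z n) (λ _ → 0#) W P c Q + move (tail≥ n) (restAbove n) W P c Q) P Q
      ≈⟨ splits-+ _ _ P Q ⟩
    splits (λ P c Q → v * move (tail∋0 z n) (λ _ → 0#) W P c Q) P Q + splits (move (tail≥ n) (restAbove n) W) P Q
      ≈⟨ +-congʳ (splits-* v _ P Q) ⟩
    v * splits (move (tail∋0 z n) (λ _ → 0#) W) P Q + splits (move (tail≥ n) (restAbove n) W) P Q ∎

  withZeros-above : ∀ z lo a n k U → lo ≤ a → ΣC (suc a) n k a (withZeros z lo U a) ≈ ΣC (suc a) n k a (wordMinima U a)
  withZeros-above z lo a n k U lo≤a = ΣC-cong (suc a) n k a
    (λ d → *-congʳ (trans (*-congˡ (zeros-above z lo≤a d)) (*-identityʳ _)))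

  -- The used value lo is kept out of the slot lists, which start at lo + 1. Either it recurs, and
  -- is a right-to-left minimum whose factor v is put in front of `tail∋0`, or it is avoided.
  withZeros-correct : ∀ z n lo k p U ℓ m → ℓ ℕ.+ lo ≡ p → m ℕ.+ p ≡ suc k → p ≤ k → Fresh U k → U lo ≡ true →
    ΣC lo n k p (withZeros z lo U p) ≈ tail∋0∪tail≥ z n (seg U (suc lo) ℓ) (seg U (suc p) m)

  withZeros-term : ∀ z n lo k p U → Fresh U k → U lo ≡ true → MoveTerm U (suc lo) k p
    (λ a → ΣC lo n (bump k p a) a (λ s → withZeros z lo U p (a ∷ s))) (tail∋0∪tail≥ z n) (restAbove n)

  -- Returning to lo is a weak descent, so no slot is appended and all slots end up above it.
  -- Whether or not lo recurs once more, it contributes a single factor v.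
  withZeros-zero : ∀ z n lo k p U ℓ m → ℓ ℕ.+ lo ≡ p → m ℕ.+ p ≡ suc k → p ≤ k → Fresh U k → U lo ≡ true →
    ΣC lo n (bump k p lo) lo (λ s → withZeros z lo U p (lo ∷ s)) ≈
    v * (x * z * (tail∋0 z n [] (seg U (suc lo) ℓ ++ seg U (suc p) m) + tail≥ n [] (seg U (suc lo) ℓ ++ seg U (suc p) m)))

  withZeros-correct z zero lo k p U ℓ m eq₁ eq₂ p≤k fresh used-lo = solve 1 (λ v → con (+ 1) :* con (+ 1) :* con (+ 1) := v :* con (+ 0) :+ con (+ 1)) refl v
  withZeros-correct z (suc n) lo k p U ℓ m eq₁ eq₂ p≤k fresh used-lo = begin
    ΣC lo (suc n) k p (withZeros z lo U p)
      ≈⟨ ΣC-ranges lo n k p (withZeros z lo U p) (suc ℓ) m (≡.cong suc eq₁) eq₂ ⟩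
    _ + ΣR (suc lo) ℓ T + ΣR (suc p) m T
      ≈⟨ trans (+-assoc _ _ _) (+-cong (withZeros-zero z n lo k p U ℓ m eq₁ eq₂ p≤k fresh used-lo)
          (step-correct U (suc lo) k p (tail∋0∪tail≥ z n) (restAbove n) (withZeros-term z n lo k p U fresh used-lo) fresh p≤k ℓ m
             (≡.trans (ℕₚ.+-suc ℓ lo) (≡.cong suc eq₁)) eq₂)) ⟩
    v * q + step (tail∋0∪tail≥ z n) (restAbove n) (seg U (suc lo) ℓ) (seg U (suc p) m)
      ≈⟨ +-congˡ (+-cong (splits-tail∋0∪tail≥ z n (seg U (suc p) m) [] (seg U (suc lo) ℓ))
          (*-congˡ (splits-tail∋0∪tail≥ z n [ 1# ] (seg U (suc lo) ℓ) (seg U (suc p) m)))) ⟩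
    v * q + ((v * _ + _) + u * (v * _ + _))
      ≈⟨ solve 7 (λ v q a b u c d → v :* q :+ ((v :* a :+ b) :+ u :* (v :* c :+ d)) := v :* (q :+ (a :+ u :* c)) :+ (b :+ u :* d)) refl v q _ _ u _ _ ⟩
    tail∋0∪tail≥ z (suc n) (seg U (suc lo) ℓ) (seg U (suc p) m) ∎
    where
    T : ℕ → Carrier
    T a = ΣC lo n (bump k p a) a (λ s → withZeros z lo U p (a ∷ s))
    q = x * z * (tail∋0 z n [] (seg U (suc lo) ℓ ++ seg U (suc p) m) + tail≥ n [] (seg U (suc lo) ℓ ++ seg U (suc p) m))

  withZeros-term z n lo k p U fresh used-lo a k′ i m ≡.refl eq₃ eq₄ k≤k′ a≤k′ = begin
    ΣC lo n k′ a (λ s → withZeros z lo U p (a ∷ s))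
      ≈⟨ ΣC-first lo n k′ a (slot U a * weightIf (p <ᵇ a) u) _ (λ s → word (mark a U) a s * zeros z lo s) (ℕₚ.m≤n⇒m≤1+n (ℕₚ.<⇒≤ lo<a))
           (λ {s} _ → trans (*-congʳ (*-congˡ (*-congʳ (reflexive (≡.cong (λ e → weightIf e z) (≡ᵇ-false-> lo<a))))))
             (solve 4 (λ a b c d → a :* b :* (con (+ 1) :* c) :* d := a :* (b :* c :* d)) refl (slot U a * weightIf (p <ᵇ a) u) (word (mark a U) a s) (zeros z lo s) (minima (a ∷ s)))) ⟩
    slot U a * weightIf (p <ᵇ a) u * (ΣC lo n k′ a (withZeros z lo (mark a U) a) + (v - 1#) * ΣC (suc a) n k′ a (withZeros z lo (mark a U) a))
      ≈⟨ *-congˡ (+-cong (withZeros-correct z n lo k′ a (mark a U) (suc i) m (≡.trans (≡.sym (ℕₚ.+-suc i lo)) eq₃) eq₄ a≤k′ fresh′ used-lo′)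
           (*-congˡ (trans (withZeros-above z lo a n k′ (mark a U) (ℕₚ.<⇒≤ lo<a)) (tail≥-correct n (suc a) k′ a (mark a U) 0 m ≡.refl eq₄ a≤k′ fresh′)))) ⟩
    slot U a * weightIf (p <ᵇ a) u * (tail∋0∪tail≥ z n (seg (mark a U) (suc lo) (suc i)) (seg (mark a U) (suc a) m) + restAbove n (seg (mark a U) (suc a) m))
      ≡⟨ ≡.cong₂ (λ L R → slot U a * weightIf (p <ᵇ a) u * (tail∋0∪tail≥ z n L R + restAbove n R)) (seg-mark-last U a (suc lo) i eq₃) (seg-mark-> U m ℕₚ.≤-refl) ⟩
    slot U a * weightIf (p <ᵇ a) u * (tail∋0∪tail≥ z n (seg U (suc lo) i ++ [ x ]) (seg U (suc a) m) + restAbove n (seg U (suc a) m))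
      ≈⟨ solve 3 (λ a b c → a :* b :* c := b :* (a :* c)) refl _ _ _ ⟩
    weightIf (p <ᵇ a) u * (slot U a * (tail∋0∪tail≥ z n (seg U (suc lo) i ++ [ x ]) (seg U (suc a) m) + restAbove n (seg U (suc a) m))) ∎
    where
    lo<a : lo < a
    lo<a = ≡.subst (suc lo ≤_) eq₃ (ℕₚ.m≤n+m (suc lo) i)
    fresh′ : Fresh (mark a U) k′
    fresh′ = fresh-mark a fresh k≤k′ a≤k′
    used-lo′ : mark a U lo ≡ true
    used-lo′ = ≡.trans (≡.cong (_∨ U lo) (≡ᵇ-false-< lo<a)) used-lo

  withZeros-zero z n lo k p U ℓ m eq₁ eq₂ p≤k fresh used-lo
    rewrite bump-≤ {k} {p} {lo} (≡.subst (lo ≤_) eq₁ (ℕₚ.m≤n+m lo ℓ)) = begin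
    ΣC lo n k lo (λ s → withZeros z lo U p (lo ∷ s))
      ≈⟨ ΣC-first lo n k lo (x * z) _ (λ s → word (mark lo U) lo s * zeros z lo s) (ℕₚ.n≤1+n lo) (λ {s} _ → trans
           (*-congʳ (*-cong (*-congʳ (*-cong (reflexive (≡.cong (λ e → weightIf e x) used-lo)) (reflexive (≡.cong (λ e → weightIf e u) (<ᵇ-false lo≤p)))))
                            (*-congʳ (reflexive (≡.cong (λ e → weightIf e z) (≡ᵇ-refl lo))))))
           (solve 5 (λ x z b c d → x :* con (+ 1) :* b :* (z :* c) :* d := x :* z :* (b :* c :* d)) refl x z (word (mark lo U) lo s) (zeros z lo s) (minima (lo ∷ s)))) ⟩
    x * z * (ΣC lo n k lo (withZeros z lo (mark lo U) lo) + (v - 1#) * ΣC (suc lo) n k lo (withZeros z lo (mark lo U) lo))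
      ≈⟨ *-congˡ (+-cong (withZeros-correct z n lo k lo (mark lo U) 0 (ℓ ℕ.+ m) ≡.refl m-eq lo≤k fresh′ (≡.cong (_∨ U lo) (≡ᵇ-refl lo)))
           (*-congˡ (trans (withZeros-above z lo lo n k (mark lo U) ℕₚ.≤-refl) (tail≥-correct n (suc lo) k lo (mark lo U) 0 (ℓ ℕ.+ m) ≡.refl m-eq lo≤k fresh′)))) ⟩
    x * z * (tail∋0∪tail≥ z n [] (seg (mark lo U) (suc lo) (ℓ ℕ.+ m)) + restAbove n (seg (mark lo U) (suc lo) (ℓ ℕ.+ m)))
      ≡⟨ ≡.cong (λ W → x * z * (tail∋0∪tail≥ z n [] W + restAbove n W)) (≡.trans (seg-mark-> U (ℓ ℕ.+ m) ℕₚ.≤-refl)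
           (≡.trans (seg-++ U (suc lo) ℓ m) (≡.cong (λ b → seg U (suc lo) ℓ ++ seg U b m) (≡.trans (ℕₚ.+-suc ℓ lo) (≡.cong suc eq₁))))) ⟩
    x * z * (tail∋0∪tail≥ z n [] W + restAbove n W)
      ≈⟨ solve 5 (λ x z v a b → x :* z :* ((v :* a :+ b) :+ (v :- con (+ 1)) :* b) := v :* (x :* z :* (a :+ b))) refl x z v _ _ ⟩
    v * (x * z * (tail∋0 z n [] W + tail≥ n [] W)) ∎
    where
    W = seg U (suc lo) ℓ ++ seg U (suc p) m
    lo≤p : lo ≤ p
    lo≤p = ≡.subst (lo ≤_) eq₁ (ℕₚ.m≤n+m lo ℓ)
    lo≤k : lo ≤ k
    lo≤k = ℕₚ.≤-trans lo≤p p≤k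
    fresh′ : Fresh (mark lo U) k
    fresh′ = fresh-mark lo fresh ℕₚ.≤-refl lo≤k
    m-eq : (ℓ ℕ.+ m) ℕ.+ lo ≡ suc k
    m-eq = ≡.trans (≡.cong (ℕ._+ lo) (ℕₚ.+-comm ℓ m)) (≡.trans (ℕₚ.+-assoc m ℓ lo) (≡.trans (≡.cong (m ℕ.+_) eq₁) eq₂))

  UsedIn : (ℕ → Bool) → ℕ → ℕ → Set
  UsedIn U lo p = ∀ a → lo ≤ a → a ≤ p → U a ≡ true

  seg-used : ∀ U a n {lo p} → UsedIn U lo p → lo ≤ a → n ℕ.+ a ≤ suc p → seg U a n ≡ used n
  seg-used U a zero    h lo≤a le = ≡.refl
  seg-used U a (suc n) {p = p} h lo≤a le = ≡.cong₂ _∷_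
    (≡.cong (λ e → weightIf e x) (h a lo≤a (ℕₚ.≤-trans (ℕₚ.m≤n+m a n) (ℕₚ.≤-pred le))))
    (seg-used U (suc a) n h (ℕₚ.m≤n⇒m≤1+n lo≤a) (≡.subst (_≤ suc p) (≡.sym (ℕₚ.+-suc n a)) le))

  inRun : Carrier → Carrier → ℕ → (ℕ → Bool) → ℕ → List ℕ → Carrier
  inRun y z lo U p s = word U p s * zeros z lo s * fixeds y (suc p) s * minima s

  -- `lo` is the value whose occurrences carry z, `lo′` the least entry allowed. Inside the initial
  -- run the number of ascents equals the last entry p.
  runs : Carrier → Carrier → ℕ → ℕ → ℕ → (ℕ → Bool) → ℕ → Carrier
  runs y z lo lo′ n U p = ΣC lo′ n p p (inRun y z lo U p)

  inRun-extend : ∀ y z lo lo′ n U p → lo ≤ p → lo′ ≤ suc (suc p) → Fresh U p →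
    ΣC lo′ n (bump p p (suc p)) (suc p) (λ s → inRun y z lo U p (suc p ∷ s)) ≈
    u * y * (runs y z lo lo′ n (mark (suc p) U) (suc p) + (v - 1#) * runs y z lo (suc (suc p)) n (mark (suc p) U) (suc p))
  inRun-extend y z lo lo′ n U p lo≤p lo′≤ fresh rewrite bump-> {p} {p} {suc p} ℕₚ.≤-refl =
    ΣC-first lo′ n (suc p) (suc p) (u * y) _ (λ s → word (mark (suc p) U) (suc p) s * zeros z lo s * fixeds y (suc (suc p)) s) lo′≤
      (λ {s} _ → trans (*-congʳ (*-cong
          (*-cong (*-congʳ (*-cong (reflexive (≡.cong (λ e → weightIf e x) (fresh (suc p) ℕₚ.≤-refl))) (reflexive (≡.cong (λ e → weightIf e u) (<ᵇ-true {p} ℕₚ.≤-refl)))))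
                  (*-congʳ (reflexive (≡.cong (λ e → weightIf e z) (≡ᵇ-false-> (s≤s lo≤p))))))
          (*-congʳ (reflexive (≡.cong (λ e → weightIf e y) (≡ᵇ-refl (suc p)))))))
        (solve 6 (λ u y b c d e → con (+ 1) :* u :* b :* (con (+ 1) :* c) :* (y :* d) :* e := u :* y :* (b :* c :* d :* e)) refl
          u y (word (mark (suc p) U) (suc p) s) (zeros z lo s) (fixeds y (suc (suc p)) s) (minima (suc p ∷ s))))

  inRun-leave : ∀ y z lo lo′ n U p a → a ≤ p →
    ΣC lo′ n (bump p p a) a (λ s → inRun y z lo U p (a ∷ s)) ≈ ΣC lo′ n (bump p p a) a (λ s → withZeros z lo U p (a ∷ s))
  inRun-leave y z lo lo′ n U p a a≤p rewrite bump-≤ {p} {p} {a} a≤p = ΣC-cong lo′ n p a (λ {s} d → *-congʳ (trans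
    (*-congˡ (trans (*-cong (reflexive (≡.cong (λ e → weightIf e y) (≡ᵇ-false-< (s≤s a≤p)))) (fixeds-late y (suc (suc p)) ℕₚ.≤-refl d)) (*-identityˡ 1#)))
    (*-identityʳ _)))

  runs-step : ∀ y z lo lo′ n U p ℓ → lo ≤ p → lo′ ≤ suc p → ℓ ℕ.+ lo′ ≡ suc p → Fresh U p →
    runs y z lo lo′ (suc n) U p ≈ ΣR lo′ ℓ (λ a → ΣC lo′ n (bump p p a) a (λ s → withZeros z lo U p (a ∷ s)))
      + u * y * (runs y z lo lo′ n (mark (suc p) U) (suc p) + (v - 1#) * runs y z lo (suc (suc p)) n (mark (suc p) U) (suc p))
  runs-step y z lo lo′ n U p ℓ lo≤p lo′≤ eq fresh = trans (ΣC-ranges lo′ n p p (inRun y z lo U p) ℓ 1 eq ≡.refl) (+-cong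
    (ΣR-cong-< lo′ ℓ (λ a _ lt → inRun-leave y z lo lo′ n U p a (ℕₚ.≤-pred (≡.subst (a <_) eq lt))))
    (trans (+-identityʳ _) (inRun-extend y z lo lo′ n U p lo≤p (ℕₚ.m≤n⇒m≤1+n lo′≤) fresh)))

  runs-zeros : ∀ y z lo lo′ n U p → lo < lo′ → runs y z lo lo′ n U p ≈ runs y 1# lo lo′ n U p
  runs-zeros y z lo (suc b) n U p (s≤s lo≤b) = ΣC-cong (suc b) n p p (λ {s} d → *-congʳ (*-congʳ (*-congˡ
    (trans (zeros-above z lo≤b d) (sym (zeros-1 lo s))))))

  runs-1 : ∀ y lo lo₂ lo′ n U p → runs y 1# lo lo′ n U p ≈ runs y 1# lo₂ lo′ n U p
  runs-1 y lo lo₂ lo′ n U p = ΣC-cong lo′ n p p (λ {s} _ → *-congʳ (*-congʳ (*-congˡ (trans (zeros-1 lo s) (sym (zeros-1 lo₂ s))))))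

  usedIn-mark : ∀ {U lo p} → UsedIn U lo p → UsedIn (mark (suc p) U) lo (suc p)
  usedIn-mark {U} {lo} {p} h a lo≤a a≤ with ℕₚ.m≤n⇒m<n∨m≡n a≤
  ... | inj₁ (s≤s a≤p) = ≡.trans (≡.cong (_∨ U a) (≡ᵇ-false-< (s≤s a≤p))) (h a lo≤a a≤p)
  ... | inj₂ ≡.refl    = ≡.cong (_∨ U a) (≡ᵇ-refl a)

  -- The summands separate the words by whether lo recurs; in those that avoid it z has exponent 0,
  -- so it may be set to 1.
  run∋0-correct : ∀ y z n lo i U p → i ℕ.+ lo ≡ p → Fresh U p → UsedIn U lo p →
    runs y z lo lo n U p ≈ v * run∋0 z y n i + runs y 1# lo (suc lo) n U p
  run∋0-correct y z zero lo i U p eq fresh usedIn = solve 1 (λ v → con (+ 1) :* con (+ 1) :* con (+ 1) :* con (+ 1)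
    := v :* con (+ 0) :+ con (+ 1) :* con (+ 1) :* con (+ 1) :* con (+ 1)) refl v
  run∋0-correct y z (suc n) lo i U p eq fresh usedIn = begin
    runs y z lo lo (suc n) U p
      ≈⟨ runs-step y z lo lo n U p (suc i) lo≤p (ℕₚ.m≤n⇒m≤1+n lo≤p) (≡.cong suc eq) fresh ⟩
    (_ + ΣR (suc lo) i (λ a → ΣC lo n (bump p p a) a (λ s → withZeros z lo U p (a ∷ s)))) + u * y * (runs y z lo lo n U′ (suc p) + (v - 1#) * runs y z lo (suc (suc p)) n U′ (suc p))
      ≈⟨ +-cong (+-cong (trans (withZeros-zero z n lo p p U i 1 eq ≡.refl ℕₚ.≤-refl fresh used-lo) (reflexive (≡.cong (λ W → v * (x * z * (tail∋0 z n [] W + tail≥ n [] W))) (≡.cong₂ _++_ L≡ R≡))))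
                        (trans (descents-correct U (suc lo) p p (tail∋0∪tail≥ z n) (restAbove n) (withZeros-term z n lo p p U fresh used-lo) ℕₚ.≤-refl i 1 eq′ ≡.refl)
                          (trans (reflexive (≡.cong₂ (λ R L → splits (move (tail∋0∪tail≥ z n) (restAbove n) R) [] L) R≡ L≡)) (splits-tail∋0∪tail≥ z n [ 1# ] [] (used i)))))
                (*-congˡ (+-cong (run∋0-correct y z n lo (suc i) U′ (suc p) (≡.cong suc eq) fresh′ (usedIn-mark usedIn))
                   (*-congˡ (runs-zeros y z lo (suc (suc p)) n U′ (suc p) (s≤s (ℕₚ.m≤n⇒m≤1+n lo≤p)))))) ⟩
    (v * q + (v * s₁ + s₂)) + u * y * ((v * ρ + a₁) + (v - 1#) * a₂)
      ≈⟨ solve 9 (λ v q s₁ s₂ u y ρ a₁ a₂ → (v :* q :+ (v :* s₁ :+ s₂)) :+ u :* y :* ((v :* ρ :+ a₁) :+ (v :- con (+ 1)) :* a₂)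
           := v :* (u :* y :* ρ :+ (q :+ s₁)) :+ (s₂ :+ u :* y :* (a₁ :+ (v :- con (+ 1)) :* a₂))) refl v q s₁ s₂ u y ρ a₁ a₂ ⟩
    v * run∋0 z y (suc n) i + (s₂ + u * y * (a₁ + (v - 1#) * a₂))
      ≈⟨ +-congˡ (+-congʳ (sym (trans
           (ΣR-cong (suc lo) i (λ a → ΣC-cong (suc lo) n _ a (λ {s} _ → *-congʳ (trans (*-congˡ (zeros-1 lo (a ∷ s))) (*-identityʳ _)))))
           (trans (descents-correct U (suc lo) p p (tail≥ n) (restAbove n) (tail≥-term n (suc lo) p p U fresh) ℕₚ.≤-refl i 1 eq′ ≡.refl)
              (reflexive (≡.cong₂ (λ R L → splits (move (tail≥ n) (restAbove n) R) [] L) R≡ L≡)))))) ⟩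
    v * run∋0 z y (suc n) i + (ΣR (suc lo) i (λ a → ΣC (suc lo) n (bump p p a) a (λ s → withZeros 1# lo U p (a ∷ s))) + u * y * (a₁ + (v - 1#) * a₂))
      ≈⟨ +-congˡ (runs-step y 1# lo (suc lo) n U p i lo≤p (s≤s lo≤p) eq′ fresh) ⟨
    v * run∋0 z y (suc n) i + runs y 1# lo (suc lo) (suc n) U p ∎
    where
    U′ = mark (suc p) U
    lo≤p : lo ≤ p
    lo≤p = ≡.subst (lo ≤_) eq (ℕₚ.m≤n+m lo i)
    used-lo : U lo ≡ true
    used-lo = usedIn lo ℕₚ.≤-refl lo≤p
    eq′ : i ℕ.+ suc lo ≡ suc p
    eq′ = ≡.trans (ℕₚ.+-suc i lo) (≡.cong suc eq)
    fresh′ : Fresh U′ (suc p)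
    fresh′ = fresh-mark (suc p) fresh (ℕₚ.n≤1+n p) ℕₚ.≤-refl
    L≡ : seg U (suc lo) i ≡ used i
    L≡ = seg-used U (suc lo) i usedIn (ℕₚ.n≤1+n lo) (ℕₚ.≤-reflexive eq′)
    R≡ : seg U (suc p) 1 ≡ [ 1# ]
    R≡ = ≡.cong (λ e → weightIf e x ∷ []) (fresh (suc p) ℕₚ.≤-refl)
    q = x * z * (tail∋0 z n [] (used i ++ [ 1# ]) + tail≥ n [] (used i ++ [ 1# ]))
    s₁ = splits (move (tail∋0 z n) (λ _ → 0#) [ 1# ]) [] (used i)
    s₂ = splits (move (tail≥ n) (restAbove n) [ 1# ]) [] (used i)
    ρ = run∋0 z y n (suc i)
    a₁ = runs y 1# lo (suc lo) n U′ (suc p)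
    a₂ = runs y 1# lo (suc (suc p)) n U′ (suc p)

  run≥-correct : ∀ y lo n U p → lo ≤ p → Fresh U p → runs y 1# lo (suc p) n U p ≈ run≥ y n
  run≥-correct y lo zero    U p lo≤p fresh = solve 0 (con (+ 1) :* con (+ 1) :* con (+ 1) :* con (+ 1) := con (+ 1)) refl
  run≥-correct y lo (suc n) U p lo≤p fresh = begin
    runs y 1# lo (suc p) (suc n) U p
      ≈⟨ trans (runs-step y 1# lo (suc p) n U p 0 lo≤p ℕₚ.≤-refl ≡.refl fresh) (+-identityˡ _) ⟩
    u * y * (runs y 1# lo (suc p) n U′ (suc p) + (v - 1#) * runs y 1# lo (suc (suc p)) n U′ (suc p))
      -- Because z is 1, the value carrying it can be moved up from lo to p + 1, the new lowest
      -- value, where `run∋0-correct` starts again with i = 0.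
      ≈⟨ *-congˡ (+-cong (trans (runs-1 y lo (suc p) (suc p) n U′ (suc p)) (trans (run∋0-correct y 1# n (suc p) 0 U′ (suc p) ≡.refl fresh′
            (λ a lo≤a a≤p → ≡.subst (λ b → mark (suc p) U b ≡ true) (ℕₚ.≤-antisym lo≤a a≤p) (≡.cong (_∨ U (suc p)) (≡ᵇ-refl (suc p)))))
            (+-congˡ (run≥-correct y (suc p) n U′ (suc p) ℕₚ.≤-refl fresh′))))
          (*-congˡ (run≥-correct y lo n U′ (suc p) (ℕₚ.m≤n⇒m≤1+n lo≤p) fresh′))) ⟩
    u * y * ((v * run∋0 1# y n 0 + run≥ y n) + (v - 1#) * run≥ y n)
      ≈⟨ solve 5 (λ u y v a b → u :* y :* ((v :* a :+ b) :+ (v :- con (+ 1)) :* b) := u :* y :* v :* (a :+ b)) refl u y v _ _ ⟩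
    u * y * v * (run∋0 1# y n 0 + run≥ y n) ∎
    where
    U′ = mark (suc p) U
    fresh′ : Fresh U′ (suc p)
    fresh′ = fresh-mark (suc p) fresh (ℕₚ.n≤1+n p) ℕₚ.≤-refl

  startUsed : ℕ → Bool
  startUsed = mark 0 (λ _ → false)

  weight : Carrier → Carrier → List ℕ → Carrier
  weight y z s = word (λ _ → false) 0 s * zeros z 0 s * fixeds y 0 s * minima s

  total-correct : ∀ y z n → sumL (map (weight y z) (A (suc n))) ≈ total z y n
  total-correct y z n = begin
    sumL (map (weight y z) (A (suc n)))
      ≈⟨ sumL-A n (weight y z) ⟩
    ΣC 0 n 0 0 (λ s → weight y z (0 ∷ s))
      ≈⟨ ΣC-first 0 n 0 0 (z * y) _ (λ s → word startUsed 0 s * zeros z 0 s * fixeds y 1 s) z≤n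
           (λ {s} _ → solve 6 (λ z y a b c d → con (+ 1) :* con (+ 1) :* a :* (z :* b) :* (y :* c) :* d := z :* y :* (a :* b :* c :* d)) refl
             z y (word startUsed 0 s) (zeros z 0 s) (fixeds y 1 s) (minima (0 ∷ s))) ⟩
    z * y * (runs y z 0 0 n startUsed 0 + (v - 1#) * runs y z 0 1 n startUsed 0)
      ≈⟨ *-congˡ (+-cong (trans (run∋0-correct y z n 0 0 startUsed 0 ≡.refl fresh (λ { zero _ _ → ≡.refl ; (suc _) _ () })) (+-congˡ avoiding))
                         (*-congˡ (trans (runs-zeros y z 0 1 n startUsed 0 ℕₚ.≤-refl) avoiding))) ⟩
    z * y * ((v * run∋0 z y n 0 + run≥ y n) + (v - 1#) * run≥ y n)
      ≈⟨ solve 5 (λ z y v a b → z :* y :* ((v :* a :+ b) :+ (v :- con (+ 1)) :* b) := z :* y :* v :* (a :+ b)) refl z y v _ _ ⟩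
    total z y n ∎
    where
    fresh : Fresh startUsed 0
    fresh (suc b) _ = ≡.refl
    avoiding : runs y 1# 0 1 n startUsed 0 ≈ run≥ y n
    avoiding = run≥-correct y 0 n startUsed 0 z≤n fresh

-- rep and rmin as sums over entries

repeatsFrom : (ℕ → Bool) → List ℕ → ℕ
repeatsFrom U []      = 0
repeatsFrom U (a ∷ s) = (if U a then 1 else 0) ℕ.+ repeatsFrom (mark a U) s

unmarked : (ℕ → Bool) → List ℕ → ℕ
unmarked U = count (not ∘ U)

≡ᵇ-comm : ∀ m n → (m ≡ᵇ n) ≡ (n ≡ᵇ m)
≡ᵇ-comm zero    zero    = ≡.refl
≡ᵇ-comm zero    (suc n) = ≡.refl
≡ᵇ-comm (suc m) zero    = ≡.refl
≡ᵇ-comm (suc m) (suc n) = ≡ᵇ-comm m n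

unmarked-mark : ∀ U a xs → unmarked (mark a U) xs ≡ unmarked U (filter (λ y → ¬? (a ≟ y)) xs)
unmarked-mark U a []       = ≡.refl
unmarked-mark U a (b ∷ xs) rewrite ≡ᵇ-comm b a with a ≡ᵇ b
... | true  = unmarked-mark U a xs
... | false = ≡.cong ((if not (U b) then 1 else 0) ℕ.+_) (unmarked-mark U a xs)

-- Generalised to an arbitrary set U of values seen before, so that the induction can mark the head.
unmarked+repeats : ∀ U s → unmarked U (deduplicate _≟_ s) ℕ.+ repeatsFrom U s ≡ length s
unmarked+repeats U []      = ≡.refl
unmarked+repeats U (a ∷ s)
  rewrite ≡.sym (unmarked-mark U a (deduplicate _≟_ s)) with U a
... | true  = ≡.trans (ℕₚ.+-suc _ _) (≡.cong suc (unmarked+repeats (mark a U) s))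
... | false = ≡.cong suc (unmarked+repeats (mark a U) s)

unmarked-none : ∀ xs → unmarked (λ _ → false) xs ≡ length xs
unmarked-none []       = ≡.refl
unmarked-none (a ∷ xs) = ≡.cong suc (unmarked-none xs)

rep≡repeatsFrom : ∀ s → rep s ≡ repeatsFrom (λ _ → false) s
rep≡repeatsFrom s = ≡.trans (≡.cong (_∸ d) (≡.trans (≡.sym (unmarked+repeats (λ _ → false) s))
    (≡.trans (≡.cong (ℕ._+ ρ) (unmarked-none (deduplicate _≟_ s))) (ℕₚ.+-comm d ρ)))) (ℕₚ.m+n∸n≡m ρ d)
  where
  d = length (deduplicate _≟_ s)
  ρ = repeatsFrom (λ _ → false) s

-- A new right-to-left minimum is smaller than everything after it, so the `deduplicate` in `rmin`
-- removes nothing.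
minima-above : ∀ a s → allB (a <ᵇ_) s ≡ true → All (λ b → a ≢ b) (rminValues s)
minima-above a []      h = []
minima-above a (b ∷ s) h with a <ᵇ b in eq
... | true with allB (b <ᵇ_) s
...   | true  = (λ { ≡.refl → ℕₚ.<-irrefl ≡.refl (ℕₚ.<ᵇ⇒< a b (≡.subst Bool.T (≡.sym eq) _)) }) ∷ minima-above a s h
...   | false = minima-above a s h

rmin-∷ : ∀ a s → rmin (a ∷ s) ≡ (if allB (a <ᵇ_) s then 1 else 0) ℕ.+ rmin s
rmin-∷ a s with allB (a <ᵇ_) s in eq
... | true  = ≡.cong (λ xs → suc (length xs)) (filter-all (λ y → ¬? (a ≟ y)) (Allₚ.deduplicate⁺ _≟_ (minima-above a s eq)))
... | false = ≡.refl

module StatisticPowers (S : CommutativeRing 0ℓ 0ℓ) (x u v : CommutativeRing.Carrier S) where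
  open CommutativeRing S hiding (zero)
  open import Relation.Binary.Reasoning.Setoid setoid
  open IntegerSolver S
  open Series S using (pow; sumL)
  open ListSums S
  open WordModel.Weights S x u v using (total)
  open Statistics S x u v

  pow-if : ∀ b a k → pow a ((if b then 1 else 0) ℕ.+ k) ≈ weightIf b a * pow a k
  pow-if true  a k = refl
  pow-if false a k = sym (*-identityˡ _)

  word-pow : ∀ U p s → word U p s ≈ pow x (repeatsFrom U s) * pow u (asc (p ∷ s))
  word-pow U p []      = sym (*-identityˡ 1#)
  word-pow U p (a ∷ s) = begin
    slot U a * weightIf (p <ᵇ a) u * word (mark a U) a s
      ≈⟨ *-congˡ (word-pow (mark a U) a s) ⟩
    slot U a * weightIf (p <ᵇ a) u * (pow x (repeatsFrom (mark a U) s) * pow u (asc (a ∷ s)))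
      ≈⟨ solve 4 (λ a b c d → a :* b :* (c :* d) := (a :* c) :* (b :* d)) refl _ _ _ _ ⟩
    (slot U a * pow x (repeatsFrom (mark a U) s)) * (weightIf (p <ᵇ a) u * pow u (asc (a ∷ s)))
      ≈⟨ *-cong (pow-if (U a) x (repeatsFrom (mark a U) s)) (pow-if (p <ᵇ a) u (asc (a ∷ s))) ⟨
    pow x (repeatsFrom U (a ∷ s)) * pow u (asc (p ∷ a ∷ s)) ∎

  zeros-pow : ∀ z s → zeros z 0 s ≈ pow z (zeroSt s)
  zeros-pow z []      = refl
  zeros-pow z (a ∷ s) = trans (*-congˡ (zeros-pow z s)) (sym (pow-if (a ≡ᵇ 0) z (zeroSt s)))

  fixeds-pow : ∀ y j s → fixeds y j s ≈ pow y (fixedFrom j s)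
  fixeds-pow y j []      = refl
  fixeds-pow y j (a ∷ s) = trans (*-congˡ (fixeds-pow y (suc j) s)) (sym (pow-if (a ≡ᵇ j) y (fixedFrom (suc j) s)))

  minima-pow : ∀ s → minima s ≈ pow v (rmin s)
  minima-pow []      = refl
  minima-pow (a ∷ s) = trans (*-congˡ (minima-pow s)) (trans (sym (pow-if (allB (a <ᵇ_) s) v (rmin s)))
    (reflexive (≡.cong (pow v) (≡.sym (rmin-∷ a s)))))

  monomial : Carrier → Carrier → List ℕ → Carrier
  monomial y z s = pow x (rep s) * pow y (maxSt s) * pow u (asc s) * pow z (zeroSt s) * pow v (rmin s)

  statistics-total : ∀ y z n → sumL (map (monomial y z) (A (suc n))) ≈ total z y n
  statistics-total y z n = begin
    sumL (map (monomial y z) (A (suc n)))        ≈⟨ sumL-A n (monomial y z) ⟩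
    ΣC 0 n 0 0 (λ s → monomial y z (0 ∷ s))      ≈⟨ ΣC-cong 0 n 0 0 (λ {s} _ → same s) ⟩
    ΣC 0 n 0 0 (λ s → weight y z (0 ∷ s))        ≈⟨ sumL-A n (weight y z) ⟨
    sumL (map (weight y z) (A (suc n)))          ≈⟨ total-correct y z n ⟩
    total z y n                                  ∎
    where
    same : ∀ s → monomial y z (0 ∷ s) ≈ weight y z (0 ∷ s)
    same s = begin
      pow x (rep (0 ∷ s)) * pow y (maxSt (0 ∷ s)) * pow u (asc (0 ∷ s)) * pow z (zeroSt (0 ∷ s)) * pow v (rmin (0 ∷ s))
        ≡⟨ ≡.cong₂ (λ i j → pow x i * pow y j * pow u (asc (0 ∷ s)) * pow z (zeroSt (0 ∷ s)) * pow v (rmin (0 ∷ s)))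
             (rep≡repeatsFrom (0 ∷ s)) (maxSt-∷ 0 s) ⟩
      pow x (repeatsFrom (λ _ → false) (0 ∷ s)) * pow y (fixedFrom 0 (0 ∷ s)) * pow u (asc (0 ∷ s)) * pow z (zeroSt (0 ∷ s)) * pow v (rmin (0 ∷ s))
        ≈⟨ solve 5 (λ a b c d e → a :* b :* c :* d :* e := a :* c :* d :* b :* e) refl _ _ _ _ _ ⟩
      pow x (repeatsFrom (λ _ → false) (0 ∷ s)) * pow u (asc (0 ∷ 0 ∷ s)) * pow z (zeroSt (0 ∷ s)) * pow y (fixedFrom 0 (0 ∷ s)) * pow v (rmin (0 ∷ s))
        ≈⟨ *-cong (*-cong (*-cong (word-pow (λ _ → false) 0 (0 ∷ s)) (zeros-pow z (0 ∷ s))) (fixeds-pow y 0 (0 ∷ s))) (minima-pow (0 ∷ s)) ⟨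
      weight y z (0 ∷ s) ∎

-- Power series as a commutative ring

module Convolution (R : CommutativeRing 0ℓ 0ℓ) where
  open CommutativeRing R hiding (zero)
  open Series R
  open import Relation.Binary.Reasoning.Setoid setoid
  open IntegerSolver R
  open ListSums R

  tl : PS → PS
  tl f k = f (suc k)

  -- The Cauchy product by recursion on the degree, free of the truncated subtraction in `_⊗_`.
  conv : PS → PS → PS
  conv f g zero    = f 0 * g 0
  conv f g (suc n) = f 0 * g (suc n) + conv (tl f) g n

  ⊗≈conv : ∀ f g n → (f ⊗ g) n ≈ conv f g n
  ⊗≈conv f g n = trans (sumL-upTo (suc n) _) (go f n)
    where
    go : ∀ f n → ΣR 0 (suc n) (λ k → f k * g (n ∸ k)) ≈ conv f g n
    go f zero    = +-identityʳ _
    go f (suc n) = +-congˡ (trans (ΣR-shift 0 (suc n) _) (go (tl f) n))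

  conv-cong : ∀ n {f f′ g g′} → (∀ k → k ≤ n → f k ≈ f′ k) → (∀ k → k ≤ n → g k ≈ g′ k) → conv f g n ≈ conv f′ g′ n
  conv-cong zero    ef eg = *-cong (ef 0 z≤n) (eg 0 z≤n)
  conv-cong (suc n) ef eg = +-cong (*-cong (ef 0 z≤n) (eg (suc n) ℕₚ.≤-refl))
    (conv-cong n (λ k k≤ → ef (suc k) (s≤s k≤)) (λ k k≤ → eg k (ℕₚ.m≤n⇒m≤1+n k≤)))

  conv-last : ∀ f g n → conv f g (suc n) ≈ conv f (tl g) n + f (suc n) * g 0
  conv-last f g zero    = refl
  conv-last f g (suc n) = trans (+-congˡ (conv-last (tl f) g n)) (sym (+-assoc _ _ _))

  conv-comm : ∀ n f g → conv f g n ≈ conv g f n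
  conv-comm zero    f g = *-comm _ _
  conv-comm (suc n) f g = begin
    f 0 * g (suc n) + conv (tl f) g n     ≈⟨ +-comm _ _ ⟩
    conv (tl f) g n + f 0 * g (suc n)     ≈⟨ +-cong (conv-comm n (tl f) g) (*-comm _ _) ⟩
    conv g (tl f) n + g (suc n) * f 0     ≈⟨ conv-last g f n ⟨
    conv g f (suc n)                      ∎

  conv-distribʳ : ∀ n f g h → conv (g ⊕ h) f n ≈ conv g f n + conv h f n
  conv-distribʳ zero    f g h = distribʳ _ _ _
  conv-distribʳ (suc n) f g h = trans (+-cong (distribʳ _ _ _) (conv-distribʳ n f (tl g) (tl h)))
    (solve 4 (λ a b c d → (a :+ b) :+ (c :+ d) := (a :+ c) :+ (b :+ d)) refl _ _ _ _)

  conv-scale : ∀ n a f g → conv (λ k → a * f k) g n ≈ a * conv f g n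
  conv-scale zero    a f g = *-assoc _ _ _
  conv-scale (suc n) a f g = trans (+-cong (*-assoc _ _ _) (conv-scale n a (tl f) g)) (sym (distribˡ _ _ _))

  conv-assoc : ∀ n f g h → conv (conv f g) h n ≈ conv f (conv g h) n
  conv-assoc zero    f g h = *-assoc _ _ _
  conv-assoc (suc n) f g h = begin
    f 0 * g 0 * h (suc n) + conv ((λ k → f 0 * tl g k) ⊕ conv (tl f) g) h n
      ≈⟨ +-congˡ (trans (conv-distribʳ n h _ _) (+-cong (conv-scale n (f 0) (tl g) h) (conv-assoc n (tl f) g h))) ⟩
    f 0 * g 0 * h (suc n) + (f 0 * conv (tl g) h n + conv (tl f) (conv g h) n)
      ≈⟨ solve 5 (λ a b c d e → a :* b :* c :+ (a :* d :+ e) := a :* (b :* c :+ d) :+ e) refl _ _ _ _ _ ⟩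
    f 0 * (g 0 * h (suc n) + conv (tl g) h n) + conv (tl f) (conv g h) n ∎

  conv-0 : ∀ n g → conv (λ _ → 0#) g n ≈ 0#
  conv-0 zero    g = zeroˡ _
  conv-0 (suc n) g = trans (+-cong (zeroˡ _) (conv-0 n g)) (+-identityˡ 0#)

  conv-const : ∀ n a g → conv (const a) g n ≈ a * g n
  conv-const zero    a g = refl
  conv-const (suc n) a g = trans (+-congˡ (conv-0 n g)) (+-identityʳ _)

  tPS-⊗-zero : ∀ f → (tPS ⊗ f) 0 ≈ 0#
  tPS-⊗-zero f = trans (⊗≈conv tPS f 0) (zeroˡ _)

  tPS-⊗-suc : ∀ f n → (tPS ⊗ f) (suc n) ≈ f n
  tPS-⊗-suc f n = begin
    (tPS ⊗ f) (suc n)                  ≈⟨ ⊗≈conv tPS f (suc n) ⟩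
    0# * f (suc n) + conv (tl tPS) f n ≈⟨ +-cong (zeroˡ _) (conv-cong n (λ { zero _ → refl ; (suc k) _ → refl }) (λ _ _ → refl)) ⟩
    0# + conv (const 1#) f n           ≈⟨ +-identityˡ _ ⟩
    conv (const 1#) f n                ≈⟨ conv-const n 1# f ⟩
    1# * f n                           ≈⟨ *-identityˡ _ ⟩
    f n                                ∎

module PowerSeriesRing (R : CommutativeRing 0ℓ 0ℓ) (P : ℕ → Set) (down : ∀ {m n} → m ≤ n → P n → P m) where
  open CommutativeRing R hiding (zero)
  open Series R
  open Convolution R

  -- Only the degrees in the downward closed `P` are compared. Degrees up to N make t nilpotent; all
  -- degrees give the full ring used for extracting coefficients.
  _≋_ : PS → PS → Set
  f ≋ g = ∀ k → P k → f k ≈ g k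

  ⊗-cong : ∀ {f f′ g g′} → f ≋ f′ → g ≋ g′ → (f ⊗ g) ≋ (f′ ⊗ g′)
  ⊗-cong {f} {f′} {g} {g′} ef eg n pn = trans (⊗≈conv f g n) (trans
    (conv-cong n (λ k k≤ → ef k (down k≤ pn)) (λ k k≤ → eg k (down k≤ pn))) (sym (⊗≈conv f′ g′ n)))

  ⊗-comm : ∀ f g → (f ⊗ g) ≋ (g ⊗ f)
  ⊗-comm f g n _ = trans (⊗≈conv f g n) (trans (conv-comm n f g) (sym (⊗≈conv g f n)))

  ⊗-assoc : ∀ f g h → ((f ⊗ g) ⊗ h) ≋ (f ⊗ (g ⊗ h))
  ⊗-assoc f g h n _ = trans (⊗≈conv (f ⊗ g) h n) (trans (conv-cong n (λ k _ → ⊗≈conv f g k) (λ _ _ → refl))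
    (trans (conv-assoc n f g h) (trans (conv-cong n (λ _ _ → refl) (λ k _ → sym (⊗≈conv g h k))) (sym (⊗≈conv f (g ⊗ h) n)))))

  ⊗-identityˡ : ∀ f → (const 1# ⊗ f) ≋ f
  ⊗-identityˡ f n _ = trans (⊗≈conv (const 1#) f n) (trans (conv-const n 1# f) (*-identityˡ _))

  ⊗-distribʳ : ∀ f g h → ((g ⊕ h) ⊗ f) ≋ ((g ⊗ f) ⊕ (h ⊗ f))
  ⊗-distribʳ f g h n _ = trans (⊗≈conv (g ⊕ h) f n) (trans (conv-distribʳ n f g h)
    (+-cong (sym (⊗≈conv g f n)) (sym (⊗≈conv h f n))))

  seriesRing : CommutativeRing 0ℓ 0ℓ
  seriesRing = record
    { Carrier = PS
    ; _≈_ = _≋_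
    ; _+_ = _⊕_
    ; _*_ = _⊗_
    ; -_ = ⊖_
    ; 0# = λ _ → 0#
    ; 1# = const 1#
    ; isCommutativeRing = record
      { isRing = record
        { +-isAbelianGroup = record
          { isGroup = record
            { isMonoid = record
              { isSemigroup = record
                { isMagma = record
                  { isEquivalence = record
                    { refl = λ _ _ → refl
                    ; sym = λ e k p → sym (e k p)
                    ; trans = λ e e′ k p → trans (e k p) (e′ k p) }
                  ; ∙-cong = λ e e′ k p → +-cong (e k p) (e′ k p) }
                ; assoc = λ _ _ _ _ _ → +-assoc _ _ _ }
              ; identity = (λ _ _ _ → +-identityˡ _) , (λ _ _ _ → +-identityʳ _) }
            ; inverse = (λ _ _ _ → -‿inverseˡ _) , (λ _ _ _ → -‿inverseʳ _)
            ; ⁻¹-cong = λ e k p → -‿cong (e k p) }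
          ; comm = λ _ _ _ _ → +-comm _ _ }
        ; *-cong = ⊗-cong
        ; *-assoc = ⊗-assoc
        ; *-identity = ⊗-identityˡ , (λ f n p → trans (⊗-comm f (const 1#) n p) (⊗-identityˡ f n p))
        ; distrib = (λ f g h n p → trans (⊗-comm f (g ⊕ h) n p) (trans (⊗-distribʳ f g h n p) (+-cong (⊗-comm g f n p) (⊗-comm h f n p))))
                  , ⊗-distribʳ }
      ; *-comm = ⊗-comm } }

  module PSR = CommutativeRing seriesRing

  const-⊗ : ∀ a b → const (a * b) ≋ (const a ⊗ const b)
  const-⊗ a b n _ = sym (trans (⊗≈conv (const a) (const b) n) (trans (conv-const n a (const b)) (scaled n)))
    where
    scaled : ∀ n → a * const b n ≈ const (a * b) n
    scaled zero    = refl
    scaled (suc n) = zeroʳ a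

  const-pow : ∀ a n → const (pow a n) ≋ powPS (const a) n
  const-pow a zero    = PSR.refl
  const-pow a (suc n) = PSR.trans (const-⊗ a (pow a n)) (PSR.*-congˡ {const a} (const-pow a n))

  const-+ : ∀ a b → const (a + b) ≋ (const a ⊕ const b)
  const-+ a b zero    _ = refl
  const-+ a b (suc k) _ = sym (+-identityˡ 0#)

  const-neg : ∀ a → const (- a) ≋ (⊖ const a)
  const-neg a zero    _ = refl
  const-neg a (suc k) _ = sym -0#≈0#
    where open import Algebra.Properties.Ring ring using (-0#≈0#)

  const-0 : const 0# ≋ (λ _ → 0#)
  const-0 zero    _ = refl
  const-0 (suc k) _ = refl

  const-sumL : ∀ {B : Set} (f : B → Carrier) xs → const (sumL (map f xs)) ≋ Series.sumL seriesRing (map (λ s → const (f s)) xs)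
  const-sumL f []       = const-0
  const-sumL f (s ∷ xs) = PSR.trans (const-+ (f s) _) (PSR.+-congˡ {const (f s)} (const-sumL f xs))

  pow-series : ∀ f n → Series.pow seriesRing f n ≡ powPS f n
  pow-series f zero    = ≡.refl
  pow-series f (suc n) = ≡.cong (f ⊗_) (pow-series f n)

  powPS-tPS : ∀ n k → k < n → powPS tPS n k ≈ 0#
  powPS-tPS (suc n) zero    _         = tPS-⊗-zero (powPS tPS n)
  powPS-tPS (suc n) (suc k) (s≤s k<n) = trans (tPS-⊗-suc (powPS tPS n) k) (powPS-tPS n k k<n)

module TruncatedSeries (R : CommutativeRing 0ℓ 0ℓ) (N : ℕ) where
  open CommutativeRing R hiding (zero)
  open Series R
  open Convolution R
  open PowerSeriesRing R (_≤ N) ℕₚ.≤-trans public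

  tPS-nilpotent : PSR._≈_ (Series.pow seriesRing tPS (suc N)) PSR.0#
  tPS-nilpotent k k≤N = trans (reflexive (≡.cong (λ f → f k) (pow-series tPS (suc N)))) (powPS-tPS (suc N) k (s≤s k≤N))

  open NilpotentSums seriesRing N tPS tPS-nilpotent using (horner)

  horner-const : ∀ n c k → k ≤ n → horner n tPS (λ i → const (c i)) k ≈ c k
  horner-const zero    c zero    z≤n       = refl
  horner-const (suc n) c zero    z≤n       =
    trans (+-congˡ (tPS-⊗-zero (horner n tPS (λ i → const (c (suc i)))))) (+-identityʳ _)
  horner-const (suc n) c (suc k) (s≤s k≤n) =
    trans (+-identityˡ _) (trans (tPS-⊗-suc (horner n tPS (λ i → const (c (suc i)))) k) (horner-const n (λ i → c (suc i)) k k≤n))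

-- The generating function in the truncated series ring

module StatisticSums (R : CommutativeRing 0ℓ 0ℓ) where
  open CommutativeRing R hiding (zero)
  open Series R

  statisticSum : (x u v y z : Carrier) → ℕ → Carrier
  statisticSum x u v y z n = sumL (map (StatisticPowers.monomial R x u v y z) (A (suc n)))

module GeneratingFunction (R : CommutativeRing 0ℓ 0ℓ) (N : ℕ) where
  open Series R
  open StatisticSums R
  open TruncatedSeries R N public
  module S = CommutativeRing seriesRing
  open NilpotentSums seriesRing N tPS tPS-nilpotent using (horner; horner-cong) public
  module Sym = Symmetry seriesRing N tPS tPS-nilpotent
  private module R = CommutativeRing R

  totals : (x u v y z : PS) → PS
  totals x u v y z = horner N tPS (WordModel.Weights.total seriesRing x u v z y)

  const-monomial : ∀ x u v y z s → StatisticPowers.monomial seriesRing (const x) (const u) (const v) (const y) (const z) s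
    S.≈ const (StatisticPowers.monomial R x u v y z s)
  const-monomial x u v y z s = S.sym (S.trans (const-⊗ _ _) (S.*-cong (S.trans (const-⊗ _ _) (S.*-cong (S.trans (const-⊗ _ _)
    (S.*-cong (S.trans (const-⊗ _ _) (S.*-cong (power x (rep s)) (power y (maxSt s)))) (power u (asc s)))) (power z (zeroSt s)))) (power v (rmin s))))
    where
    power : ∀ a n → const (pow a n) S.≈ Series.pow seriesRing (const a) n
    power a n = S.trans (const-pow a n) (S.reflexive (≡.sym (pow-series (const a) n)))

  totals-coefficient : ∀ x u v y z n → n ≤ N → totals (const x) (const u) (const v) (const y) (const z) n R.≈ statisticSum x u v y z n
  totals-coefficient x u v y z n n≤N = R.trans (S.trans (horner-cong N tPS (λ k → S.trans
      (S.sym (StatisticPowers.statistics-total seriesRing (const x) (const u) (const v) (const y) (const z) k))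
      (S.trans (ListSums.sumL-cong seriesRing (const-monomial x u v y z) (A (suc k))) (S.sym (const-sumL _ (A (suc k))))))) S.refl n n≤N)
    (horner-const N (statisticSum x u v y z) n n≤N)

  totals-eq : ∀ x u v y z → totals x u v y z S.≈ z ⊗ y ⊗ v ⊗ (Sym.Δ x u z y v ⊕ Sym.Kernel.M x u v y)
  totals-eq x u v y z = KernelEquation.total-eq seriesRing N tPS tPS-nilpotent x u v z y

module StatisticSymmetry (R : CommutativeRing 0ℓ 0ℓ) where
  open CommutativeRing R hiding (zero)
  open Series R
  open StatisticSums R

  max-rmin-swap : ∀ x u v y z n → statisticSum x u v y z n ≈ statisticSum x u y v z n
  max-rmin-swap x u v y z n = trans (sym (totals-coefficient x u v y z n ℕₚ.≤-refl))
    (trans (swapped n ℕₚ.≤-refl) (totals-coefficient x u y v z n ℕₚ.≤-refl))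
    where
    -- Truncation at degree n still shows the coefficient n.
    open GeneratingFunction R n
    open IntegerSolver seriesRing
    swapped : totals (const x) (const u) (const v) (const y) (const z) S.≈ totals (const x) (const u) (const y) (const v) (const z)
    swapped = S.trans (totals-eq _ _ (const v) (const y) (const z)) (S.trans
      (S.*-cong (solve 3 (λ z y v → z :* y :* v := z :* v :* y) S.refl (const z) (const y) (const v))
        (S.+-cong (Sym.Δ-sym (const x) (const u) (const z) (const y) (const v)) (Sym.M-sym (const x) (const u) (const y) (const v))))
      (S.sym (totals-eq _ _ (const y) (const v) (const z))))

  asc-rep-swap : ∀ x u y z n → statisticSum x u 1# y z n ≈ statisticSum u x 1# z y n
  asc-rep-swap x u y z n = trans (sym (totals-coefficient x u 1# y z n ℕₚ.≤-refl))
    (trans (swapped n ℕₚ.≤-refl) (totals-coefficient u x 1# z y n ℕₚ.≤-refl))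
    where
    open GeneratingFunction R n
    open IntegerSolver seriesRing
    swapped : totals (const x) (const u) (const 1#) (const y) (const z) S.≈ totals (const u) (const x) (const 1#) (const z) (const y)
    swapped = S.trans (totals-eq _ _ (const 1#) (const y) (const z)) (S.trans
      (S.*-cong (S.*-congʳ (S.*-comm (const z) (const y))) (Sym.φ-sym (const x) (const u) (const z) (const y)))
      (S.sym (totals-eq _ _ (const 1#) (const z) (const y))))

-- Inverses of power series

module SeriesInverse (R : CommutativeRing 0ℓ 0ℓ) where
  open CommutativeRing R hiding (zero)
  open Series R
  open Convolution R
  open IntegerSolver R
  open import Relation.Binary.Reasoning.Setoid setoid

  -- convTail f k w n is the private dot f k (invList f w n) of Defs, recovered by unification.
  mutual
    convTail : PS → ℕ → Carrier → ℕ → Carrier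
    convTail = _

    invPS-suc : ∀ f w n → invPS f w (suc n) ≡ - (w * convTail f 1 w n)
    invPS-suc f w n with 1
    ... | k = ≡.refl

  convTail≈conv : ∀ f w n k F → (∀ j → F j ≡ f (j ℕ.+ k)) → convTail f k w n ≈ conv F (invPS f w) n
  convTail≈conv f w zero    k F eq = trans (+-identityʳ _) (*-congʳ (reflexive (≡.sym (eq 0))))
  convTail≈conv f w (suc n) k F eq = +-cong (*-congʳ (reflexive (≡.sym (eq 0))))
    (convTail≈conv f w n (suc k) (tl F) (λ j → ≡.trans (eq (suc j)) (≡.cong f (≡.sym (ℕₚ.+-suc j k)))))

  conv-inverse : ∀ f w → w * f 0 ≈ 1# → ∀ n → conv f (invPS f w) n ≈ const 1# n
  conv-inverse f w unit zero    = trans (*-comm _ _) unit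
  conv-inverse f w unit (suc n) = begin
    f 0 * - (w * d) + conv (tl f) (invPS f w) n   ≈⟨ +-congˡ (convTail≈conv f w n 1 (tl f) (λ j → ≡.cong f (≡.sym (ℕₚ.+-comm j 1)))) ⟨
    f 0 * - (w * d) + d                           ≈⟨ solve 3 (λ a w d → a :* (:- (w :* d)) :+ d := d :- w :* a :* d) refl _ w d ⟩
    d - w * f 0 * d                               ≈⟨ +-congˡ (-‿cong (trans (*-congʳ unit) (*-identityˡ d))) ⟩
    d - d                                         ≈⟨ -‿inverseʳ d ⟩
    0#                                            ∎
    where d = convTail f 1 w n

-- Iterating the functional equation

module Iteration (S : CommutativeRing 0ℓ 0ℓ) (N : ℕ) (t : CommutativeRing.Carrier S)
  (nil : CommutativeRing._≈_ S (Series.pow S t (suc N)) (CommutativeRing.0# S)) where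
  open CommutativeRing S hiding (zero)
  open import Relation.Binary.Reasoning.Setoid setoid
  open IntegerSolver S
  open LinearCombination S
  open Series S using (pow)
  open Symmetry S N t nil

  module _ (x u y v : Carrier) where

    s : Carrier
    s = x + u - x * u

    iter : ℕ → Carrier
    iter zero    = y
    iter (suc i) = c x u (iter i)

    -- `ρ` stands for r as the formula writes it, which agrees with `r x u` only up to the equality
    -- of the ring.
    q : Carrier → ℕ → Carrier
    q ρ i = (1# - y * ρ) * pow (1# - ρ) i

    q-iter : ∀ {ρ} → ρ ≈ r x u → ∀ i → q ρ i ≈ 1# - iter i * r x u
    q-iter e zero    = trans (*-identityʳ _) (+-congˡ (-‿cong (*-congˡ e)))
    q-iter {ρ} e (suc i) = begin
      (1# - y * ρ) * ((1# - ρ) * pow (1# - ρ) i)     ≈⟨ solve 3 (λ a b c → a :* (b :* c) := b :* (a :* c)) refl _ _ _ ⟩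
      (1# - ρ) * q ρ i                               ≈⟨ *-cong (+-congˡ (-‿cong e)) (q-iter e i) ⟩
      (1# - r x u) * (1# - iter i * r x u)           ≈⟨ solve 2 (λ r y → (con (+ 1) :- r) :* (con (+ 1) :- y :* r) := con (+ 1) :- (con (+ 1) :+ y :- y :* r) :* r) refl _ _ ⟩
      1# - iter (suc i) * r x u                      ∎

    module Expansion (ρ : Carrier) (ρ≈r : ρ ≈ r x u) (a b d : ℕ → Carrier) (k k′ : Carrier)
      (a-inv : ∀ i → a i * (x - u * (x - 1#) * q ρ i) ≈ 1#)
      (b-inv : ∀ i → b i * (x - x * u + u * (1# - ρ * v) * q ρ i) ≈ 1#)
      (d-inv : ∀ i → d i * (x - x * u + u * q ρ i) ≈ 1#)
      (k-inv : k * (1# - t * u * v * y) ≈ 1#)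
      (k′-inv : k′ * (1# - v * y * t * u) ≈ 1#) where

      factor : ℕ → Carrier
      factor i = x * (1# - q ρ i) * (x - x * u + u * q ρ i) * a i * b i

      prod : ℕ → Carrier
      prod zero    = factor 0
      prod (suc m) = prod m * factor (suc m)

      summand : ℕ → Carrier
      summand m = s * q ρ m * d m * prod m

      summands : ℕ → Carrier
      summands zero    = summand 0
      summands (suc m) = summands m + summand (suc m)

      -- The denominators of the formula are s times the factors of the functional equation: s
      -- `kernel` here, s `e` and s `h` in the next two. At t = 0 each of them is s = x + u - x u,
      -- the element assumed invertible.
      a-inv′ : ∀ i → a i * (s * kernel x u (iter i)) ≈ 1#
      a-inv′ i = trans (*-congˡ (sym (trans (+-congˡ (-‿cong (*-congˡ (q-iter ρ≈r i))))
        (solve 4 (λ x u t y → let s = x :+ u :- x :* u ; Q = con (+ 1) :- y :* (t :* s) in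
           x :- u :* (x :- con (+ 1)) :* Q := s :* (Q :+ t :* x :* y)) refl x u t (iter i))))) (a-inv i)

      d-inv′ : ∀ i → d i * (s * e x u (iter i)) ≈ 1#
      d-inv′ i = trans (*-congˡ (sym (trans (+-congˡ (*-congˡ (q-iter ρ≈r i)))
        (solve 4 (λ x u t y → let s = x :+ u :- x :* u ; Q = con (+ 1) :- y :* (t :* s) in
           x :- x :* u :+ u :* Q := s :* (con (+ 1) :- t :* u :* y)) refl x u t (iter i))))) (d-inv i)

      b-inv′ : ∀ i → b i * (s * h x u (iter i) v) ≈ 1#
      b-inv′ i = trans (*-congˡ (sym (trans (+-congˡ (*-cong (*-congˡ (+-congˡ (-‿cong (*-congʳ ρ≈r)))) (q-iter ρ≈r i)))
        (solve 5 (λ x u t y v → let s = x :+ u :- x :* u ; r = t :* s ; Q = con (+ 1) :- y :* r in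
           x :- x :* u :+ u :* (con (+ 1) :- r :* v) :* Q := s :* (con (+ 1) :- t :* u :* (y :+ v :- y :* v :* r))) refl x u t (iter i) v)))) (b-inv i)

      -- 1 - q is `iter i` times r, which supplies the factor t that makes the products tend to
      -- zero.
      factor-eq : ∀ i → factor i ≈ t * (x * iter i * s * (s * e x u (iter i)) * a i * b i)
      factor-eq i = trans (*-congʳ (*-congʳ (*-cong (*-congˡ (+-congˡ (-‿cong (q-iter ρ≈r i)))) (+-congˡ (*-congˡ (q-iter ρ≈r i))))))
        (solve 6 (λ x u t y a b → let s = x :+ u :- x :* u ; Q = con (+ 1) :- y :* (t :* s) in
           x :* (con (+ 1) :- Q) :* (x :- x :* u :+ u :* Q) :* a :* b
           := t :* (x :* y :* s :* (s :* (con (+ 1) :- t :* u :* y)) :* a :* b)) refl x u t (iter i) (a i) (b i))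

      -- `Δ₁-eq` multiplied by `iter i`. The coefficient `c` on its right is `iter (suc i)`, so the
      -- same product of iterate and `Δ₁` reappears one step further.
      unfold : ∀ i → iter i * Δ₁ x u (iter i) v ≈ factor i * (s * q ρ i * d i + iter (suc i) * Δ₁ x u (iter (suc i)) v)
      unfold i = trans (lincomb₄ (- (yᵢ * Δᵢ * (b i * (s * H)))) (- (yᵢ * Δᵢ)) (a i * b i * s * s * yᵢ) (- (x * yᵢ * t * s * s * a i * b i * Y))
          (a-inv′ i) (b-inv′ i) (Δ₁-eq x u yᵢ v) (d-inv′ i)
          (solve 14 (λ t x y s a b d kernel H E Y C Δ Δ′ →
             y :* Δ :- t :* (x :* y :* s :* (s :* E) :* a :* b) :* (s :* Y :* d :+ C :* Δ′)
             := (:- (y :* Δ :* (b :* (s :* H)))) :* (a :* (s :* kernel) :- con (+ 1))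
                :+ (:- (y :* Δ)) :* (b :* (s :* H) :- con (+ 1))
                :+ a :* b :* s :* s :* y :* (kernel :* H :* Δ :- (t :* x :* Y :+ t :* (x :* C :* E) :* Δ′))
                :+ (:- (x :* y :* t :* s :* s :* a :* b :* Y)) :* (d :* (s :* E) :- con (+ 1)))
            refl t x yᵢ s (a i) (b i) (d i) (kernel x u yᵢ) H (e x u yᵢ) Y (iter (suc i)) Δᵢ (Δ₁ x u (iter (suc i)) v)))
        (sym (*-cong (factor-eq i) (+-congʳ (*-congʳ (*-congˡ (q-iter ρ≈r i))))))
        where
        yᵢ = iter i
        Δᵢ = Δ₁ x u yᵢ v
        H = h x u yᵢ v
        Y = 1# - yᵢ * r x u

      partial-expansion : ∀ m → y * Δ₁ x u y v ≈ summands m + prod m * (iter (suc m) * Δ₁ x u (iter (suc m)) v)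
      partial-expansion zero = trans (unfold 0) (solve 5 (λ f s q d e → f :* (s :* q :* d :+ e) := s :* q :* d :* f :+ f :* e) refl _ s _ _ _)
      partial-expansion (suc m) = trans (partial-expansion m) (trans (+-congˡ (*-congˡ (unfold (suc m))))
        (solve 7 (λ S p f s q d e → S :+ p :* (f :* (s :* q :* d :+ e)) := (S :+ s :* q :* d :* (p :* f)) :+ p :* f :* e) refl _ _ _ s _ _ _))

      prod-divisible : ∀ m → Σ Carrier (λ g → prod m ≈ pow t (suc m) * g)
      prod-divisible zero = _ , trans (factor-eq 0) (*-congʳ (sym (*-identityʳ t)))
      prod-divisible (suc m) with prod-divisible m
      ... | g , eq = _ , trans (*-cong eq (factor-eq (suc m)))
        (solve 4 (λ t p g f → p :* g :* (t :* f) := t :* p :* (g :* f)) refl t _ g _)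

      pow-zero : ∀ m → N ≤ m → pow t (suc m) ≈ 0#
      pow-zero m N≤m with ℕₚ.m≤n⇒∃[o]m+o≡n N≤m
      ... | o , ≡.refl = trans (pow-+ (suc N) o) (trans (*-congʳ nil) (zeroˡ _))
        where
        pow-+ : ∀ m o → pow t (m ℕ.+ o) ≈ pow t m * pow t o
        pow-+ zero    o = sym (*-identityˡ _)
        pow-+ (suc m) o = trans (*-congˡ (pow-+ m o)) (sym (*-assoc _ _ _))

      expansion : ∀ m → N ≤ m → y * Δ₁ x u y v ≈ summands m
      expansion m N≤m with prod-divisible m
      ... | g , eq = trans (partial-expansion m) (trans (+-congˡ (trans (*-congʳ (trans eq (trans (*-congʳ (pow-zero m N≤m)) (zeroˡ g)))) (zeroˡ _))) (+-identityʳ _))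

      term : ℕ → Carrier
      term m = ρ * v * q ρ m * d m * k * prod m

      terms : ℕ → Carrier
      terms zero    = term 0
      terms (suc m) = terms m + term (suc m)

      term-eq : ∀ m → term m ≈ t * v * k * summand m
      term-eq m = trans (*-congʳ (*-congʳ (*-congʳ (*-congʳ (*-congʳ ρ≈r)))))
        (solve 7 (λ t s v q d k p → t :* s :* v :* q :* d :* k :* p := t :* v :* k :* (s :* q :* d :* p)) refl t s v _ _ k _)

      terms-eq : ∀ m → terms m ≈ t * v * k * summands m
      terms-eq zero    = term-eq 0
      terms-eq (suc m) = trans (+-cong (terms-eq m) (term-eq (suc m))) (sym (distribˡ _ _ _))

      -- M = (1 + t u v y Δ₁) / (1 - t u v y), hence Δ₁ + M = (1 + Δ₁) / (1 - t u v y): the 1 gives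
      -- the term in front and Δ₁ the sum. `k` and `k′` invert the same element, written in two
      -- orders.
      generating-function : ∀ m → N ≤ m → t * (1# * y * v * (Δ₁ x u y v + Kernel.M x u v y)) ≈ v * y * t * k′ + terms m
      generating-function m N≤m = trans (lincomb₄ (- (t * y * v * (Δ₁ x u y v + Kernel.M x u v y))) (t * y * v * k) (- (k * v * y * t)) (t * v * y * k′)
          k-inv (Kernel.M-eq x u v y) k′-inv k-inv
          (solve 8 (λ t u v y k k′ Δ M →
             t :* (con (+ 1) :* y :* v :* (Δ :+ M)) :- (v :* y :* t :* k′ :+ t :* v :* k :* (y :* Δ))
             := (:- (t :* y :* v :* (Δ :+ M))) :* (k :* (con (+ 1) :- t :* u :* v :* y) :- con (+ 1))
                :+ t :* y :* v :* k :* ((con (+ 1) :- t :* (u :* v :* y)) :* M :- (con (+ 1) :+ t :* u :* v :* y :* Δ))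
                  :+ (:- (k :* v :* y :* t)) :* (k′ :* (con (+ 1) :- v :* y :* t :* u) :- con (+ 1))
                :+ (t :* v :* y :* k′) :* (k :* (con (+ 1) :- t :* u :* v :* y) :- con (+ 1))) refl t u v y k k′ _ _))
        (+-congˡ (trans (*-congˡ (expansion m N≤m)) (sym (terms-eq m))))

-- The three power series identities

module Identities (R : CommutativeRing 0ℓ 0ℓ) where
  open CommutativeRing R hiding (zero)
  open Series R
  open StatisticSums R
  open StatisticSymmetry R
  open IntegerSolver R

  pow-1 : ∀ k → pow 1# k ≈ 1#
  pow-1 zero    = refl
  pow-1 (suc k) = trans (*-identityˡ _) (pow-1 k)

  𝒢-statisticSum : ∀ n x y u z → 𝒢 (suc n) x y u z ≈ statisticSum x u 1# y z n
  𝒢-statisticSum n x y u z = ListSums.sumL-cong R (λ s → sym (trans (*-congˡ (pow-1 (rmin s))) (*-identityʳ _))) (A (suc n))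

  𝔊-statisticSum : ∀ n x y u v → 𝔊 (suc n) x y u v ≈ statisticSum x u v y 1# n
  𝔊-statisticSum n x y u v = ListSums.sumL-cong R (λ s → sym (*-congʳ (trans (*-congˡ (pow-1 (zeroSt s))) (*-identityʳ _)))) (A (suc n))

  identity-i : Identity-i
  identity-i zero    x y u z = refl
  identity-i (suc n) x y u z = trans (𝒢-statisticSum n x y u z) (trans (asc-rep-swap x u y z n) (sym (𝒢-statisticSum n u z x y)))

  identity-iii : Identity-iii
  identity-iii zero    x y u v = refl
  identity-iii (suc n) x y u v = trans (𝔊-statisticSum n x y u v) (trans (max-rmin-swap x u v y 1# n) (sym (𝔊-statisticSum n x v u y)))

  module _ (x y u v w : Carrier) (unit : w * (x − x * u + u) ≈ 1#) (N : ℕ) where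
    open GeneratingFunction R N
    open Convolution R using (⊗≈conv; tPS-⊗-zero; tPS-⊗-suc)
    open SeriesInverse R
    open Iteration seriesRing N tPS tPS-nilpotent
    private
      module Rhs = RHS x y u v w
      open Rhs using (X; Y; U; V; r)

    r-zero : r 0 ≈ 0#
    r-zero = tPS-⊗-zero (const (x + u − x * u))

    ⊗-head : ∀ f g → (f ⊗ g) 0 ≈ f 0 * g 0
    ⊗-head f g = ⊗≈conv f g 0

    -- r has no constant term; hence the denominators containing q all start with x - x u + u,
    -- inverted by `w`.
    q-head : ∀ i → Rhs.q i 0 ≈ 1#
    q-head i = trans (⊗-head (const 1# ⊝ Y ⊗ r) (powPS (const 1# ⊝ r) i)) (trans (*-cong
      (trans (+-congˡ (-‿cong (trans (⊗-head Y r) (*-congˡ r-zero)))) (solve 1 (λ y → con (+ 1) :- y :* con (+ 0) := con (+ 1)) refl y)) (powers i)) (*-identityˡ 1#))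
      where
      powers : ∀ i → powPS (const 1# ⊝ r) i 0 ≈ 1#
      powers zero    = refl
      powers (suc i) = trans (⊗-head (const 1# ⊝ r) (powPS (const 1# ⊝ r) i)) (trans
        (*-cong (trans (+-congˡ (-‿cong r-zero)) (solve 0 (con (+ 1) :- con (+ 0) := con (+ 1)) refl)) (powers i)) (*-identityˡ 1#))

    q≡ : ∀ i → Rhs.q i ≡ q X U Y V r i
    q≡ i = ≡.cong ((const 1# ⊝ Y ⊗ r) ⊗_) (≡.sym (pow-series (const 1# ⊝ r) i))

    inverse : ∀ f {f′} w → f ≡ f′ → w * f 0 ≈ 1# → (invPS f w ⊗ f′) S.≈ S.1#
    inverse f w ≡.refl e = S.trans (S.*-comm (invPS f w) f) (λ n _ → trans (⊗≈conv f (invPS f w) n) (conv-inverse f w e n))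

    a b d : ℕ → PS
    a i = invPS (X ⊝ U ⊗ (X ⊝ const 1#) ⊗ Rhs.q i) w
    b i = invPS (X ⊝ X ⊗ U ⊕ U ⊗ (const 1# ⊝ r ⊗ V) ⊗ Rhs.q i) w
    d i = invPS (X ⊝ X ⊗ U ⊕ U ⊗ Rhs.q i) w

    r≈ : r S.≈ tPS ⊗ (X ⊕ U ⊝ X ⊗ U)
    r≈ = S.*-congˡ {tPS} (S.trans (const-+ (x + u) (- (x * u))) (S.+-cong (const-+ x u) (S.trans (const-neg (x * u)) (S.-‿cong (const-⊗ x u)))))

    X⊝X⊗U : (X ⊝ X ⊗ U) 0 ≈ x − x * u
    X⊝X⊗U = +-congˡ (-‿cong (⊗-head X U))

    open Expansion X U Y V r r≈ a b d (invPS (const 1# ⊝ tPS ⊗ U ⊗ V ⊗ Y) 1#) (invPS (const 1# ⊝ V ⊗ Y ⊗ tPS ⊗ U) 1#)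
      (λ i → inverse _ w (≡.cong (λ Q → X ⊝ U ⊗ (X ⊝ const 1#) ⊗ Q) (q≡ i)) (trans
        (*-congˡ (trans (+-congˡ (-‿cong (trans (⊗-head (U ⊗ (X ⊝ const 1#)) (Rhs.q i)) (*-cong (⊗-head U (X ⊝ const 1#)) (q-head i)))))
          (solve 2 (λ x u → x :- u :* (x :- con (+ 1)) :* con (+ 1) := x :- x :* u :+ u) refl x u))) unit))
      (λ i → inverse _ w (≡.cong (λ Q → X ⊝ X ⊗ U ⊕ U ⊗ (const 1# ⊝ r ⊗ V) ⊗ Q) (q≡ i)) (trans
        (*-congˡ (trans (+-cong X⊝X⊗U (trans (⊗-head (U ⊗ (const 1# ⊝ r ⊗ V)) (Rhs.q i)) (*-cong (trans (⊗-head U (const 1# ⊝ r ⊗ V)) (*-congˡ (+-congˡ (-‿cong (trans (⊗-head r V) (*-congʳ r-zero)))))) (q-head i))))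
          (solve 3 (λ x u v → x :- x :* u :+ u :* (con (+ 1) :- con (+ 0) :* v) :* con (+ 1) := x :- x :* u :+ u) refl x u v))) unit))
      (λ i → inverse _ w (≡.cong (λ Q → X ⊝ X ⊗ U ⊕ U ⊗ Q) (q≡ i)) (trans
        (*-congˡ (+-cong X⊝X⊗U (trans (⊗-head U (Rhs.q i)) (trans (*-congˡ (q-head i)) (*-identityʳ u))))) unit))
      (inverse _ 1# ≡.refl (trans (*-identityˡ _) (trans (+-congˡ (-‿cong (trans (⊗-head (tPS ⊗ U ⊗ V) Y) (*-congʳ (trans (⊗-head (tPS ⊗ U) V) (*-congʳ (tPS-⊗-zero U)))))))
        (solve 2 (λ v y → con (+ 1) :- con (+ 0) :* v :* y := con (+ 1)) refl v y))))
      (inverse _ 1# ≡.refl (trans (*-identityˡ _) (trans (+-congˡ (-‿cong (trans (⊗-head (V ⊗ Y ⊗ tPS) U) (*-congʳ (trans (⊗-head (V ⊗ Y) tPS) (zeroʳ _))))))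
        (solve 1 (λ u → con (+ 1) :- con (+ 0) :* u := con (+ 1)) refl u))))

    factor≡ : ∀ i → Rhs.factor i ≡ factor i
    factor≡ i = ≡.cong (λ Q → X ⊗ (const 1# ⊝ Q) ⊗ (X ⊝ X ⊗ U ⊕ U ⊗ Q) ⊗ a i ⊗ b i) (q≡ i)

    prod≡ : ∀ m → prodUpTo Rhs.factor m ≡ prod m
    prod≡ zero    = factor≡ 0
    prod≡ (suc m) = ≡.cong₂ _⊗_ (prod≡ m) (factor≡ (suc m))

    terms≡ : ∀ m → sumUpTo Rhs.term m ≡ terms m
    terms≡ m = sums m
      where
      term≡ : ∀ m → Rhs.term m ≡ term m
      term≡ m = ≡.cong₂ (λ Q P → r ⊗ V ⊗ Q ⊗ d m ⊗ invPS (const 1# ⊝ tPS ⊗ U ⊗ V ⊗ Y) 1# ⊗ P) (q≡ m) (prod≡ m)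
      sums : ∀ m → sumUpTo Rhs.term m ≡ terms m
      sums zero    = term≡ 0
      sums (suc m) = ≡.cong₂ _⊕_ (sums m) (term≡ (suc m))

    -- The degree in `totals` counts the entries after the first one, hence the extra factor t.
    𝔊-series : (λ n → 𝔊 n x y u v) S.≈ tPS ⊗ totals X U V Y (const 1#)
    𝔊-series zero    _   = sym (tPS-⊗-zero (totals X U V Y (const 1#)))
    𝔊-series (suc k) k<N = trans (𝔊-statisticSum k x y u v) (trans
      (sym (totals-coefficient x u v y 1# k (ℕₚ.<⇒≤ k<N))) (sym (tPS-⊗-suc (totals X U V Y (const 1#)) k)))

    truncated-ii : ∀ M → N ≤ M → (λ n → 𝔊 n x y u v) S.≈ Rhs.rhs M
    truncated-ii M N≤M = S.trans 𝔊-series (S.trans (S.*-congˡ {tPS} (totals-eq X U V Y (const 1#)))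
      (S.trans (generating-function M N≤M) (S.+-congˡ {Rhs.first} (S.reflexive (≡.sym (terms≡ M))))))

  identity-ii : Identity-ii
  -- The m-th product is divisible by t^(m+1), so the coefficient n is final from M = n on.
  identity-ii x y u v w unit n = n , λ M n≤M → truncated-ii x y u v w unit n M n≤M n ℕₚ.≤-refl

-- From equal generating functions to bijections

module Matching {B : Set} (F G : List ℕ → B) where
  -- Pairs the two lists position by position; s itself is the default value outside `xs`.
  assoc : List (List ℕ) → List (List ℕ) → List ℕ → List ℕ
  assoc []       zs       s = s
  assoc (x ∷ xs) []       s = s
  assoc (x ∷ xs) (z ∷ zs) s with ≡-dec _≟_ s x
  ... | yes _ = z
  ... | no  _ = assoc xs zs s

  assoc-∈ : ∀ xs zs {s} → map F xs ≡ map G zs → s ∈ xs → assoc xs zs s ∈ zs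
  assoc-∈ (x ∷ xs) (z ∷ zs) {s} eq s∈ with ≡-dec _≟_ s x
  ... | yes _ = here ≡.refl
  ... | no s≢x with s∈
  ...   | here s≡x = ⊥-elim (s≢x s≡x)
  ...   | there s∈xs = there (assoc-∈ xs zs (proj₂ (∷-injective eq)) s∈xs)

  assoc-≡ : ∀ xs zs {s} → map F xs ≡ map G zs → s ∈ xs → F s ≡ G (assoc xs zs s)
  assoc-≡ (x ∷ xs) (z ∷ zs) {s} eq s∈ with ≡-dec _≟_ s x
  ... | yes ≡.refl = proj₁ (∷-injective eq)
  ... | no s≢x with s∈
  ...   | here s≡x = ⊥-elim (s≢x s≡x)
  ...   | there s∈xs = assoc-≡ xs zs (proj₂ (∷-injective eq)) s∈xs

  assoc-injective : ∀ xs zs {s s′} → map F xs ≡ map G zs → Unique zs → s ∈ xs → s′ ∈ xs → assoc xs zs s ≡ assoc xs zs s′ → s ≡ s′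
  assoc-injective (x ∷ xs) (z ∷ zs) {s} {s′} eq (z∉ ∷ uniq) s∈ s′∈ e with ≡-dec _≟_ s x | ≡-dec _≟_ s′ x
  ... | yes p | yes q = ≡.trans p (≡.sym q)
  ... | yes p | no q with s′∈
  ...   | here r = ⊥-elim (q r)
  ...   | there r = ⊥-elim (All.lookup z∉ (assoc-∈ xs zs (proj₂ (∷-injective eq)) r) e)
  assoc-injective (x ∷ xs) (z ∷ zs) {s} {s′} eq (z∉ ∷ uniq) s∈ s′∈ e | no p | yes q with s∈
  ...   | here r = ⊥-elim (p r)
  ...   | there r = ⊥-elim (All.lookup z∉ (assoc-∈ xs zs (proj₂ (∷-injective eq)) r) (≡.sym e))
  assoc-injective (x ∷ xs) (z ∷ zs) {s} {s′} eq (z∉ ∷ uniq) s∈ s′∈ e | no p | no q with s∈ | s′∈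
  ...   | here r | _ = ⊥-elim (p r)
  ...   | there _ | here r = ⊥-elim (q r)
  ...   | there r | there r′ = assoc-injective xs zs (proj₂ (∷-injective eq)) uniq r r′ e

  assoc-surjective : ∀ xs zs {z} → map F xs ≡ map G zs → Unique xs → z ∈ zs → ∃[ s ] (s ∈ xs × assoc xs zs s ≡ z)
  assoc-surjective (x ∷ xs) (z ∷ zs) eq (x∉ ∷ uniq) (here ≡.refl) = x , here ≡.refl , found
    where
    found : assoc (x ∷ xs) (z ∷ zs) x ≡ z
    found with ≡-dec _≟_ x x
    ... | yes _ = ≡.refl
    ... | no x≢x = ⊥-elim (x≢x ≡.refl)
  assoc-surjective (x ∷ xs) (z ∷ zs) eq (x∉ ∷ uniq) (there z∈) with assoc-surjective xs zs (proj₂ (∷-injective eq)) uniq z∈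
  ... | s , s∈xs , e = s , there s∈xs , skipped
    where
    skipped : assoc (x ∷ xs) (z ∷ zs) s ≡ _
    skipped with ≡-dec _≟_ s x
    ... | yes ≡.refl = ⊥-elim (All.lookup x∉ s∈xs ≡.refl)
    ... | no _ = e

  -- The permutation of values lifts to a rearrangement `zs` of `X` whose G-values agree with the
  -- F-values of `X` position by position.
  bijection : ∀ X → Unique X → map G X ↭ map F X → ∃[ β ] (BijOn X β × (∀ {s} → s ∈ X → F s ≡ G (β s)))
  bijection X uniq perm with ↭-map-inv G perm
  ... | zs , eq , X↭zs = assoc X zs
    , ((λ s∈ → ∈-resp-↭ (↭-sym X↭zs) (assoc-∈ X zs eq s∈))
      , (λ s∈ s′∈ → assoc-injective X zs eq (PermutationSetoid.Unique-resp-↭ (≡.setoid (List ℕ)) (↭⇒↭ₛ X↭zs) uniq) s∈ s′∈)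
      , (λ s∈ → assoc-surjective X zs eq uniq (∈-resp-↭ X↭zs s∈)))
    , assoc-≡ X zs eq

invSeqs-unique : ∀ n → Unique (invSeqs n)
invSeqs-unique zero    = [] ∷ []
invSeqs-unique (suc n) = ≡.subst Unique (≡.sym (product (invSeqs n)))
  (Uniqueₚ.cartesianProductWith⁺ (λ s a → s ++ [ a ]) (λ {w} {x} {y} {z} → ∷ʳ-injective w x) (invSeqs-unique n) (Uniqueₚ.upTo⁺ (suc n)))
  where
  product : ∀ xs → concatMap (λ s → map (λ a → s ++ [ a ]) (upTo (suc n))) xs ≡ cartesianProductWith (λ s a → s ++ [ a ]) xs (upTo (suc n))
  product []       = ≡.refl
  product (s ∷ xs) = ≡.cong (map (λ a → s ++ [ a ]) (upTo (suc n)) ++_) (product xs)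

A-unique : ∀ n → Unique (A n)
A-unique n = Uniqueₚ.filter⁺ (T? ∘ isAscent) (invSeqs-unique n)

_==_ : ∀ {k} → Vec ℕ k → Vec ℕ k → Bool
[]       == []       = true
(a ∷ as) == (b ∷ bs) = (a ≡ᵇ b) ∧ (as == bs)

==-refl : ∀ {k} (as : Vec ℕ k) → (as == as) ≡ true
==-refl []       = ≡.refl
==-refl (a ∷ as) rewrite ≡ᵇ-refl a = ==-refl as

==-sound : ∀ {k} (as bs : Vec ℕ k) → (as == bs) ≡ true → as ≡ bs
==-sound []       []       _ = ≡.refl
==-sound (a ∷ as) (b ∷ bs) e with a ≡ᵇ b in eq
... | true = ≡.cong₂ _∷_ (ℕₚ.≡ᵇ⇒≡ a b (≡.subst Bool.T (≡.sym eq) tt)) (==-sound as bs e)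

multiplicity : ∀ {k} → Vec ℕ k → List (Vec ℕ k) → ℕ
multiplicity key []       = 0
multiplicity key (v ∷ vs) = (if v == key then 1 else 0) ℕ.+ multiplicity key vs

multiplicity-↭ : ∀ {k} (key : Vec ℕ k) {xs ys} → xs ↭ ys → multiplicity key xs ≡ multiplicity key ys
multiplicity-↭ key _↭_.refl          = ≡.refl
multiplicity-↭ key (_↭_.prep x p)    = ≡.cong (_ ℕ.+_) (multiplicity-↭ key p)
multiplicity-↭ key (_↭_.swap x y p)  rewrite multiplicity-↭ key p = exchange (if x == key then 1 else 0) (if y == key then 1 else 0) _
  where
  exchange : ∀ a b c → a ℕ.+ (b ℕ.+ c) ≡ b ℕ.+ (a ℕ.+ c)
  exchange a b c = ≡.trans (≡.sym (ℕₚ.+-assoc a b c)) (≡.trans (≡.cong (ℕ._+ c) (ℕₚ.+-comm a b)) (ℕₚ.+-assoc b a c))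
multiplicity-↭ key (_↭_.trans p q)   = ≡.trans (multiplicity-↭ key p) (multiplicity-↭ key q)

multiplicity-self : ∀ {k} (key : Vec ℕ k) vs → multiplicity key (key ∷ vs) ≡ suc (multiplicity key vs)
multiplicity-self key vs rewrite ==-refl key = ≡.refl

multiplicity-∈ : ∀ {k} (key : Vec ℕ k) vs → 0 < multiplicity key vs → key ∈ vs
multiplicity-∈ key (v ∷ vs) lt with v == key in eq
... | true  = here (≡.sym (==-sound v key eq))
... | false = there (multiplicity-∈ key vs lt)

multiplicities⇒↭ : ∀ {k} (xs ys : List (Vec ℕ k)) → (∀ key → multiplicity key xs ≡ multiplicity key ys) → xs ↭ ys
multiplicities⇒↭ [] []       e = ↭-refl
multiplicities⇒↭ [] (y ∷ ys) e with () ← ≡.trans (e y) (multiplicity-self y ys)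
multiplicities⇒↭ (x ∷ xs) ys e with ∈-∃++ (multiplicity-∈ x ys (≡.subst (0 <_) (≡.trans (≡.sym (multiplicity-self x xs)) (e x)) (s≤s z≤n)))
... | us , vs , ≡.refl = ↭-trans (↭-prep x (multiplicities⇒↭ xs (us ++ vs) (λ key → ℕₚ.+-cancelˡ-≡ _ _ _
        (≡.trans (e key) (multiplicity-↭ key (shift x us vs)))))) (↭-sym (shift x us vs))

-- One coordinate at a time, in the order in which the variables of `polynomials` are nested.
select : ∀ {k} {B : Set} → Vec ℕ k → (B → Vec ℕ k) → List B → List B
select []         F xs = xs
select (i ∷ key) F xs = select key (Vec.tail ∘ F) (filterᵇ (λ s → Vec.head (F s) ≡ᵇ i) xs)

length-select : ∀ {k} {B : Set} (key : Vec ℕ k) (F : B → Vec ℕ k) xs → length (select key F xs) ≡ multiplicity key (map F xs)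
length-select [] F xs = all-selected xs
  where
  all-selected : ∀ xs → length xs ≡ multiplicity [] (map F xs)
  all-selected []       = ≡.refl
  all-selected (s ∷ xs) with F s
  ... | [] = ≡.cong suc (all-selected xs)
length-select (i ∷ key) F xs = ≡.trans (length-select key (Vec.tail ∘ F) _) (filtered xs)
  where
  filtered : ∀ xs → multiplicity key (map (Vec.tail ∘ F) (filterᵇ (λ s → Vec.head (F s) ≡ᵇ i) xs)) ≡ multiplicity (i ∷ key) (map F xs)
  filtered []       = ≡.refl
  filtered (s ∷ xs) with F s in eq
  ... | a ∷ as with a ≡ᵇ i
  ...   | true  rewrite eq = ≡.cong ((if as == key then 1 else 0) ℕ.+_) (filtered xs)
  ...   | false = filtered xs

module Monomials (R : CommutativeRing 0ℓ 0ℓ) where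
  open CommutativeRing R hiding (zero)
  open Series R using (pow; sumL)

  monomial : ∀ {k} → Vec Carrier k → Vec ℕ k → Carrier
  monomial []       []       = 1#
  monomial (v ∷ vs) (a ∷ as) = pow v a * monomial vs as

  sumOver : ∀ {k} {B : Set} → Vec Carrier k → (B → Vec ℕ k) → List B → Carrier
  sumOver vs F xs = sumL (map (λ s → monomial vs (F s)) xs)

private
  module Full (R : CommutativeRing 0ℓ 0ℓ) = PowerSeriesRing R (λ _ → ⊤) (λ _ _ → tt)

-- Iterated power series over ℤ contain the polynomials, and a coefficient is read off by applying
-- the series to its exponents.
polynomials : ℕ → CommutativeRing 0ℓ 0ℓ
polynomials zero    = ℤₚ.+-*-commutativeRing
polynomials (suc k) = Full.seriesRing (polynomials k)

variables : ∀ k → Vec (CommutativeRing.Carrier (polynomials k)) k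
variables zero    = []
variables (suc k) = Series.tPS (polynomials k) ∷ Vec.map (Series.const (polynomials k)) (variables k)

module Coefficient (R : CommutativeRing 0ℓ 0ℓ) where
  open CommutativeRing R hiding (zero)
  open Series R
  open Convolution R
  open Full R
  open ListSums R
  open Monomials

  monomial-const : ∀ {k} (vs : Vec Carrier k) as → monomial seriesRing (Vec.map const vs) as PSR.≈ const (monomial R vs as)
  monomial-const []       []       = PSR.refl
  monomial-const (v ∷ vs) (a ∷ as) = PSR.trans
    (PSR.*-cong (PSR.trans (PSR.reflexive (pow-series (const v) a)) (PSR.sym (const-pow v a))) (monomial-const vs as))
    (PSR.sym (const-⊗ (pow v a) (monomial R vs as)))

  power-coefficient : ∀ a c i → (powPS tPS a ⊗ const c) i ≈ ind (a ≡ᵇ i) c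
  power-coefficient zero    c zero    = ⊗-identityˡ (const c) 0 tt
  power-coefficient zero    c (suc i) = ⊗-identityˡ (const c) (suc i) tt
  power-coefficient (suc a) c i = trans (⊗-assoc tPS (powPS tPS a) (const c) i tt) (shifted i)
    where
    shifted : ∀ i → (tPS ⊗ (powPS tPS a ⊗ const c)) i ≈ ind (suc a ≡ᵇ i) c
    shifted zero    = tPS-⊗-zero (powPS tPS a ⊗ const c)
    shifted (suc i) = trans (tPS-⊗-suc (powPS tPS a ⊗ const c) i) (power-coefficient a c i)

  sumL-coefficient : ∀ {B : Set} (f : B → PS) xs i → Series.sumL seriesRing (map f xs) i ≈ sumL (map (λ s → f s i) xs)
  sumL-coefficient f []       i = refl
  sumL-coefficient f (s ∷ xs) i = +-congˡ (sumL-coefficient f xs i)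

  sumOver-coefficient : ∀ {k} {B : Set} (vs : Vec Carrier k) (F : B → Vec ℕ (suc k)) xs i →
    sumOver seriesRing (tPS ∷ Vec.map const vs) F xs i ≈ sumOver R vs (Vec.tail ∘ F) (filterᵇ (λ s → Vec.head (F s) ≡ᵇ i) xs)
  sumOver-coefficient vs F xs i = trans (sumL-coefficient _ xs i) (trans
    (sumL-cong (λ s → coefficient (F s)) xs)
    (sym (sumL-filter (λ s → monomial R vs (Vec.tail (F s))) (λ s → Vec.head (F s) ≡ᵇ i) xs)))
    where
    coefficient : ∀ as → monomial seriesRing (tPS ∷ Vec.map const vs) as i ≈ ind (Vec.head as ≡ᵇ i) (monomial R vs (Vec.tail as))
    coefficient (a ∷ as) = trans (PSR.*-cong (PSR.reflexive (pow-series tPS a)) (monomial-const vs as) i tt)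
      (power-coefficient a (monomial R vs as) i)

-- In the generic variables the coefficient at `key` is the number of elements with that vector of
-- statistics, and ℤ has characteristic 0, so this number can be recovered.
coefficients : ∀ k {B : Set} (F G : B → Vec ℕ k) xs ys →
  CommutativeRing._≈_ (polynomials k) (Monomials.sumOver (polynomials k) (variables k) F xs) (Monomials.sumOver (polynomials k) (variables k) G ys) →
  ∀ key → length (select key F xs) ≡ length (select key G ys)
coefficients zero    F G xs ys e [] = ℤₚ.+-injective (≡.trans (≡.sym (total F xs)) (≡.trans e (total G ys)))
  where
  total : ∀ F xs → Monomials.sumOver (polynomials 0) [] F xs ≡ + length xs
  total F []       = ≡.refl
  total F (s ∷ xs) with F s
  ... | [] = ≡.cong (λ i → (+ 1) ℤ.+ i) (total F xs)
coefficients (suc k) F G xs ys e (i ∷ key) = coefficients k (Vec.tail ∘ F) (Vec.tail ∘ G) _ _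
  (trans (sym (sumOver-coefficient (variables k) F xs i)) (trans (e i tt) (sumOver-coefficient (variables k) G ys i))) key
  where
  open CommutativeRing (polynomials k)
  open Coefficient (polynomials k)

-- The identity over all rings is used at one universal point: independent variables over ℤ.
equidistribution⇒bijection : ∀ n {k} (F G : List ℕ → Vec ℕ k) →
  (∀ R vs → CommutativeRing._≈_ R (Monomials.sumOver R vs F (A n)) (Monomials.sumOver R vs G (A n))) →
  ∃[ β ] (BijOn (A n) β × (∀ {s} → s ∈ A n → F s ≡ G (β s)))
equidistribution⇒bijection n {k} F G e = Matching.bijection F G (A n) (A-unique n) (↭-sym (multiplicities⇒↭ _ _ (λ key →
  ≡.trans (≡.sym (length-select key F (A n))) (≡.trans (coefficients k F G (A n) (A n) (e (polynomials k) (variables k)) key) (length-select key G (A n))))))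

-- The three equidistributions

module _ (R : CommutativeRing 0ℓ 0ℓ) where
  open CommutativeRing R hiding (zero)
  open Series R using (pow)
  open IntegerSolver R
  open StatisticSums R
  open StatisticSymmetry R
  open Identities R using (pow-1)
  open Monomials R using (sumOver)

  asc-rep-zero-max : ∀ n (vs : Vec Carrier 4) →
    sumOver vs (λ s → asc s ∷ rep s ∷ zeroSt s ∷ maxSt s ∷ []) (A (suc n)) ≈
    sumOver vs (λ s → rep s ∷ asc s ∷ maxSt s ∷ zeroSt s ∷ []) (A (suc n))
  asc-rep-zero-max n (a ∷ b ∷ c ∷ d ∷ []) = begin
    _                            ≈⟨ ListSums.sumL-cong R (λ s → trans (solve 4 (λ a b c d → a :* (b :* (c :* (d :* con (+ 1)))) := b :* d :* a :* c :* con (+ 1)) refl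
      (pow a (asc s)) (pow b (rep s)) (pow c (zeroSt s)) (pow d (maxSt s))) (*-congˡ (sym (pow-1 (rmin s))))) (A (suc n)) ⟩
    statisticSum b a 1# d c n    ≈⟨ asc-rep-swap b a d c n ⟩
    statisticSum a b 1# c d n    ≈⟨ ListSums.sumL-cong R (λ s → trans (*-congˡ (pow-1 (rmin s))) (solve 4 (λ a b c d → a :* c :* b :* d :* con (+ 1) := a :* (b :* (c :* (d :* con (+ 1))))) refl
      (pow a (rep s)) (pow b (asc s)) (pow c (maxSt s)) (pow d (zeroSt s)))) (A (suc n)) ⟩
    _                            ∎
    where open import Relation.Binary.Reasoning.Setoid setoid

  asc-rep-max-rmin : ∀ n (vs : Vec Carrier 4) →
    sumOver vs (λ s → asc s ∷ rep s ∷ maxSt s ∷ rmin s ∷ []) (A (suc n)) ≈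
    sumOver vs (λ s → asc s ∷ rep s ∷ rmin s ∷ maxSt s ∷ []) (A (suc n))
  asc-rep-max-rmin n (a ∷ b ∷ c ∷ d ∷ []) = begin
    _                            ≈⟨ ListSums.sumL-cong R (λ s → trans (solve 4 (λ a b c d → a :* (b :* (c :* (d :* con (+ 1)))) := b :* c :* a :* con (+ 1) :* d) refl
      (pow a (asc s)) (pow b (rep s)) (pow c (maxSt s)) (pow d (rmin s))) (*-congʳ (*-congˡ (sym (pow-1 (zeroSt s)))))) (A (suc n)) ⟩
    statisticSum b a d c 1# n    ≈⟨ max-rmin-swap b a d c 1# n ⟩
    statisticSum b a c d 1# n    ≈⟨ ListSums.sumL-cong R (λ s → trans (*-congʳ (*-congˡ (pow-1 (zeroSt s)))) (solve 4 (λ a b c d → b :* d :* a :* con (+ 1) :* c := a :* (b :* (c :* (d :* con (+ 1))))) refl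
      (pow a (asc s)) (pow b (rep s)) (pow c (rmin s)) (pow d (maxSt s)))) (A (suc n)) ⟩
    _                            ∎
    where open import Relation.Binary.Reasoning.Setoid setoid

  asc-rep-zero-rmin : ∀ n (vs : Vec Carrier 4) →
    sumOver vs (λ s → asc s ∷ rep s ∷ zeroSt s ∷ rmin s ∷ []) (A (suc n)) ≈
    sumOver vs (λ s → rep s ∷ asc s ∷ rmin s ∷ zeroSt s ∷ []) (A (suc n))
  asc-rep-zero-rmin n (a ∷ b ∷ c ∷ d ∷ []) = begin
    _                            ≈⟨ ListSums.sumL-cong R (λ s → trans (solve 4 (λ a b c d → a :* (b :* (c :* (d :* con (+ 1)))) := b :* con (+ 1) :* a :* c :* d) refl
      (pow a (asc s)) (pow b (rep s)) (pow c (zeroSt s)) (pow d (rmin s))) (*-congʳ (*-congʳ (*-congʳ (*-congˡ (sym (pow-1 (maxSt s)))))))) (A (suc n)) ⟩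
    -- With max weighted by 1, the exchange moves d onto max and leaves 1 on rmin, the form that
    -- `asc-rep-swap` requires.
    statisticSum b a d 1# c n    ≈⟨ max-rmin-swap b a d 1# c n ⟩
    statisticSum b a 1# d c n    ≈⟨ asc-rep-swap b a d c n ⟩
    statisticSum a b 1# c d n    ≈⟨ max-rmin-swap a b 1# c d n ⟩
    statisticSum a b c 1# d n    ≈⟨ ListSums.sumL-cong R (λ s → trans (*-congʳ (*-congʳ (*-congʳ (*-congˡ (pow-1 (maxSt s)))))) (solve 4 (λ a b c d → a :* con (+ 1) :* b :* d :* c := a :* (b :* (c :* (d :* con (+ 1))))) refl
      (pow a (rep s)) (pow b (asc s)) (pow c (rmin s)) (pow d (zeroSt s)))) (A (suc n)) ⟩
    _                            ∎
    where open import Relation.Binary.Reasoning.Setoid setoid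

quadruple-bijection : ∀ n (f₁ f₂ f₃ f₄ g₁ g₂ g₃ g₄ : List ℕ → ℕ) →
  ∃[ β ] (BijOn (A n) β × (∀ {s} → s ∈ A n → _≡_ {A = Vec ℕ 4} (f₁ s ∷ f₂ s ∷ f₃ s ∷ f₄ s ∷ []) (g₁ (β s) ∷ g₂ (β s) ∷ g₃ (β s) ∷ g₄ (β s) ∷ []))) →
  ∃[ β ] (BijOn (A n) β × (∀ {s} → s ∈ A n → quad (f₁ s) (f₂ s) (f₃ s) (f₄ s) ≡ quad (g₁ (β s)) (g₂ (β s)) (g₃ (β s)) (g₄ (β s))))
quadruple-bijection n f₁ f₂ f₃ f₄ g₁ g₂ g₃ g₄ (β , bij , eq) = β , bij , λ s∈ → ≡.cong toQuad (eq s∈)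
  where
  toQuad : Vec ℕ 4 → ℕ × ℕ × ℕ × ℕ
  toQuad (a ∷ b ∷ c ∷ d ∷ []) = quad a b c d

theorem8 : (∀ (R : CommutativeRing 0ℓ 0ℓ) →
    Series.Identity-i R × Series.Identity-ii R × Series.Identity-iii R)
    × (∀ (n : ℕ) → 1 ≤ n →
    (∃[ β ] (BijOn (A n) β × (∀ {s} → s ∈ A n →
    quad (asc s) (rep s) (zeroSt s) (maxSt s) ≡ quad (rep (β s)) (asc (β s)) (maxSt (β s)) (zeroSt (β s)))))
    × (∃[ β ] (BijOn (A n) β × (∀ {s} → s ∈ A n →
    quad (asc s) (rep s) (maxSt s) (rmin s) ≡ quad (asc (β s)) (rep (β s)) (rmin (β s)) (maxSt (β s)))))
    × (∃[ β ] (BijOn (A n) β × (∀ {s} → s ∈ A n →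
    quad (asc s) (rep s) (zeroSt s) (rmin s) ≡ quad (rep (β s)) (asc (β s)) (rmin (β s)) (zeroSt (β s))))))
theorem8 = (λ R → Identities.identity-i R , Identities.identity-ii R , Identities.identity-iii R) , λ
  { (suc n) _ →
      quadruple-bijection (suc n) asc rep zeroSt maxSt rep asc maxSt zeroSt
        (equidistribution⇒bijection (suc n) _ _ (λ R → asc-rep-zero-max R n)) ,
      quadruple-bijection (suc n) asc rep maxSt rmin asc rep rmin maxSt
        (equidistribution⇒bijection (suc n) _ _ (λ R → asc-rep-max-rmin R n)) ,
      quadruple-bijection (suc n) asc rep zeroSt rmin rep asc rmin zeroSt
        (equidistribution⇒bijection (suc n) _ _ (λ R → asc-rep-zero-rmin R n)) }
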